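{- Let $\mathcal{M}$ be a positroid of rank $d$ on $[n]$ without loops or coloops, and let $\pi$ be its associated (fixed-point-free) decorated permutation. Then the matroid polytope $\Gamma_{\mathcal{M}}\subset\mathbb{R}^n$ is exactly the set of points $x\in\mathbb{R}^n$ satisfying the inequalities $x_i\ge 0$ for all $i\in[n]$, the equality $x_1+\cdots+x_n=d$, and the inequalities $$\sum_{l\in E}x_l\le d-\operatorname{ccw}(E^c)$$ for all cyclic intervals $E\subseteq[n]$ whose complement $E^c=[n]\setminus E$ is covered by CCW-arrows of $\pi$.
   Context: A positroid of rank $d$ on $[n]=\{1,\dots,n\}$ is a matroid whose bases are the column sets of the nonzero maximal minors of some real $d\times n$ matrix of rank $d$ all of whose maximal minors are nonnegative. The cyclically shifted order $<_i$ on $[n]$ is $i<_i i+1<_i\cdots<_i n<_i 1<_i\cdots<_i i-1$. For $a,b\in[n]$ the cyclic interval is $[a,b]=\{x\in[n]: x\le_a b\}$ (nonempty; $[a,a-1]=[n]$, indices mod $n$). Decorated permutation of a loopless and coloopless positroid $\mathcal{M}$ with rank function $\operatorname{rk}$: it is the permutation $\pi$ of $[n]$ (without fixed points) for which $\pi(i)$ is the first element $j$ in the list $i+1,i+2,\dots,i-1$ (cyclically) such that $\operatorname{rk}(\{i,i+1,\dots,j\})=\operatorname{rk}(\{i+1,\dots,j\})$. A CCW-arrow of $\pi$ is a cyclic interval of the form $[x,\pi^{ -1}(x)]$, one for each $x\in[n]$. For $S\subseteq[n]$, $\operatorname{ccw}(S)$ is the number of $x\in[n]$ with $[x,\pi^{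 -1}(x)]\subseteq S$. A set $S\subseteq[n]$ is covered by CCW-arrows of $\pi$ if each element of $S$ is contained in some CCW-arrow of $\pi$ that is itself contained in $S$ (vacuously true for $S=\emptyset$). The matroid polytope is $\Gamma_{\mathcal{M}}=\operatorname{conv}\{e_B : B \text{ a basis of }\mathcal{M}\}$ with $e_B=\sum_{i\in B}e_i$, where $e_1,\dots,e_n$ is the standard basis of $\mathbb{R}^n$. -}

module Defs where

open import Algebra.Bundles using (CommutativeRing)
import Algebra.Definitions.RawMonoid as RawMonoidDefinitions
open import Data.Bool.Base using (if_then_else_)
open import Data.Fin.Base as Fin using (Fin; zero; suc; toℕ; punchIn)
open import Data.Fin.Permutation using (Permutation′; _⟨$⟩ʳ_; _⟨$⟩ˡ_)
open import Data.Fin.Properties using (any?; _≟_)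
open import Data.Fin.Subset
  using (Subset; inside; outside; _∈_; _∉_; _⊆_; _∪_; ⁅_⁆; ∣_∣)
  renaming (_-_ to _∖_)
open import Data.Fin.Subset.Properties using (_⊆?_; anySubset?)
open import Data.List.Base as List using (List; []; _∷_; _++_; filter)
open import Data.List.Extrema.Nat using (max)
open import Data.Nat.Base as ℕ using (ℕ; zero; suc)
import Data.Nat.Properties as ℕ
open import Data.Nat.DivMod using (_%_; _mod_)
open import Data.Product.Base using (Σ; ∃; ∃₂; _×_; _,_)
import Data.Vec.Base as Vec
open import Data.Vec.Base using ([]; _∷_)
open import Data.Vec.Functional using (Vector)
open import Function.Bundles using (_⇔_)
open import Level using (Level; 0ℓ; _⊔_) renaming (suc to lsuc)
open import Relation.Binary.Core using (Rel)
open import Relation.Binary.Structures using (IsDecTotalOrder)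
open import Relation.Binary.PropositionalEquality.Core using (_≡_; _≢_)
open import Relation.Nullary.Decidable using (does; _×-dec_)
open import Relation.Nullary.Negation using (¬_)
open import Relation.Unary using (Pred; Decidable)

------------------------------------------------------------------------
-- The real numbers

-- The real numbers of classical mathematics, axiomatised as a Dedekind
-- complete (totally, decidably) ordered field; classically these axioms
-- determine ℝ up to unique isomorphism.
record RealNumbers (c ℓ : Level) : Set (lsuc (c ⊔ ℓ)) where
  infix 4 _≤_
  field
    commutativeRing : CommutativeRing c ℓ

  open CommutativeRing commutativeRing public

  field
    0≉1             : ¬ 0# ≈ 1#
    inverse         : ∀ x → ¬ x ≈ 0# → ∃ λ y → x * y ≈ 1#
    _≤_             : Rel Carrier ℓ
    isDecTotalOrder : IsDecTotalOrder _≈_ _≤_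
    +-monoˡ-≤       : ∀ z {x y} → x ≤ y → x + z ≤ y + z
    *-nonneg        : ∀ {x y} → 0# ≤ x → 0# ≤ y → 0# ≤ x * y

  UpperBound : Pred Carrier (c ⊔ ℓ) → Pred Carrier (c ⊔ ℓ)
  UpperBound P u = ∀ x → P x → x ≤ u

  field
    supremum : (P : Pred Carrier (c ⊔ ℓ)) → ∃ P → ∃ (UpperBound P) →
               ∃ λ s → UpperBound P s × (∀ u → UpperBound P u → s ≤ u)

------------------------------------------------------------------------
-- Matroids, given by their bases

record Matroid (n : ℕ) : Set₁ where
  field
    Basis    : Pred (Subset n) 0ℓ
    basis?   : Decidable Basis
    nonempty : ∃ Basis
    exchange : ∀ {B₁ B₂} → Basis B₁ → Basis B₂ →
               ∀ {x} → x ∈ B₁ → x ∉ B₂ →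
               ∃ λ y → y ∈ B₂ × y ∉ B₁ × Basis ((B₁ ∖ x) ∪ ⁅ y ⁆)

  Independent : Pred (Subset n) 0ℓ
  Independent I = ∃ λ B → Basis B × I ⊆ B

  independent? : Decidable Independent
  independent? I = anySubset? (λ B → basis? B ×-dec I ⊆? B)

  IsLoop : Pred (Fin n) 0ℓ
  IsLoop i = ∀ B → Basis B → i ∉ B

  IsColoop : Pred (Fin n) 0ℓ
  IsColoop i = ∀ B → Basis B → i ∈ B

  Loopless : Set
  Loopless = ∀ i → ¬ IsLoop i

  Coloopless : Set
  Coloopless = ∀ i → ¬ IsColoop i

subsets : ∀ n → List (Subset n)
subsets zero    = [] ∷ []
subsets (suc n) =
  List.map (outside ∷_) (subsets n) ++ List.map (inside ∷_) (subsets n)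

rk : ∀ {n} → Matroid n → Subset n → ℕ
rk {n} M S =
  max 0 (List.map ∣_∣ (filter (λ I → independent? I ×-dec I ⊆? S) (subsets n)))
  where open Matroid M

------------------------------------------------------------------------
-- Cyclic orders and cyclic intervals; the ground set [n] is Fin n

-- The 0-based position of x in the list a, a+1, …, n, 1, …, a-1, so that
-- x <ₐ y means  offset a x < offset a y.
offset : ∀ {n} → Fin n → Fin n → ℕ
offset {suc n} a x = (suc n ℕ.∸ toℕ a ℕ.+ toℕ x) % suc n

next : ∀ {n} → Fin n → Fin n
next {suc n} i = suc (toℕ i) mod suc n

⟦_,_⟧ : ∀ {n} → Fin n → Fin n → Subset n
⟦ a , b ⟧ = Vec.tabulate (λ x → does (offset a x ℕ.≤? offset a b))

IsCyclicInterval : ∀ {n} → Pred (Subset n) 0ℓ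
IsCyclicInterval E = ∃₂ λ a b → E ≡ ⟦ a , b ⟧

------------------------------------------------------------------------
-- Decorated permutations and CCW-arrows

-- For j ≢ i, the interval ⟦ next i , j ⟧ is {i+1, …, j}.
ClosesAt : ∀ {n} → Matroid n → Fin n → Fin n → Set
ClosesAt M i j = rk M ⟦ i , j ⟧ ≡ rk M ⟦ next i , j ⟧

-- π(i) is the first j in the list i+1, …, i-1 with
-- rk {i, …, j} = rk {i+1, …, j}.
IsDecoratedPermutation : ∀ {n} → Matroid n → Permutation′ n → Set
IsDecoratedPermutation M π = ∀ i →
  π ⟨$⟩ʳ i ≢ i ×
  ClosesAt M i (π ⟨$⟩ʳ i) ×
  (∀ k → k ≢ i → offset i k ℕ.< offset i (π ⟨$⟩ʳ i) → ¬ ClosesAt M i k)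

ccwArrow : ∀ {n} → Permutation′ n → Fin n → Subset n
ccwArrow π x = ⟦ x , π ⟨$⟩ˡ x ⟧

ccw : ∀ {n} → Permutation′ n → Subset n → ℕ
ccw π S = ∣ Vec.tabulate (λ x → does (ccwArrow π x ⊆? S)) ∣

CoveredByCCWArrows : ∀ {n} → Permutation′ n → Pred (Subset n) 0ℓ
CoveredByCCWArrows π S =
  ∀ y → y ∈ S → ∃ λ x → y ∈ ccwArrow π x × ccwArrow π x ⊆ S

------------------------------------------------------------------------
-- Real matrices, positroids and matroid polytopes

StrictlyIncreasing : ∀ {d n} → (Fin d → Fin n) → Set
StrictlyIncreasing f = ∀ {i j} → i Fin.< j → f i Fin.< f j

image : ∀ {d n} → (Fin d → Fin n) → Subset n
image f = Vec.tabulate (λ x → does (any? (λ k → f k ≟ x)))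

module OverReals {c ℓ} (ℝ : RealNumbers c ℓ) where
  open RealNumbers ℝ hiding (zero)
  open RawMonoidDefinitions +-rawMonoid public using (sum)
  open RawMonoidDefinitions +-rawMonoid using () renaming (_×_ to _·_)

  fromℕ : ℕ → Carrier
  fromℕ k = k · 1#

  ∑[_] : ∀ {n} → Subset n → Vector Carrier n → Carrier
  ∑[ S ] x = sum (λ l → if Vec.lookup S l then x l else 0#)

  Matrix : ℕ → ℕ → Set c
  Matrix m n = Fin m → Fin n → Carrier

  sign : ∀ {n} → Fin n → Carrier
  sign zero    = 1#
  sign (suc j) = - sign j

  -- Laplace expansion along the first row.
  det : ∀ {n} → Matrix n n → Carrier
  det {zero}  A = 1#
  det {suc n} A =
    sum (λ j → sign j * (A zero j * det (λ i k → A (suc i) (punchIn j k))))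

  -- A d-subset of the columns is given by its increasing enumeration f,
  -- so that its columns are taken in increasing order.
  minor : ∀ {d n} → Matrix d n → (Fin d → Fin n) → Carrier
  minor A f = det (λ i k → A i (f k))

  IndependentColumns : ∀ {m n} → Matrix m n → Subset n → Set (c ⊔ ℓ)
  IndependentColumns {n = n} A S = (a : Vector Carrier n) →
    (∀ i → ∑[ S ] (λ j → a j * A i j) ≈ 0#) → ∀ j → j ∈ S → a j ≈ 0#

  HasRank : ∀ {m n} → Matrix m n → ℕ → Set (c ⊔ ℓ)
  HasRank A r =
    (∃ λ S → IndependentColumns A S × ∣ S ∣ ≡ r) ×
    (∀ S → IndependentColumns A S → ∣ S ∣ ℕ.≤ r)

  IsPositroid : ∀ {n} → ℕ → Matroid n → Set (c ⊔ ℓ)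
  IsPositroid {n} d M = Σ (Matrix d n) λ A →
    HasRank A d ×
    (∀ f → StrictlyIncreasing f → 0# ≤ minor A f) ×
    (∀ B → Basis B ⇔
       (∃ λ f → StrictlyIncreasing f × B ≡ image f × ¬ minor A f ≈ 0#))
    where open Matroid M

  conv : ∀ {n p} → Pred (Vector Carrier n) p → Pred (Vector Carrier n) (c ⊔ ℓ ⊔ p)
  conv {n} P x =
    ∃ λ m → Σ (Fin m → Vector Carrier n) λ v → Σ (Vector Carrier m) λ w →
      (∀ k → P (v k)) ×
      (∀ k → 0# ≤ w k) ×
      sum w ≈ 1# ×
      (∀ i → x i ≈ sum (λ k → w k * v k i))

  e : ∀ {n} → Fin n → Vector Carrier n
  e i j = if does (i ≟ j) then 1# else 0#

  e⟨_⟩ : ∀ {n} → Subset n → Vector Carrier n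
  e⟨ B ⟩ j = ∑[ B ] (λ i → e i j)

  matroidPolytope : ∀ {n} → Matroid n → Pred (Vector Carrier n) (c ⊔ ℓ)
  matroidPolytope M = conv (λ v → ∃ λ B → Basis B × (∀ i → v i ≈ e⟨ B ⟩ i))
    where open Matroid M

-- Let rk be the rank function of M. Counting, for an interval [a , b], the i ∈ [a , b]
-- with π(i) ∉ [i , b] gives rk [a , b], so rk E + ccw (E ᶜ) = d for every cyclic interval E;
-- a complement that is not covered splits at an uncovered point into two shorter ones.
-- Hence the inequalities say exactly that x(E) ≤ rk E for every cyclic interval E.
--
-- These are bounds on differences of the partial sums of x. Rounding the partial sums
-- with a threshold s ∈ (0 , 1] preserves all of them, and averaging over s gives x back,
-- so x is a convex combination of 0/1-points obeying the same bounds.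
--
-- It remains to see that a d-set B with |B ∩ E| ≤ rk E for all cyclic intervals E is a
-- basis. Otherwise B lies in a hyperplane spanned by an independent set Q of size d − 1.
-- Let X be a gap between cyclically consecutive elements of the complement of the
-- hyperplane. If rk X > |Q ∩ X|, some y ∈ X can replace some p ∈ Q outside X. The two
-- linear functionals vanishing on Q and on Q − p + y are proportional, but the signs forced
-- by nonnegative minors at the two ends of X disagree. So |B ∩ X| ≤ rk X ≤ |Q ∩ X| for
-- all gaps X, and summing gives d ≤ d − 1.

module Submission where

open import Defs
open import Data.Bool.Base using (Bool; true; false; if_then_else_)
open import Data.Fin.Base as Fin using (Fin; zero; suc; toℕ; inject₁)
open import Data.Fin.Permutation using (Permutation′)
open import Data.Fin.Properties using (_≟_; any?; toℕ<n; toℕ-injective; toℕ-inject₁; toℕ-fromℕ)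
open import Data.Fin.Subset using (Subset; _∈_; _∉_; _⊆_; _∩_; ∁; ⁅_⁆; ∣_∣)
open import Data.Fin.Subset.Properties
open import Data.Nat.Base as ℕ using (ℕ; zero; suc)
import Data.Nat.Properties as ℕ
open import Data.Product.Base using (∃; _×_; _,_; proj₁; proj₂)
open import Data.Sum.Base using (_⊎_; inj₁; inj₂; [_,_])
open import Data.Vec.Base using (tabulate; lookup)
open import Data.Vec.Functional using (Vector)
open import Data.Vec.Properties using (lookup∘tabulate)
open import Function.Base using (_∘_)
open import Function.Bundles using (_⇔_; mk⇔)
open import Relation.Binary.PropositionalEquality as ≡ using (_≡_; _≢_; cong; cong₂; subst; module ≡-Reasoning)
open import Relation.Binary.Structures using (IsDecTotalOrder)
open import Relation.Nullary hiding (det)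
open import Relation.Nullary.Decidable using (does)

-- Rounding preserves the bounds because all the constants are integers. An interval that runs past
-- n has sum `Y (b+1) − Y a + d` in terms of the partial sums Y, so the total d enters as one more
-- integer constant. Only the fractional parts of the n + 1 partial sums influence the rounding, so
-- the average over (0 , 1] is a finite sum over the pieces into which they cut that interval.
--
-- Nonnegativity of the minors acts through one parity. Moving column j to the front of the
-- increasing enumeration of Q ∪ {j} costs the sign (-1) to the number of elements of Q below j, and
-- passing from Q to Q - p + y changes this sign exactly when j lies between p and y. Proportional
-- functionals must show the same change at all points off the hyperplane, so p and y are in the
-- same gap between two such points. Parities live in the linear order of [n], whereas gaps are
-- cyclic: the circle is cut at a point o off the hyperplane, and the corrections due to the cut
-- cancel modulo 2.
--
-- Inequalities and counts are kept in additive form throughout, so that natural numbers never have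
-- to be subtracted.

-- Counting subsets by sums of 0/1 indicators

module Counting where

  open import Data.Bool.Base using (Bool; true; false)
  open import Data.Fin.Base using (Fin; zero; suc)
  open import Data.Fin.Properties using (_≟_; any?)
  open import Data.Fin.Subset using (Subset; _∈_; _∉_; _⊆_; _∪_; _∩_; ∁; ⁅_⁆; ∣_∣)
    renaming (_-_ to _∖_)
  open import Data.Fin.Subset.Properties
  open import Data.Nat.Base
  open import Data.Nat.Properties hiding (_≟_)
  open import Data.Product.Base using (∃; _×_; _,_)
  open import Data.Sum.Base using (_⊎_; inj₁; inj₂; [_,_])
  open import Data.Vec.Base as Vec using (_∷_; []; lookup)
  open import Data.Vec.Properties using ([]=⇒lookup; lookup⇒[]=)
  open import Function.Base using (_∘_)
  open import Relation.Binary.PropositionalEquality hiding ([_])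
  open import Relation.Nullary
  open import Relation.Nullary.Decidable using (does; dec-true; dec-false)

  open import Algebra.Properties.CommutativeMonoid.Sum +-0-commutativeMonoid public
    using () renaming (sum to sumℕ; sum-permute to sumℕ-permute; ∑-comm to sumℕ-comm; ∑-distrib-+ to sumℕ-+;
        sum-cong-≗ to sumℕ-cong; sum-replicate-zero to sumℕ-zero)

  𝟙 : Bool → ℕ
  𝟙 true  = 1
  𝟙 false = 0

  𝟙? : ∀ {p} {P : Set p} → Dec P → ℕ
  𝟙? P? = 𝟙 (does P?)

  sumℕ-mono : ∀ {n} {f g : Fin n → ℕ} → (∀ i → f i ≤ g i) → sumℕ f ≤ sumℕ g
  sumℕ-mono {zero}  f≤g = z≤n
  sumℕ-mono {suc n} f≤g = +-mono-≤ (f≤g zero) (sumℕ-mono (f≤g ∘ suc))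

  sumℕ-0 : ∀ {n} {f : Fin n → ℕ} → (∀ i → f i ≡ 0) → sumℕ f ≡ 0
  sumℕ-0 {n} f≡0 = trans (sumℕ-cong f≡0) (sumℕ-zero n)

  sumℕ-single : ∀ {n} {f : Fin n → ℕ} (k : Fin n) → (∀ i → i ≢ k → f i ≡ 0) → sumℕ f ≡ f k
  sumℕ-single {suc n} {f} zero    f≡0 = trans (cong (f zero +_) (sumℕ-0 (λ i → f≡0 (suc i) λ ()))) (+-identityʳ _)
  sumℕ-single {suc n} {f} (suc k) f≡0 = trans (cong (_+ sumℕ (f ∘ suc)) (f≡0 zero λ ()))
    (sumℕ-single k (λ i i≢k → f≡0 (suc i) λ { refl → i≢k refl }))

  size : ∀ {n} (S : Subset n) → ∣ S ∣ ≡ sumℕ (𝟙 ∘ lookup S)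
  size []          = refl
  size (true ∷ S)  = cong suc (size S)
  size (false ∷ S) = size S

  ∈⇒lookup : ∀ {n} {S : Subset n} {i} → i ∈ S → lookup S i ≡ true
  ∈⇒lookup = []=⇒lookup

  lookup⇒∈ : ∀ {n} {S : Subset n} {i} → lookup S i ≡ true → i ∈ S
  lookup⇒∈ {S = S} {i} = lookup⇒[]= i S

  ∉⇒lookup : ∀ {n} {S : Subset n} {i} → i ∉ S → lookup S i ≡ false
  ∉⇒lookup {S = S} {i} i∉S with lookup S i in eq
  ... | true  = contradiction (lookup⇒∈ eq) i∉S
  ... | false = refl

  does-∈? : ∀ {n} (S : Subset n) i → lookup S i ≡ does (i ∈? S)
  does-∈? S i with i ∈? S
  ... | yes i∈S = ∈⇒lookup i∈S
  ... | no  i∉S = ∉⇒lookup i∉S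

  size-∈? : ∀ {n} (S : Subset n) → ∣ S ∣ ≡ sumℕ (λ i → 𝟙? (i ∈? S))
  size-∈? S = trans (size S) (sumℕ-cong (λ i → cong 𝟙 (does-∈? S i)))

  𝟙?-yes : ∀ {p} {P : Set p} (P? : Dec P) → P → 𝟙? P? ≡ 1
  𝟙?-yes P? p = cong 𝟙 (dec-true P? p)

  𝟙?-no : ∀ {p} {P : Set p} (P? : Dec P) → ¬ P → 𝟙? P? ≡ 0
  𝟙?-no P? p = cong 𝟙 (dec-false P? p)

  𝟙?-≤1 : ∀ {p} {P : Set p} (P? : Dec P) → 𝟙? P? ≤ 1
  𝟙?-≤1 (yes _) = ≤-refl
  𝟙?-≤1 (no _)  = z≤n

  𝟙?-mono : ∀ {p q} {P : Set p} {Q : Set q} (P? : Dec P) (Q? : Dec Q) → (P → Q) → 𝟙? P? ≤ 𝟙? Q?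
  𝟙?-mono (yes p) Q? f = ≤-reflexive (sym (𝟙?-yes Q? (f p)))
  𝟙?-mono (no ¬p) Q? f = z≤n

  𝟙?-cong : ∀ {p q} {P : Set p} {Q : Set q} (P? : Dec P) (Q? : Dec Q) → (P → Q) → (Q → P) → 𝟙? P? ≡ 𝟙? Q?
  𝟙?-cong P? Q? f g = ≤-antisym (𝟙?-mono P? Q? f) (𝟙?-mono Q? P? g)

  -- The form in which cardinalities are split: a counting identity is proved pointwise, as a
  -- disjoint case distinction for one element, and then summed.
  𝟙?-⊎ : ∀ {p q r} {P : Set p} {Q : Set q} {R : Set r} (P? : Dec P) (Q? : Dec Q) (R? : Dec R) →
         (P → Q ⊎ R) → (Q → P) → (R → P) → (Q → ¬ R) → 𝟙? P? ≡ 𝟙? Q? + 𝟙? R?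
  𝟙?-⊎ P? (yes q) (yes r) _ _ _ ¬qr = contradiction r (¬qr q)
  𝟙?-⊎ P? (yes q) (no ¬r) _ f _ _ = 𝟙?-yes P? (f q)
  𝟙?-⊎ P? (no ¬q) (yes r) _ _ g _ = 𝟙?-yes P? (g r)
  𝟙?-⊎ P? (no ¬q) (no ¬r) h _ _ _ = 𝟙?-no P? λ p → [ ¬q , ¬r ] (h p)

  size-∪-disjoint : ∀ {n} {S T : Subset n} → (∀ {i} → i ∈ S → i ∉ T) → ∣ S ∪ T ∣ ≡ ∣ S ∣ + ∣ T ∣
  size-∪-disjoint {n} {S} {T} disj = begin
    ∣ S ∪ T ∣                                               ≡⟨ size-∈? (S ∪ T) ⟩
    sumℕ (λ i → 𝟙? (i ∈? (S ∪ T)))                          ≡⟨ sumℕ-cong pw ⟩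
    sumℕ (λ i → 𝟙? (i ∈? S) + 𝟙? (i ∈? T))                  ≡⟨ sumℕ-+ {n} _ _ ⟩
    sumℕ (λ i → 𝟙? (i ∈? S)) + sumℕ (λ i → 𝟙? (i ∈? T))     ≡⟨ cong₂ _+_ (size-∈? S) (size-∈? T) ⟨
    ∣ S ∣ + ∣ T ∣                                           ∎
    where
    open ≡-Reasoning
    pw : ∀ i → 𝟙? (i ∈? (S ∪ T)) ≡ 𝟙? (i ∈? S) + 𝟙? (i ∈? T)
    pw i = 𝟙?-⊎ (i ∈? (S ∪ T)) (i ∈? S) (i ∈? T) (x∈p∪q⁻ S T)
             (λ h → x∈p∪q⁺ (inj₁ h)) (λ h → x∈p∪q⁺ (inj₂ h)) disj

  size-insert : ∀ {n} {S : Subset n} {x} → x ∉ S → ∣ S ∪ ⁅ x ⁆ ∣ ≡ suc ∣ S ∣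
  size-insert {S = S} {x} x∉S = trans
    (size-∪-disjoint (λ i∈S i∈x → x∉S (subst (_∈ S) (x∈⁅y⁆⇒x≡y x i∈x) i∈S)))
    (trans (cong (∣ S ∣ +_) (∣⁅x⁆∣≡1 x)) (+-comm _ 1))

  ∈∖⇒ : ∀ {n} {S : Subset n} {x y} → x ∈ S ∖ y → x ∈ S × x ≢ y
  ∈∖⇒ {S = S} {x} {y} x∈ = p─q⊆p S ⁅ y ⁆ x∈ , x≢y
    where
    x≢y : x ≢ y
    x≢y refl = lemma S x x∈
      where
      lemma : ∀ {n} (S : Subset n) x → x ∉ S ∖ x
      lemma (true  ∷ S) zero    ()
      lemma (false ∷ S) zero    ()
      lemma (_     ∷ S) (suc x) (Vec.there h) = lemma S x h

  size-delete : ∀ {n} {S : Subset n} {x} → x ∈ S → ∣ S ∣ ≡ suc ∣ S ∖ x ∣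
  size-delete {S = S} {x} x∈S = trans (cong ∣_∣ eq) (size-insert x∉)
    where
    x∉ : x ∉ S ∖ x
    x∉ h with ∈∖⇒ h
    ... | _ , x≢x = x≢x refl
    eq : S ≡ (S ∖ x) ∪ ⁅ x ⁆
    eq = ⊆-antisym
      (λ {i} i∈S → x∈p∪q⁺ (to i i∈S))
      (λ {i} i∈ → [ (λ h → p─q⊆p S ⁅ x ⁆ h) , (λ h → subst (_∈ S) (sym (x∈⁅y⁆⇒x≡y x h)) x∈S) ]
                    (x∈p∪q⁻ (S ∖ x) ⁅ x ⁆ i∈))
      where
      to : ∀ i → i ∈ S → i ∈ S ∖ x ⊎ i ∈ ⁅ x ⁆
      to i i∈S with i ≟ x
      ... | yes refl = inj₂ (x∈⁅x⁆ x)
      ... | no  i≢x  = inj₁ (x∈p∧x≢y⇒x∈p-y i∈S i≢x)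

  <⇒∃∉ : ∀ {n} {S T : Subset n} → ∣ S ∣ < ∣ T ∣ → ∃ λ y → y ∈ T × y ∉ S
  <⇒∃∉ {S = S} {T} S<T with any? (λ y → (y ∈? T) ×-dec ¬? (y ∈? S))
  ... | yes w  = w
  ... | no  ∄w = contradiction (p⊆q⇒∣p∣≤∣q∣ T⊆S) (<⇒≱ S<T)
    where
    T⊆S : T ⊆ S
    T⊆S {y} y∈T with y ∈? S
    ... | yes y∈S = y∈S
    ... | no  y∉S = contradiction (y , y∈T , y∉S) ∄w

  size-split : ∀ {n} (S T : Subset n) → ∣ S ∣ ≡ ∣ S ∩ T ∣ + ∣ S ∩ ∁ T ∣
  size-split {n} S T = begin
    ∣ S ∣                                                   ≡⟨ size-∈? S ⟩
    sumℕ (λ i → 𝟙? (i ∈? S))                                ≡⟨ sumℕ-cong pw ⟩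
    sumℕ (λ i → 𝟙? (i ∈? (S ∩ T)) + 𝟙? (i ∈? (S ∩ ∁ T)))    ≡⟨ sumℕ-+ {n} _ _ ⟩
    _                                                       ≡⟨ cong₂ _+_ (size-∈? (S ∩ T)) (size-∈? (S ∩ ∁ T)) ⟨
    ∣ S ∩ T ∣ + ∣ S ∩ ∁ T ∣                                  ∎
    where
    open ≡-Reasoning
    split : ∀ i → i ∈ S → i ∈ S ∩ T ⊎ i ∈ S ∩ ∁ T
    split i i∈S with i ∈? T
    ... | yes i∈T = inj₁ (x∈p∩q⁺ (i∈S , i∈T))
    ... | no  i∉T = inj₂ (x∈p∩q⁺ (i∈S , x∉p⇒x∈∁p i∉T))
    pw : ∀ i → 𝟙? (i ∈? S) ≡ 𝟙? (i ∈? (S ∩ T)) + 𝟙? (i ∈? (S ∩ ∁ T))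
    pw i = 𝟙?-⊎ (i ∈? S) (i ∈? (S ∩ T)) (i ∈? (S ∩ ∁ T)) (split i) (p∩q⊆p S T) (p∩q⊆p S (∁ T))
      (λ h k → x∈∁p⇒x∉p (p∩q⊆q S (∁ T) k) (p∩q⊆q S T h))

-- Independent sets and the rank function of a matroid given by bases

module MatroidRank where

  open Counting
  open import Data.Fin.Base using (Fin; zero; suc)
  open import Data.Fin.Properties using (_≟_; any?)
  open import Data.Fin.Subset using (Subset; _∈_; _∉_; _⊆_; _⊂_; _∪_; _∩_; ∁; ⁅_⁆; ⊥; ∣_∣; inside; outside)
    renaming (_-_ to _∖_)
  open import Data.Fin.Subset.Properties
  open import Data.List.Base as List using (List; _∷_; [])
  open import Data.List.Extrema.Nat using (xs≤max; max≤v⁺; argmax-sel)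
  open import Data.List.Membership.Propositional using () renaming (_∈_ to _∈ₗ_)
  open import Data.List.Membership.Propositional.Properties
    using (∈-map⁺; ∈-map⁻; ∈-++⁺ˡ; ∈-++⁺ʳ; ∈-filter⁺; ∈-filter⁻)
  import Data.List.Relation.Unary.All as All
  open import Data.List.Relation.Unary.Any using (here; there)
  open import Data.Nat.Base
  open import Data.Nat.Properties hiding (_≟_)
  open import Data.Product.Base using (∃; _×_; _,_; proj₁; proj₂)
  open import Data.Sum.Base using (inj₁; inj₂; [_,_])
  open import Data.Vec.Base as Vec using (_∷_; []; lookup)
  open import Function.Base using (_∘_; id)
  open import Relation.Binary.PropositionalEquality hiding ([_])
  open import Relation.Nullary

  ∈-subsets : ∀ {n} (S : Subset n) → S ∈ₗ subsets n
  ∈-subsets []                = here refl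
  ∈-subsets (outside ∷ S) = ∈-++⁺ˡ (∈-map⁺ (outside ∷_) (∈-subsets S))
  ∈-subsets (inside ∷ S)  = ∈-++⁺ʳ _ (∈-map⁺ (inside ∷_) (∈-subsets S))

  insert⊆ : ∀ {n} {S T : Subset n} {x} → S ⊆ T → x ∈ T → S ∪ ⁅ x ⁆ ⊆ T
  insert⊆ {S = S} {T} {x} S⊆T x∈T i∈ =
    [ S⊆T , (λ h → subst (_∈ T) (sym (x∈⁅y⁆⇒x≡y x h)) x∈T) ] (x∈p∪q⁻ S ⁅ x ⁆ i∈)

  ∈insert : ∀ {n} (S : Subset n) x → x ∈ S ∪ ⁅ x ⁆
  ∈insert S x = x∈p∪q⁺ (inj₂ (x∈⁅x⁆ x))

  ⊆insert : ∀ {n} (S : Subset n) x → S ⊆ S ∪ ⁅ x ⁆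
  ⊆insert S x = p⊆p∪q ⁅ x ⁆

  ⊆∧size⇒⊇ : ∀ {n} {S T : Subset n} → S ⊆ T → ∣ T ∣ ≤ ∣ S ∣ → T ⊆ S
  ⊆∧size⇒⊇ {S = S} S⊆T T≤S {i} i∈T with i ∈? S
  ... | yes i∈S = i∈S
  ... | no  i∉S = contradiction (p⊂q⇒∣p∣<∣q∣ (S⊆T , i , i∈T , i∉S)) (≤⇒≯ T≤S)

  module Rank {n} (M : Matroid n) (d : ℕ) (size-basis : ∀ {B} → Matroid.Basis M B → ∣ B ∣ ≡ d) where
    open Matroid M

    independent-⊆ : ∀ {I J} → I ⊆ J → Independent J → Independent I
    independent-⊆ I⊆J (B , b , J⊆B) = B , b , J⊆B ∘ I⊆J

    size-independent : ∀ {I} → Independent I → ∣ I ∣ ≤ d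
    size-independent (B , b , I⊆B) = ≤-trans (p⊆q⇒∣p∣≤∣q∣ I⊆B) (≤-reflexive (size-basis b))

    independent⇒basis : ∀ {I} → Independent I → ∣ I ∣ ≡ d → Basis I
    independent⇒basis (B , b , I⊆B) eq = subst Basis
      (⊆-antisym (⊆∧size⇒⊇ I⊆B (≤-reflexive (trans (size-basis b) (sym eq)))) I⊆B) b

    -- Once every element of B outside I lies in C, the bases B and C having equal size gives |B ∖
    -- I| > |C ∖ J|, so some element of B ∖ I avoids C ∖ J and therefore lies in J. Before that,
    -- each exchange either brings an element of J into a basis containing I, which finishes at
    -- once, or lowers |B ∖ C|.
    augment : ∀ {I J} → Independent I → Independent J → ∣ I ∣ < ∣ J ∣ →
              ∃ λ y → y ∈ J × y ∉ I × Independent (I ∪ ⁅ y ⁆)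
    augment {I} {J} (B , b , I⊆B) (C , c , J⊆C) I<J = go _ b I⊆B ≤-refl
      where
      -- Exchange elements of B outside I ∪ C for elements of C until there are none.
      go : ∀ k {B} → Basis B → I ⊆ B → ∣ B ∩ ∁ C ∣ ≤ k →
           ∃ λ y → y ∈ J × y ∉ I × Independent (I ∪ ⁅ y ⁆)
      go k {B} b I⊆B m≤k with any? (λ x → (x ∈? B) ×-dec (¬? (x ∈? I)) ×-dec ¬? (x ∈? C))
      go k {B} b I⊆B m≤k | no ∄x = y , y∈J , (y∉) , B , b , insert⊆ I⊆B y∈B
        where
        B⊆ : ∀ {x} → x ∈ B → x ∉ I → x ∈ C
        B⊆ {x} x∈B x∉I with x ∈? C
        ... | yes x∈C = x∈C
        ... | no  x∉C = contradiction (x , x∈B , x∉I , x∉C) ∄x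
        ∣B∩∁I∣ : ∣ B ∣ ≡ ∣ I ∣ + ∣ B ∩ ∁ I ∣
        ∣B∩∁I∣ = trans (size-split B I)
            (cong (λ S → ∣ S ∣ + ∣ B ∩ ∁ I ∣) (⊆-antisym (p∩q⊆q B I) (λ h → x∈p∩q⁺ (I⊆B h , h))))
        large : ∣ C ∩ ∁ J ∣ < ∣ B ∩ ∁ I ∣
        large = +-cancelˡ-< ∣ I ∣ _ _ (begin-strict
          ∣ I ∣ + ∣ C ∩ ∁ J ∣ <⟨ +-monoˡ-< _ I<J ⟩
          ∣ J ∣ + ∣ C ∩ ∁ J ∣ ≡⟨ cong (λ S → ∣ S ∣ + ∣ C ∩ ∁ J ∣) (⊆-antisym (p∩q⊆q C J) (λ h → x∈p∩q⁺ (J⊆C h , h))) ⟨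
          _ ≡⟨ size-split C J ⟨
          ∣ C ∣ ≡⟨ size-basis c ⟩
          d ≡⟨ size-basis b ⟨
          ∣ B ∣ ≡⟨ ∣B∩∁I∣ ⟩
          _ ∎)
          where open ≤-Reasoning
        found : ∃ λ y → y ∈ B ∩ ∁ I × y ∉ C ∩ ∁ J
        found = <⇒∃∉ large
        y = proj₁ found
        y∈B = p∩q⊆p B (∁ I) (proj₁ (proj₂ found))
        y∉ : y ∉ I
        y∉ = x∈∁p⇒x∉p (p∩q⊆q B (∁ I) (proj₁ (proj₂ found)))
        y∈J : y ∈ J
        y∈J with y ∈? J
        ... | yes h = h
        ... | no  h = contradiction (x∈p∩q⁺ (B⊆ y∈B y∉ , x∉p⇒x∈∁p h)) (proj₂ (proj₂ found))
      go k {B} b I⊆B m≤k | yes (x , x∈B , x∉I , x∉C) with exchange b c x∈B x∉C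
      ... | y , y∈C , y∉B , b′ with y ∈? J
      ...   | yes y∈J = y , y∈J , y∉B ∘ I⊆B , _ , b′ ,
                insert⊆ (λ {i} h → x∈p∪q⁺ (inj₁ (x∈p∧x≢y⇒x∈p-y (I⊆B h) λ { refl → x∉I h }))) (∈insert _ y)
      ...   | no  y∉J with k
      ...     | zero = contradiction (nonempty-size x∈) (≤⇒≯ m≤k)
        where
        x∈ : x ∈ B ∩ ∁ C
        x∈ = x∈p∩q⁺ (x∈B , x∉p⇒x∈∁p x∉C)
        nonempty-size : ∀ {S : Subset n} → x ∈ S → 0 < ∣ S ∣
        nonempty-size h = ≤-trans (≤-reflexive (sym (∣⁅x⁆∣≡1 x)))
          (p⊆q⇒∣p∣≤∣q∣ λ i∈ → subst (_∈ _) (sym (x∈⁅y⁆⇒x≡y x i∈)) h)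
      ...     | suc k′ = go k′ b′
                (λ {i} h → x∈p∪q⁺ (inj₁ (x∈p∧x≢y⇒x∈p-y (I⊆B h) λ { refl → x∉I h })))
                (s≤s⁻¹ (≤-trans (p⊂q⇒∣p∣<∣q∣ smaller) m≤k))
        where
        smaller : ((B ∖ x) ∪ ⁅ y ⁆) ∩ ∁ C ⊂ B ∩ ∁ C
        smaller = (λ {i} i∈ → x∈p∩q⁺ ([ (λ h → p─q⊆p B ⁅ x ⁆ h)
                  , (λ h → contradiction (subst (_∈ C) (sym (x∈⁅y⁆⇒x≡y y h)) y∈C) (x∈∁p⇒x∉p (p∩q⊆q _ (∁ C) i∈))) ]
                  (x∈p∪q⁻ (B ∖ x) ⁅ y ⁆ (p∩q⊆p _ (∁ C) i∈)) , p∩q⊆q _ (∁ C) i∈))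
          , x , x∈p∩q⁺ (x∈B , x∉p⇒x∈∁p x∉C)
          , λ h → [ (λ h → proj₂ (∈∖⇒ h) refl) , (λ h → x∉C (subst (_∈ C) (sym (x∈⁅y⁆⇒x≡y y h)) y∈C)) ]
                    (x∈p∪q⁻ (B ∖ x) ⁅ y ⁆ (p∩q⊆p _ (∁ C) h))

    extend : ∀ {I J} → Independent I → Independent J → ∣ I ∣ ≤ ∣ J ∣ →
             ∃ λ K → Independent K × I ⊆ K × K ⊆ I ∪ J × ∣ K ∣ ≡ ∣ J ∣
    extend {I} {J} i j I≤J = go (∣ J ∣ ∸ ∣ I ∣) i id (p⊆p∪q J) (m+[n∸m]≡n I≤J)
      where
      go : ∀ k {L} → Independent L → I ⊆ L → L ⊆ I ∪ J → ∣ L ∣ + k ≡ ∣ J ∣ →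
           ∃ λ K → Independent K × I ⊆ K × K ⊆ I ∪ J × ∣ K ∣ ≡ ∣ J ∣
      go zero {L} l I⊆L L⊆ eq = L , l , I⊆L , L⊆ , trans (sym (+-identityʳ _)) eq
      go (suc k) {L} l I⊆L L⊆ eq with augment l j
          (≤-trans (s≤s (m≤m+n ∣ L ∣ k)) (≤-reflexive (trans (sym (+-suc _ k)) eq)))
      ... | y , y∈J , y∉L , l′ = go k l′ (⊆insert L y ∘ I⊆L) (insert⊆ L⊆ (x∈p∪q⁺ (inj₂ y∈J)))
            (trans (cong (_+ k) (size-insert y∉L)) (trans (sym (+-suc _ k)) eq))

    private
      candidates : Subset n → List (Subset n)
      candidates S = List.filter (λ I → independent? I ×-dec I ⊆? S) (subsets n)

    -- With `rk≤` and `rk-attained` this is the whole interface to the list maximum that defines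
    -- `rk`.
    size≤rk : ∀ {I S} → Independent I → I ⊆ S → ∣ I ∣ ≤ rk M S
    size≤rk {I} {S} i I⊆S = All.lookup (xs≤max 0 (List.map ∣_∣ (candidates S)))
      (∈-map⁺ ∣_∣ (∈-filter⁺ (λ I → independent? I ×-dec I ⊆? S) (∈-subsets I) (i , I⊆S)))

    rk≤ : ∀ {S k} → (∀ {I} → Independent I → I ⊆ S → ∣ I ∣ ≤ k) → rk M S ≤ k
    rk≤ {S} {k} h = max≤v⁺ z≤n (All.tabulate bound)
      where
      bound : ∀ {m} → m ∈ₗ List.map ∣_∣ (candidates S) → m ≤ k
      bound m∈ with ∈-map⁻ ∣_∣ m∈
      ... | I , I∈ , refl with ∈-filter⁻ (λ I → independent? I ×-dec I ⊆? S) {xs = subsets n} I∈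
      ...   | _ , i , I⊆S = h i I⊆S

    ⊥-independent : Independent ⊥
    ⊥-independent = proj₁ nonempty , proj₂ nonempty , ⊥⊆

    rk-attained : ∀ S → ∃ λ I → Independent I × I ⊆ S × ∣ I ∣ ≡ rk M S
    rk-attained S with argmax-sel id 0 (List.map ∣_∣ (candidates S))
    ... | inj₁ eq = _ , ⊥-independent , ⊥⊆ , trans (∣⊥∣≡0 n) (sym eq)
    ... | inj₂ m∈ with ∈-map⁻ ∣_∣ m∈
    ...   | I , I∈ , eq with ∈-filter⁻ (λ I → independent? I ×-dec I ⊆? S) {xs = subsets n} I∈
    ...     | _ , i , I⊆S = I , i , I⊆S , sym eq

    rk-mono : ∀ {S T} → S ⊆ T → rk M S ≤ rk M T
    rk-mono S⊆T = rk≤ λ i I⊆S → size≤rk i (S⊆T ∘ I⊆S)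

    rk-⊤ : ∀ {S} → (∀ i → i ∈ S) → rk M S ≡ d
    rk-⊤ full with nonempty
    ... | B , b = ≤-antisym (rk≤ λ i _ → size-independent i)
      (≤-trans (≤-reflexive (sym (size-basis b))) (size≤rk (B , b , id) (λ _ → full _)))

    rk-insert : ∀ S x → rk M (S ∪ ⁅ x ⁆) ≤ suc (rk M S)
    rk-insert S x = rk≤ bound
      where
      bound : ∀ {I} → Independent I → I ⊆ S ∪ ⁅ x ⁆ → ∣ I ∣ ≤ suc (rk M S)
      bound {I} i I⊆ with x ∈? I
      ... | yes x∈I = ≤-trans (≤-reflexive (size-delete x∈I)) (s≤s (size≤rk (independent-⊆ (p─q⊆p I ⁅ x ⁆) i)
              λ h → [ id , (λ z → contradiction (x∈⁅y⁆⇒x≡y x z) (proj₂ (∈∖⇒ h))) ]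
                  (x∈p∪q⁻ S ⁅ x ⁆ (I⊆ (p─q⊆p I ⁅ x ⁆ h)))))
      ... | no  x∉I = m≤n⇒m≤1+n (size≤rk i λ h →
          [ id , (λ z → contradiction (subst (_∈ I) (x∈⁅y⁆⇒x≡y x z) h) x∉I) ] (x∈p∪q⁻ S ⁅ x ⁆ (I⊆ h)))

    -- Closure is monotone. If x raised the rank of T, extend a maximal independent I in S to a
    -- maximal independent L in T. The element that augments L from T ∪ {x} cannot lie in T, so it
    -- is x; then I ∪ {x} is independent in S ∪ {x} and exceeds its rank.
    rk-insert-closed : ∀ {S T x} → S ⊆ T → rk M (S ∪ ⁅ x ⁆) ≡ rk M S → rk M (T ∪ ⁅ x ⁆) ≡ rk M T
    rk-insert-closed {S} {T} {x} S⊆T eq = ≤-antisym (≮⇒≥ absurd) (rk-mono (⊆insert T x))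
      where
      absurd : ¬ rk M T < rk M (T ∪ ⁅ x ⁆)
      absurd lt with rk-attained S | rk-attained T | rk-attained (T ∪ ⁅ x ⁆)
      ... | I , i , I⊆S , ∣I∣ | J , j , J⊆T , ∣J∣ | K , k , K⊆ , ∣K∣
        with extend i j (≤-trans (size≤rk i (S⊆T ∘ I⊆S)) (≤-reflexive (sym ∣J∣)))
      ... | L , l , I⊆L , L⊆ , ∣L∣ with augment l k (subst₂ _<_ (sym (trans ∣L∣ ∣J∣)) (sym ∣K∣) lt)
      ... | y , y∈K , y∉L , l′ with x∈p∪q⁻ T ⁅ x ⁆ (K⊆ y∈K)
      ...   | inj₁ y∈T = <-irrefl (trans ∣L∣ ∣J∣)
          (≤-trans (≤-reflexive (sym (size-insert y∉L))) (size≤rk l′ (insert⊆ L⊆T y∈T)))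
        where
        L⊆T : L ⊆ T
        L⊆T h = [ S⊆T ∘ I⊆S , J⊆T ] (x∈p∪q⁻ I J (L⊆ h))
      ...   | inj₂ y∈x with x∈⁅y⁆⇒x≡y x y∈x
      ...     | refl = <-irrefl (trans ∣I∣ (sym eq)) (≤-trans (≤-reflexive (sym (size-insert (y∉L ∘ I⊆L))))
                  (size≤rk (independent-⊆ (insert⊆ (⊆insert L y ∘ I⊆L) (∈insert L y)) l′)
                           (insert⊆ (⊆insert S y ∘ I⊆S) (∈insert S y))))

-- Cyclic offsets and cyclic intervals

module CyclicIntervals where

  open Counting
  open MatroidRank
  open import Data.Fin.Base using (Fin; zero; suc; toℕ)
  open import Data.Fin.Permutation using (Permutation′; _⟨$⟩ʳ_; inverseˡ)
  open import Data.Fin.Properties using (_≟_; toℕ<n; toℕ-injective; toℕ-fromℕ<)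
  open import Data.Fin.Subset using (Subset; _∈_; _∉_; _⊆_; _∪_; ∁; ⁅_⁆; ∣_∣)
  open import Data.Fin.Subset.Properties
  open import Data.Nat.Base
  open import Data.Nat.DivMod
  open import Data.Nat.Properties hiding (_≟_)
  open import Data.Product.Base using (∃; _×_; _,_; proj₁; proj₂)
  open import Data.Sum.Base using (_⊎_; inj₁; inj₂; [_,_])
  open import Data.Vec.Base using (tabulate)
  open import Data.Vec.Properties using (lookup∘tabulate)
  open import Function.Base using (_∘_; id)
  open import Relation.Binary.PropositionalEquality hiding ([_])
  open import Relation.Nullary
  open import Relation.Nullary.Decidable using (does; dec-true)

  ∈-tabulate⁺ : ∀ {n p} {P : Fin n → Set p} (P? : ∀ i → Dec (P i)) {i} → P i → i ∈ tabulate (λ i → does (P? i))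
  ∈-tabulate⁺ P? {i} p = lookup⇒∈ (trans (lookup∘tabulate _ i) (dec-true (P? i) p))

  ∈-tabulate⁻ : ∀ {n p} {P : Fin n → Set p} (P? : ∀ i → Dec (P i)) {i} → i ∈ tabulate (λ i → does (P? i)) → P i
  ∈-tabulate⁻ P? {i} i∈ with P? i | trans (sym (lookup∘tabulate (λ i → does (P? i)) i)) (∈⇒lookup i∈)
  ... | yes p | _ = p
  ... | no  _ | ()

  ∈⟦⟧⁺ : ∀ {n} {a b z : Fin n} → offset a z ≤ offset a b → z ∈ ⟦ a , b ⟧
  ∈⟦⟧⁺ {a = a} {b} = ∈-tabulate⁺ (λ x → offset a x ≤? offset a b)

  ∈⟦⟧⁻ : ∀ {n} {a b z : Fin n} → z ∈ ⟦ a , b ⟧ → offset a z ≤ offset a b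
  ∈⟦⟧⁻ {a = a} {b} = ∈-tabulate⁻ (λ x → offset a x ≤? offset a b)

  %-absorbʳ : ∀ a b n .{{_ : NonZero n}} → (a + b % n) % n ≡ (a + b) % n
  %-absorbʳ a b n = begin
    (a + b % n) % n         ≡⟨ %-distribˡ-+ a (b % n) n ⟩
    (a % n + b % n % n) % n ≡⟨ cong (λ t → (a % n + t) % n) (m%n%n≡m%n b n) ⟩
    (a % n + b % n) % n     ≡⟨ %-distribˡ-+ a b n ⟨
    (a + b) % n             ∎
    where open ≡-Reasoning

  %-absorbˡ : ∀ a b n .{{_ : NonZero n}} → (a % n + b) % n ≡ (a + b) % n
  %-absorbˡ a b n = trans (cong (_% n) (+-comm (a % n) b)) (trans (%-absorbʳ b a n) (cong (_% n) (+-comm b a)))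

  module _ {m : ℕ} where
    private
      n = suc m

    offset-spec : (x z : Fin n) → (toℕ x + offset x z) % n ≡ toℕ z
    offset-spec x z = begin
      (toℕ x + (n ∸ toℕ x + toℕ z) % n) % n  ≡⟨ %-absorbʳ (toℕ x) (n ∸ toℕ x + toℕ z) n ⟩
      (toℕ x + (n ∸ toℕ x + toℕ z)) % n      ≡⟨ cong (_% n) (+-assoc (toℕ x) _ _) ⟨
      (toℕ x + (n ∸ toℕ x) + toℕ z) % n      ≡⟨ cong (λ t → (t + toℕ z) % n) (m+[n∸m]≡n (<⇒≤ (toℕ<n x))) ⟩
      (n + toℕ z) % n                        ≡⟨ cong (_% n) (+-comm n (toℕ z)) ⟩
      (toℕ z + n) % n                        ≡⟨ [m+n]%n≡m%n (toℕ z) n ⟩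
      toℕ z % n                              ≡⟨ m<n⇒m%n≡m (toℕ<n z) ⟩
      toℕ z                                  ∎
      where open ≡-Reasoning

    offset-unique : ∀ (x z : Fin n) {r} → r < n → (toℕ x + r) % n ≡ toℕ z → offset x z ≡ r
    offset-unique x z {r} r<n eq = begin
      (n ∸ toℕ x + toℕ z) % n            ≡⟨ cong (λ t → (n ∸ toℕ x + t) % n) eq ⟨
      (n ∸ toℕ x + (toℕ x + r) % n) % n  ≡⟨ %-absorbʳ (n ∸ toℕ x) (toℕ x + r) n ⟩
      (n ∸ toℕ x + (toℕ x + r)) % n      ≡⟨ cong (_% n) (+-assoc (n ∸ toℕ x) _ _) ⟨
      (n ∸ toℕ x + toℕ x + r) % n        ≡⟨ cong (λ t → (t + r) % n) (m∸n+n≡m (<⇒≤ (toℕ<n x))) ⟩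
      (n + r) % n                        ≡⟨ cong (_% n) (+-comm n r) ⟩
      (r + n) % n                        ≡⟨ [m+n]%n≡m%n r n ⟩
      r % n                              ≡⟨ m<n⇒m%n≡m r<n ⟩
      r                                  ∎
      where open ≡-Reasoning

    -- Change of origin. It allows an interval starting at x to be examined in the coordinate
    -- `offset o`, where the circle is cut open at an arbitrary point o.
    offset-change : ∀ (o x z : Fin n) {r} → r < n → (offset o x + r) % n ≡ offset o z → offset x z ≡ r
    offset-change o x z {r} r<n eq = offset-unique x z r<n (begin
      (toℕ x + r) % n                        ≡⟨ cong (λ t → (t + r) % n) (offset-spec o x) ⟨
      ((toℕ o + offset o x) % n + r) % n     ≡⟨ %-absorbˡ (toℕ o + offset o x) r n ⟩
      (toℕ o + offset o x + r) % n           ≡⟨ cong (_% n) (+-assoc (toℕ o) (offset o x) r) ⟩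
      (toℕ o + (offset o x + r)) % n         ≡⟨ %-absorbʳ (toℕ o) (offset o x + r) n ⟨
      (toℕ o + (offset o x + r) % n) % n     ≡⟨ cong (λ t → (toℕ o + t) % n) eq ⟩
      (toℕ o + offset o z) % n               ≡⟨ offset-spec o z ⟩
      toℕ z                                  ∎)
      where open ≡-Reasoning

    toℕ-next : (x : Fin n) → toℕ (next x) ≡ suc (toℕ x) % n
    toℕ-next x = toℕ-fromℕ< (m%n<n (suc (toℕ x)) n)

    offset-next-last : (b : Fin n) → offset (next b) b ≡ m
    offset-next-last b = offset-unique (next b) b (n<1+n m) (begin
      (toℕ (next b) + m) % n        ≡⟨ cong (λ t → (t + m) % n) (toℕ-next b) ⟩
      (suc (toℕ b) % n + m) % n     ≡⟨ %-absorbˡ (suc (toℕ b)) m n ⟩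
      (suc (toℕ b) + m) % n         ≡⟨ cong (_% n) (sym (+-suc (toℕ b) m)) ⟩
      (toℕ b + n) % n               ≡⟨ [m+n]%n≡m%n (toℕ b) n ⟩
      toℕ b % n                     ≡⟨ m<n⇒m%n≡m (toℕ<n b) ⟩
      toℕ b                         ∎)
      where open ≡-Reasoning

  offset< : ∀ {n} (x z : Fin n) → offset x z < n
  offset< {suc m} x z = m%n<n (suc m ∸ toℕ x + toℕ z) (suc m)

  offset-self : ∀ {n} (o : Fin n) → offset o o ≡ 0
  offset-self {suc m} o = offset-unique o o (s≤s z≤n)
    (trans (cong (_% suc m) (+-identityʳ (toℕ o))) (m<n⇒m%n≡m (toℕ<n o)))

  offset-injective : ∀ {n} (o : Fin n) {x z} → offset o x ≡ offset o z → x ≡ z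
  offset-injective {suc m} o {x} {z} eq = toℕ-injective
    (trans (sym (offset-spec o x)) (trans (cong (λ t → (toℕ o + t) % suc m) eq) (offset-spec o z)))

  offset-surjective : ∀ {n} (o : Fin n) {k} → k < n → ∃ λ z → offset o z ≡ k
  offset-surjective {suc m} o {k} k<n = z , offset-unique o z k<n (sym (toℕ-fromℕ< (m%n<n (toℕ o + k) (suc m))))
    where z = (toℕ o + k) mod suc m

  offset-≤ : ∀ {n} (o : Fin n) {x z} → offset o x ≤ offset o z → offset x z ≡ offset o z ∸ offset o x
  offset-≤ {suc m} o {x} {z} h = offset-change o x z (≤-<-trans (m∸n≤m (offset o z) (offset o x)) (offset< o z))
    (trans (cong (_% suc m) (m+[n∸m]≡n h)) (m<n⇒m%n≡m (offset< o z)))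

  offset-> : ∀ {n} (o : Fin n) {x z} → offset o z < offset o x → offset x z ≡ n + offset o z ∸ offset o x
  offset-> {suc m} o {x} {z} h = offset-change o x z
    (+-cancelˡ-< (offset o x) _ _ (<-≤-trans (≤-<-trans (≤-reflexive cancel) (+-monoʳ-< n h))
        (≤-reflexive (+-comm n (offset o x)))))
    (trans (cong (_% n) (trans cancel (+-comm n (offset o z))))
        (trans ([m+n]%n≡m%n (offset o z) n) (m<n⇒m%n≡m (offset< o z))))
    where
    n = suc m
    cancel : offset o x + (n + offset o z ∸ offset o x) ≡ n + offset o z
    cancel = m+[n∸m]≡n (≤-trans (<⇒≤ (offset< o x)) (m≤m+n n (offset o z)))

  ∈⟦next,⟧ : ∀ {n} (b z : Fin n) → z ∈ ⟦ next b , b ⟧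
  ∈⟦next,⟧ {suc m} b z = ∈⟦⟧⁺ {a = next b} {b} {z}
    (≤-trans (s≤s⁻¹ (offset< (next b) z)) (≤-reflexive (sym (offset-next-last b))))

  offset-next : ∀ {n} {a : Fin n} → 1 < n → offset a (next a) ≡ 1
  offset-next {suc m} {a} 1<n = offset-unique a (next a) 1<n
      (trans (cong (_% suc m) (+-comm (toℕ a) 1)) (sym (toℕ-next a)))

  module _ {n : ℕ} where

    module _ (o : Fin n) {x w z : Fin n} where
      private
        p = offset o

      -- Once the circle is cut at o, a cyclic interval is either a segment (straight) or the union
      -- of an initial and a final segment (wrapped). These four lemmas reduce membership to
      -- comparisons of offsets.
      ∈-straight⁻ : p x ≤ p w → z ∈ ⟦ x , w ⟧ → p x ≤ p z × p z ≤ p w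
      ∈-straight⁻ x≤w z∈ with <-≤-connex (p z) (p x)
      ... | inj₂ x≤z = x≤z , ≤-trans (m≤n+m∸n (p z) (p x))
                               (≤-trans (+-monoʳ-≤ (p x) (subst₂ _≤_ (offset-≤ o x≤z) (offset-≤ o x≤w) (∈⟦⟧⁻ z∈)))
                                        (≤-reflexive (m+[n∸m]≡n x≤w)))
      ... | inj₁ z<x = contradiction (∈⟦⟧⁻ z∈) (<⇒≱ (subst₂ _<_ (sym (offset-≤ o x≤w)) (sym (offset-> o z<x))
                         (∸-monoˡ-< (<-≤-trans (offset< o w) (m≤m+n n (p z))) x≤w)))

      ∈-straight⁺ : p x ≤ p z → p z ≤ p w → z ∈ ⟦ x , w ⟧
      ∈-straight⁺ x≤z z≤w = ∈⟦⟧⁺ (subst₂ _≤_ (sym (offset-≤ o x≤z)) (sym (offset-≤ o (≤-trans x≤z z≤w)))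
                              (∸-monoˡ-≤ (p x) z≤w))

      ∈-wrapped⁻ : p w < p x → z ∈ ⟦ x , w ⟧ → p x ≤ p z ⊎ p z ≤ p w
      ∈-wrapped⁻ w<x z∈ with <-≤-connex (p z) (p x)
      ... | inj₂ x≤z = inj₁ x≤z
      ... | inj₁ z<x = inj₂ (≮⇒≥ λ w<z → contradiction (∈⟦⟧⁻ z∈)
          (<⇒≱ (subst₂ _<_ (sym (offset-> o w<x)) (sym (offset-> o z<x))
                         (∸-monoˡ-< (+-monoʳ-< n w<z) (≤-trans (<⇒≤ (offset< o x)) (m≤m+n n _))))))

      ∈-wrapped⁺ : p w < p x → p x ≤ p z ⊎ p z ≤ p w → z ∈ ⟦ x , w ⟧
      ∈-wrapped⁺ w<x (inj₁ x≤z) = ∈⟦⟧⁺ (subst₂ _≤_ (sym (offset-≤ o x≤z)) (sym (offset-> o w<x))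
                                    (∸-monoˡ-≤ (p x) (≤-trans (<⇒≤ (offset< o z)) (m≤m+n n _))))
      ∈-wrapped⁺ w<x (inj₂ z≤w) = ∈⟦⟧⁺ (subst₂ _≤_ (sym (offset-> o (≤-<-trans z≤w w<x))) (sym (offset-> o w<x))
                                    (∸-monoˡ-≤ (p x) (+-monoʳ-≤ n z≤w)))

    first∈⟦⟧ : (a b : Fin n) → a ∈ ⟦ a , b ⟧
    first∈⟦⟧ a b = ∈⟦⟧⁺ (subst (_≤ offset a b) (sym (offset-self a)) z≤n)

    last∈⟦⟧ : (a b : Fin n) → b ∈ ⟦ a , b ⟧
    last∈⟦⟧ a b = ∈⟦⟧⁺ ≤-refl

    ∈⟦b,b⟧⇒≡ : ∀ {b z : Fin n} → z ∈ ⟦ b , b ⟧ → z ≡ b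
    ∈⟦b,b⟧⇒≡ {b} {z} z∈ = offset-injective b
        (trans (n≤0⇒n≡0 (subst (offset b z ≤_) (offset-self b) (∈⟦⟧⁻ z∈))) (sym (offset-self b)))

    ⟦b,b⟧≡⁅b⁆ : (b : Fin n) → ⟦ b , b ⟧ ≡ ⁅ b ⁆
    ⟦b,b⟧≡⁅b⁆ b = ⊆-antisym (λ h → subst (_∈ ⁅ b ⁆) (sym (∈⟦b,b⟧⇒≡ h)) (x∈⁅x⁆ b))
                    (λ h → subst (_∈ ⟦ b , b ⟧) (sym (x∈⁅y⁆⇒x≡y b h)) (first∈⟦⟧ b b))

    module _ {a b : Fin n} (a≢b : a ≢ b) where

      0<offset : 0 < offset a b
      0<offset = n≢0⇒n>0 λ eq → a≢b (offset-injective a (trans (offset-self a) (sym eq)))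

      offset-next′ : offset a (next a) ≡ 1
      offset-next′ = offset-next (≤-<-trans 0<offset (offset< a b))

      offset-from-next : offset (next a) b ≡ pred (offset a b)
      offset-from-next = trans (offset-≤ a (subst (_≤ offset a b) (sym offset-next′) 0<offset))
        (trans (cong (offset a b ∸_) offset-next′) (pred[n]≡n∸1 (offset a b)))
        where
        pred[n]≡n∸1 : ∀ k → k ∸ 1 ≡ pred k
        pred[n]≡n∸1 zero    = refl
        pred[n]≡n∸1 (suc k) = refl

      next-straight : offset a (next a) ≤ offset a b
      next-straight = subst (_≤ offset a b) (sym offset-next′) 0<offset

      ∉⟦next,⟧ : a ∉ ⟦ next a , b ⟧
      ∉⟦next,⟧ h with ∈-straight⁻ a next-straight h
      ... | l , _ = n≮n 0 (subst₂ _≤_ offset-next′ (offset-self a) l)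

      ⟦⟧-unfold : ⟦ a , b ⟧ ≡ ⟦ next a , b ⟧ ∪ ⁅ a ⁆
      ⟦⟧-unfold = ⊆-antisym to
        (insert⊆ (λ h → ∈⟦⟧⁺ (proj₂ (∈-straight⁻ a next-straight h))) (first∈⟦⟧ a b))
        where
        to : ⟦ a , b ⟧ ⊆ ⟦ next a , b ⟧ ∪ ⁅ a ⁆
        to {z} z∈ with z ≟ a
        ... | yes refl = ∈insert _ a
        ... | no  z≢a = x∈p∪q⁺ (inj₁ (∈-straight⁺ a (subst (_≤ offset a z) (sym offset-next′) 0<z) (∈⟦⟧⁻ z∈)))
          where
          0<z : 0 < offset a z
          0<z = n≢0⇒n>0 λ eq → z≢a (offset-injective a (trans eq (sym (offset-self a))))

    module _ {a b : Fin n} where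
      private
        p = offset a

      ∉⟦⟧⇒< : ∀ {z} → z ∉ ⟦ a , b ⟧ → p b < p z
      ∉⟦⟧⇒< z∉ = ≰⇒> (z∉ ∘ ∈⟦⟧⁺)

      <⇒∉⟦⟧ : ∀ {z} → p b < p z → z ∉ ⟦ a , b ⟧
      <⇒∉⟦⟧ b<z z∈ = <⇒≱ b<z (∈⟦⟧⁻ z∈)

      outside-straight : ∀ {x w} → ⟦ x , w ⟧ ⊆ ∁ ⟦ a , b ⟧ → p x ≤ p w
      outside-straight {x} {w} out = ≮⇒≥ λ w<x →
        x∈∁p⇒x∉p (out (∈-wrapped⁺ a w<x (inj₂ (subst (_≤ p w) (sym (offset-self a)) z≤n)))) (first∈⟦⟧ a b)

      -- Cut at a. Since i lies beyond b, the interval [i , b] wraps, and its complement is the open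
      -- segment between b and i. A point j there starts a segment [j , i] that stays beyond b. With
      -- `outside-arrow` this translates the condition j ∉ [i , b], for i outside [a , b], into
      -- containment of an arrow.
      arrow-outside : ∀ {i j} → i ∉ ⟦ a , b ⟧ → j ∉ ⟦ i , b ⟧ → ⟦ j , i ⟧ ⊆ ∁ ⟦ a , b ⟧
      arrow-outside {i} {j} i∉ j∉ {z} z∈ = x∉p⇒x∈∁p (<⇒∉⟦⟧ (<-≤-trans b<j (proj₁ (∈-straight⁻ a (<⇒≤ j<i) z∈))))
        where
        b<i = ∉⟦⟧⇒< i∉
        b<j : p b < p j
        b<j = ≰⇒> λ h → j∉ (∈-wrapped⁺ a b<i (inj₂ h))
        j<i : p j < p i
        j<i = ≰⇒> λ h → j∉ (∈-wrapped⁺ a b<i (inj₁ h))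

      outside-arrow : ∀ {i j} → j ≢ i → ⟦ j , i ⟧ ⊆ ∁ ⟦ a , b ⟧ → j ∉ ⟦ i , b ⟧
      outside-arrow {i} {j} j≢i out j∈ with ∈-wrapped⁻ a (∉⟦⟧⇒< (x∈∁p⇒x∉p (out (last∈⟦⟧ j i)))) j∈
      ... | inj₁ i≤j = j≢i (offset-injective a (≤-antisym (outside-straight out) i≤j))
      ... | inj₂ j≤b = <⇒≱ (∉⟦⟧⇒< (x∈∁p⇒x∉p (out (first∈⟦⟧ j i)))) j≤b

      module _ {y} (y∉ : y ∉ ⟦ a , b ⟧) where
        private
          b<y = ∉⟦⟧⇒< y∉

        -- The complement of [a , b] is a segment in the coordinate at a, and y divides it: the
        -- complement of [y , b] is the part before y, that of [a , y] the part after y. A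
        -- subinterval that misses y is in one of the two.
        arrow-one-side : ∀ {x w} → ⟦ x , w ⟧ ⊆ ∁ ⟦ a , b ⟧ → y ∉ ⟦ x , w ⟧ →
                         ⟦ x , w ⟧ ⊆ ∁ ⟦ y , b ⟧ ⊎ ⟦ x , w ⟧ ⊆ ∁ ⟦ a , y ⟧
        arrow-one-side {x} {w} out y∉⟦x,w⟧ with <-≤-connex (p y) (p x)
        ... | inj₁ y<x = inj₂ λ z∈ → x∉p⇒x∈∁p λ z∈⟦a,y⟧ →
                <⇒≱ (<-≤-trans y<x (proj₁ (∈-straight⁻ a (outside-straight out) z∈))) (∈⟦⟧⁻ z∈⟦a,y⟧)
        ... | inj₂ x≤y = inj₁ λ z∈ → x∉p⇒x∈∁p λ z∈⟦y,b⟧ →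
                [ <⇒≱ (≤-<-trans (proj₂ (∈-straight⁻ a (outside-straight out) z∈)) w<y)
                , <⇒≱ (∉⟦⟧⇒< (x∈∁p⇒x∉p (out z∈))) ] (∈-wrapped⁻ a b<y z∈⟦y,b⟧)
          where
          w<y : p w < p y
          w<y = ≰⇒> λ y≤w → y∉⟦x,w⟧ (∈-straight⁺ a x≤y y≤w)

        ⟦a,b⟧⊆⟦y,b⟧ : ⟦ a , b ⟧ ⊆ ⟦ y , b ⟧
        ⟦a,b⟧⊆⟦y,b⟧ z∈ = ∈-wrapped⁺ a b<y (inj₂ (∈⟦⟧⁻ z∈))

        ⟦a,b⟧⊆⟦a,y⟧ : ⟦ a , b ⟧ ⊆ ⟦ a , y ⟧
        ⟦a,b⟧⊆⟦a,y⟧ z∈ = ∈⟦⟧⁺ (≤-trans (∈⟦⟧⁻ z∈) (<⇒≤ b<y))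

        ∈⟦y,b⟧⊎∈⟦a,y⟧ : ∀ z → z ∈ ⟦ y , b ⟧ ⊎ z ∈ ⟦ a , y ⟧
        ∈⟦y,b⟧⊎∈⟦a,y⟧ z with ≤-total (p y) (p z)
        ... | inj₁ y≤z = inj₁ (∈-wrapped⁺ a b<y (inj₁ y≤z))
        ... | inj₂ z≤y = inj₂ (∈⟦⟧⁺ z≤y)

  -- Ranks of cyclic intervals read off the decorated permutation

  module ArrowCount {n} (M : Matroid n) (d : ℕ) (size-basis : ∀ {B} → Matroid.Basis M B → ∣ B ∣ ≡ d)
    (loopless : Matroid.Loopless M) (π : Permutation′ n) (decorated : IsDecoratedPermutation M π) where

    open Matroid M
    open Rank M d size-basis

    passes? : ∀ (a b i : Fin n) → Dec (i ∈ ⟦ a , b ⟧ × π ⟨$⟩ʳ i ∉ ⟦ i , b ⟧)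
    passes? a b i = (i ∈? ⟦ a , b ⟧) ×-dec ¬? (π ⟨$⟩ʳ i ∈? ⟦ i , b ⟧)

    -- The decorated permutation only records where a first enters the closure of the elements after
    -- it. By monotonicity of closure it stays there for every later right end b.
    closesAt⇔ : ∀ {a b} → a ≢ b → (π ⟨$⟩ʳ a ∈ ⟦ a , b ⟧ → ClosesAt M a b) × (π ⟨$⟩ʳ a ∉ ⟦ a , b ⟧ → ¬ ClosesAt M a b)
    closesAt⇔ {a} {b} a≢b = to , λ j∉ → proj₂ (proj₂ (decorated a)) b (a≢b ∘ sym) (∉⟦⟧⇒< j∉)
      where
      j = π ⟨$⟩ʳ a
      a≢j : a ≢ j
      a≢j = proj₁ (decorated a) ∘ sym
      to : j ∈ ⟦ a , b ⟧ → ClosesAt M a b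
      to j∈ = subst (λ S → rk M S ≡ rk M ⟦ next a , b ⟧) (sym (⟦⟧-unfold a≢b))
        (rk-insert-closed {⟦ next a , j ⟧} {⟦ next a , b ⟧} {a}
          (λ h → let l , u = ∈-straight⁻ a (next-straight a≢j) h in ∈-straight⁺ a l (≤-trans u (∈⟦⟧⁻ j∈)))
          (subst (λ S → rk M S ≡ rk M ⟦ next a , j ⟧) (⟦⟧-unfold a≢j) (proj₁ (proj₂ (decorated a)))))

    rk-⁅⁆ : ∀ b → rk M ⁅ b ⁆ ≡ 1
    rk-⁅⁆ b = ≤-antisym (rk≤ λ _ I⊆ → ≤-trans (p⊆q⇒∣p∣≤∣q∣ I⊆) (≤-reflexive (∣⁅x⁆∣≡1 b)))
      (≤-trans (≤-reflexive (sym (∣⁅x⁆∣≡1 b))) (size≤rk indep id))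
      where
      indep : Independent ⁅ b ⁆
      indep with independent? ⁅ b ⁆
      ... | yes i = i
      ... | no ¬i = contradiction (λ B basis b∈B → ¬i (B , basis , λ h → subst (_∈ B) (sym (x∈⁅y⁆⇒x≡y b h)) b∈B))
          (loopless b)

    -- Induction on the length, growing the interval to the left. Prepending a raises the rank by
    -- one exactly when π(a) ∉ [a , b], and the condition counted for the other elements does not
    -- mention the left end.
    rk-interval : ∀ a b → rk M ⟦ a , b ⟧ ≡ sumℕ (λ i → 𝟙? (passes? a b i))
    rk-interval a b = go (offset a b) a refl
      where
      go : ∀ k a → offset a b ≡ k → rk M ⟦ a , b ⟧ ≡ sumℕ (λ i → 𝟙? (passes? a b i))
      go zero a eq with offset-injective a (trans eq (sym (offset-self a)))
      ... | refl = begin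
        rk M ⟦ b , b ⟧                      ≡⟨ cong (rk M) (⟦b,b⟧≡⁅b⁆ b) ⟩
        rk M ⁅ b ⁆                          ≡⟨ rk-⁅⁆ b ⟩
        1
            ≡⟨ 𝟙?-yes (passes? b b b) (first∈⟦⟧ b b , λ h → proj₁ (decorated b) (∈⟦b,b⟧⇒≡ h)) ⟨
        𝟙? (passes? b b b)
            ≡⟨ sumℕ-single b (λ i i≢b → 𝟙?-no (passes? b b i) λ (h , _) → i≢b (∈⟦b,b⟧⇒≡ h)) ⟨
        sumℕ (λ i → 𝟙? (passes? b b i))     ∎
        where open ≡-Reasoning
      go (suc k) a eq = begin
        rk M ⟦ a , b ⟧                                             ≡⟨ step ⟩
        rk M ⟦ next a , b ⟧ + 𝟙? (¬? (j ∈? ⟦ a , b ⟧))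
            ≡⟨ cong₂ _+_ (go k (next a) (trans (offset-from-next a≢b) (cong pred eq))) (sym single) ⟩
        sumℕ (λ i → 𝟙? (passes? (next a) b i)) + sumℕ (λ i → 𝟙? (at? i)) ≡⟨ sumℕ-+ {n} _ _ ⟨
        sumℕ (λ i → 𝟙? (passes? (next a) b i) + 𝟙? (at? i))        ≡⟨ sumℕ-cong pointwise ⟨
        sumℕ (λ i → 𝟙? (passes? a b i))                            ∎
        where
        open ≡-Reasoning
        j = π ⟨$⟩ʳ a
        a≢b : a ≢ b
        a≢b refl = 0≢1+n (trans (sym (offset-self a)) eq)
        at? : ∀ i → Dec (i ≡ a × j ∉ ⟦ a , b ⟧)
        at? i = (i ≟ a) ×-dec ¬? (j ∈? ⟦ a , b ⟧)
        single : sumℕ (λ i → 𝟙? (at? i)) ≡ 𝟙? (¬? (j ∈? ⟦ a , b ⟧))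
        single = trans (sumℕ-single a λ i i≢a → 𝟙?-no (at? i) (i≢a ∘ proj₁))
                       (𝟙?-cong (at? a) (¬? (j ∈? ⟦ a , b ⟧)) proj₂ (refl ,_))
        pointwise : ∀ i → 𝟙? (passes? a b i) ≡ 𝟙? (passes? (next a) b i) + 𝟙? (at? i)
        pointwise i = 𝟙?-⊎ (passes? a b i) (passes? (next a) b i) (at? i)
          (λ (i∈ , h) → [ (λ i∈ → inj₁ (i∈ , h)) ,
              (λ i∈a → inj₂ (x∈⁅y⁆⇒x≡y a i∈a , subst (λ t → π ⟨$⟩ʳ t ∉ ⟦ t , b ⟧) (x∈⁅y⁆⇒x≡y a i∈a) h)) ]
                          (x∈p∪q⁻ ⟦ next a , b ⟧ ⁅ a ⁆ (subst (i ∈_) (⟦⟧-unfold a≢b) i∈)))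
          (λ (i∈ , h) → subst (i ∈_) (sym (⟦⟧-unfold a≢b)) (⊆insert _ a i∈) , h)
          (λ { (refl , h) → first∈⟦⟧ a b , h })
          (λ { (i∈ , _) (refl , _) → ∉⟦next,⟧ a≢b i∈ })
        step : rk M ⟦ a , b ⟧ ≡ rk M ⟦ next a , b ⟧ + 𝟙? (¬? (j ∈? ⟦ a , b ⟧))
        step with j ∈? ⟦ a , b ⟧
        ... | yes j∈ = trans (proj₁ (closesAt⇔ a≢b) j∈) (sym (+-identityʳ _))
        ... | no  j∉ = trans (≤-antisym
            (subst (λ S → rk M S ≤ suc (rk M ⟦ next a , b ⟧)) (sym (⟦⟧-unfold a≢b)) (rk-insert ⟦ next a , b ⟧ a))
                         (≤∧≢⇒< (rk-mono (subst (⟦ next a , b ⟧ ⊆_) (sym (⟦⟧-unfold a≢b))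
                             (⊆insert ⟦ next a , b ⟧ a))) (proj₂ (closesAt⇔ a≢b) j∉ ∘ sym)))
                       (+-comm 1 (rk M ⟦ next a , b ⟧))

    -- The full circle is written as [b+1 , b], with the same right end as [a , b], so both ranks
    -- count elements by the same condition. The surplus consists of the i outside [a , b] with π(i)
    -- ∉ [i , b]; these are the right ends of the arrows in the complement, and x = π(i) reindexes
    -- them.
    rk+ccw : ∀ a b → d ≡ rk M ⟦ a , b ⟧ + ccw π (∁ ⟦ a , b ⟧)
    rk+ccw a b = begin
      d                                                                    ≡⟨ rk-⊤ (∈⟦next,⟧ b) ⟨
      rk M ⟦ next b , b ⟧                                                  ≡⟨ rk-interval (next b) b ⟩
      sumℕ (λ i → 𝟙? (passes? (next b) b i))                               ≡⟨ sumℕ-cong pointwise ⟩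
      sumℕ (λ i → 𝟙? (passes? a b i) + 𝟙? (arrow? (π ⟨$⟩ʳ i)))              ≡⟨ sumℕ-+ {n} _ _ ⟩
      sumℕ (λ i → 𝟙? (passes? a b i)) + sumℕ (λ i → 𝟙? (arrow? (π ⟨$⟩ʳ i)))
          ≡⟨ cong₂ _+_ (rk-interval a b) (sumℕ-permute (λ x → 𝟙? (arrow? x)) π) ⟨
      rk M ⟦ a , b ⟧ + sumℕ (λ x → 𝟙? (arrow? x))                          ≡⟨ cong (rk M ⟦ a , b ⟧ +_) ccw-sum ⟨
      rk M ⟦ a , b ⟧ + ccw π (∁ ⟦ a , b ⟧)                                 ∎
      where
      open ≡-Reasoning
      arrow? : ∀ x → Dec (ccwArrow π x ⊆ ∁ ⟦ a , b ⟧)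
      arrow? x = ccwArrow π x ⊆? ∁ ⟦ a , b ⟧
      ccw-sum : ccw π (∁ ⟦ a , b ⟧) ≡ sumℕ (λ x → 𝟙? (arrow? x))
      ccw-sum = trans (size (tabulate (λ x → does (arrow? x))))
                      (sumℕ-cong {n} (λ x → cong 𝟙 (lookup∘tabulate (λ x → does (arrow? x)) x)))
      arrow-at : ∀ i → ccwArrow π (π ⟨$⟩ʳ i) ≡ ⟦ π ⟨$⟩ʳ i , i ⟧
      arrow-at i = cong (λ t → ⟦ π ⟨$⟩ʳ i , t ⟧) (inverseˡ π)
      pointwise : ∀ i → 𝟙? (passes? (next b) b i) ≡ 𝟙? (passes? a b i) + 𝟙? (arrow? (π ⟨$⟩ʳ i))
      pointwise i = 𝟙?-⊎ (passes? (next b) b i) (passes? a b i) (arrow? (π ⟨$⟩ʳ i))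
        split
        (λ (_ , h) → ∈⟦next,⟧ b i , h)
        (λ out → ∈⟦next,⟧ b i , outside-arrow (proj₁ (decorated i)) (subst (_⊆ _) (arrow-at i) out))
        (λ (i∈ , _) out → x∈∁p⇒x∉p (subst (_⊆ _) (arrow-at i) out (last∈⟦⟧ _ i)) i∈)
        where
        split : i ∈ ⟦ next b , b ⟧ × π ⟨$⟩ʳ i ∉ ⟦ i , b ⟧ →
                (i ∈ ⟦ a , b ⟧ × π ⟨$⟩ʳ i ∉ ⟦ i , b ⟧) ⊎ ccwArrow π (π ⟨$⟩ʳ i) ⊆ ∁ ⟦ a , b ⟧
        split (_ , h) with i ∈? ⟦ a , b ⟧
        ... | yes i∈ = inj₁ (i∈ , h)
        ... | no  i∉ = inj₂ (subst (_⊆ _) (sym (arrow-at i)) (arrow-outside i∉ h))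

-- Bases recognised by their intersections with cyclic intervals

module IntervalBases where

  open Counting
  open MatroidRank
  open CyclicIntervals
  open import Data.Bool.Base using (Bool; true; false; _xor_)
  open import Data.Fin.Base as Fin using (Fin; zero; suc; toℕ)
  open import Data.Fin.Properties as Fin using (_≟_; toℕ<n)
  open import Data.Fin.Subset using (Subset; _∈_; _∉_; _⊆_; _∪_; _∩_; ⊥; ⁅_⁆; ∣_∣)
    renaming (_-_ to _∖_)
  open import Data.Fin.Subset.Properties
  open import Data.Nat.Base
  open import Data.Nat.DivMod
  open import Data.Nat.Properties hiding (_≟_)
  open import Data.Product.Base using (∃; _×_; _,_; proj₁; proj₂)
  open import Data.Sum.Base using (_⊎_; inj₁; inj₂; [_,_])
  open import Function.Base using (_∘_; id)
  open import Relation.Binary.Definitions using (tri<; tri≈; tri>)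
  open import Relation.Binary.PropositionalEquality hiding ([_])
  open import Relation.Nullary
  open import Relation.Nullary.Decidable using (does; dec-true; dec-false)

  _<ᶠ_ : ∀ {n} → Fin n → Fin n → Bool
  i <ᶠ j = does (i Fin.<? j)

  offset-straight : ∀ {n} {o z : Fin n} → toℕ o ≤ toℕ z → offset o z ≡ toℕ z ∸ toℕ o
  offset-straight {suc m} {o} {z} o≤z = offset-unique o z (≤-<-trans (m∸n≤m (toℕ z) (toℕ o)) (toℕ<n z))
    (trans (cong (_% suc m) (m+[n∸m]≡n o≤z)) (m<n⇒m%n≡m (toℕ<n z)))

  offset-wrapped : ∀ {n} {o z : Fin n} → toℕ z < toℕ o → toℕ o + offset o z ≡ n + toℕ z
  offset-wrapped {suc m} {o} {z} z<o = trans (cong (toℕ o +_) (offset-unique o z small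
      (trans (cong (_% n) (trans cancel (+-comm n (toℕ z)))) (trans ([m+n]%n≡m%n (toℕ z) n) (m<n⇒m%n≡m (toℕ<n z))))))
    cancel
    where
    n = suc m
    cancel : toℕ o + (n + toℕ z ∸ toℕ o) ≡ n + toℕ z
    cancel = m+[n∸m]≡n (≤-trans (<⇒≤ (toℕ<n o)) (m≤m+n n (toℕ z)))
    small : n + toℕ z ∸ toℕ o < n
    small = +-cancelˡ-< (toℕ o) _ _
        (<-≤-trans (≤-<-trans (≤-reflexive cancel) (+-monoʳ-< n z<o)) (≤-reflexive (+-comm n (toℕ o))))

  does-≡⇒ : ∀ {P Q : Set} (P? : Dec P) (Q? : Dec Q) → does P? ≡ does Q? → P → Q
  does-≡⇒ P?       (yes q) eq p = q
  does-≡⇒ (yes _)  (no _)  ()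
  does-≡⇒ (no ¬p)  (no _)  eq p = contradiction p ¬p

  does-⇔-xor : ∀ {P Q : Set} (P? : Dec P) (Q? : Dec Q) → (P → Q) → (Q → P) → does P? ≡ does Q? xor false
  does-⇔-xor (yes p) Q? f g = sym (cong (_xor false) (dec-true Q? (f p)))
  does-⇔-xor (no ¬p) Q? f g = sym (cong (_xor false) (dec-false Q? (¬p ∘ g)))

  -- Cutting at o instead of at the beginning lifts the points before o by n. A comparison is
  -- reversed exactly when one of its two points is lifted and the other is not.
  <ᶠ-offset : ∀ {n} (o z w : Fin n) → z <ᶠ w ≡ does (offset o z <? offset o w) xor ((z <ᶠ o) xor (w <ᶠ o))
  <ᶠ-offset {n} o z w with z Fin.<? o | w Fin.<? o
  ... | no z≮o | no w≮o = trans (does-⇔-xor (z Fin.<? w) (offset o z <? offset o w)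
    (λ z<w → subst₂ _<_ (sym pz) (sym pw) (∸-monoˡ-< z<w o≤z))
    (λ pz<pw → +-cancelˡ-< 0 _ _ (subst₂ _<_ (trans (cong (toℕ o +_) pz) (m+[n∸m]≡n o≤z))
        (trans (cong (toℕ o +_) pw) (m+[n∸m]≡n o≤w)) (+-monoʳ-< (toℕ o) pz<pw))))
    (cong₂ (λ s t → does (offset o z <? offset o w) xor (s xor t))
      (sym (dec-false (z Fin.<? o) z≮o)) (sym (dec-false (w Fin.<? o) w≮o)))
    where
    o≤z = ≮⇒≥ z≮o
    o≤w = ≮⇒≥ w≮o
    pz = offset-straight {o = o} {z} o≤z
    pw = offset-straight {o = o} {w} o≤w
  ... | no z≮o | yes w<o = trans
      (trans (dec-false (z Fin.<? w) λ z<w → <⇒≱ (<-trans z<w w<o) (≮⇒≥ z≮o))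
          (sym (cong (_xor true) (dec-true (offset o z <? offset o w) lt))))
    (cong₂ (λ s t → does (offset o z <? offset o w) xor (s xor t))
      (sym (dec-false (z Fin.<? o) z≮o)) (sym (dec-true (w Fin.<? o) w<o)))
    where
    lt : offset o z < offset o w
    lt = +-cancelˡ-< (toℕ o) _ _ (subst₂ _<_
        (sym (trans (cong (toℕ o +_) (offset-straight {o = o} {z} (≮⇒≥ z≮o))) (m+[n∸m]≡n (≮⇒≥ z≮o))))
           (sym (offset-wrapped {o = o} {w} w<o)) (<-≤-trans (toℕ<n z) (m≤m+n n (toℕ w))))
  ... | yes z<o | no w≮o = trans
      (trans (dec-true (z Fin.<? w) (<-≤-trans z<o (≮⇒≥ w≮o)))
          (sym (cong (_xor true) (dec-false (offset o z <? offset o w) ge))))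
    (cong₂ (λ s t → does (offset o z <? offset o w) xor (s xor t))
      (sym (dec-true (z Fin.<? o) z<o)) (sym (dec-false (w Fin.<? o) w≮o)))
    where
    ge : ¬ offset o z < offset o w
    ge lt = <⇒≱ (+-monoʳ-< (toℕ o) lt)
        (subst₂ _≤_ (sym (trans (cong (toℕ o +_) (offset-straight {o = o} {w} (≮⇒≥ w≮o))) (m+[n∸m]≡n (≮⇒≥ w≮o))))
           (sym (offset-wrapped {o = o} {z} z<o)) (≤-trans (<⇒≤ (toℕ<n w)) (m≤m+n n (toℕ z))))
  ... | yes z<o | yes w<o = trans (does-⇔-xor (z Fin.<? w) (offset o z <? offset o w)
    (λ z<w → +-cancelˡ-< (toℕ o) _ _ (subst₂ _<_ (sym pz) (sym pw) (+-monoʳ-< n z<w)))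
    (λ pz<pw → +-cancelˡ-< n _ _ (subst₂ _<_ pz pw (+-monoʳ-< (toℕ o) pz<pw))))
    (cong₂ (λ s t → does (offset o z <? offset o w) xor (s xor t))
      (sym (dec-true (z Fin.<? o) z<o)) (sym (dec-true (w Fin.<? o) w<o)))
    where
    pz = offset-wrapped {o = o} {z} z<o
    pw = offset-wrapped {o = o} {w} w<o

  xor-cancel : ∀ a b c d e → (a xor (c xor e)) xor (b xor (d xor e)) ≡ c xor d → a ≡ b
  xor-cancel true  true  c     d     e     _  = refl
  xor-cancel false false c     d     e     _  = refl
  xor-cancel true  false true  true  true  ()
  xor-cancel true  false true  true  false ()
  xor-cancel true  false true  false true  ()
  xor-cancel true  false true  false false ()
  xor-cancel true  false false true  true  ()
  xor-cancel true  false false true  false ()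
  xor-cancel true  false false false true  ()
  xor-cancel true  false false false false ()
  xor-cancel false true  true  true  true  ()
  xor-cancel false true  true  true  false ()
  xor-cancel false true  true  false true  ()
  xor-cancel false true  true  false false ()
  xor-cancel false true  false true  true  ()
  xor-cancel false true  false true  false ()
  xor-cancel false true  false false true  ()
  xor-cancel false true  false false false ()

  -- Combinatorial shadow of total nonnegativity: if Q and Q − p + y span the same
  -- hyperplane, then p and y are not separated by two elements outside of it.
  Noncrossing : ∀ {n} → Matroid n → ℕ → Set
  Noncrossing M m = ∀ {Q p y d₁ d₂} → ∣ Q ∣ ≡ m → p ∈ Q → y ∉ Q → ¬ Basis (Q ∪ ⁅ y ⁆) →
    Basis (Q ∪ ⁅ d₁ ⁆) → Basis (Q ∪ ⁅ d₂ ⁆) →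
    Basis (((Q ∖ p) ∪ ⁅ y ⁆) ∪ ⁅ d₁ ⁆) → Basis (((Q ∖ p) ∪ ⁅ y ⁆) ∪ ⁅ d₂ ⁆) →
    (p <ᶠ d₁) xor (y <ᶠ d₁) ≡ (p <ᶠ d₂) xor (y <ᶠ d₂)
    where open Matroid M

  module IntervalRanks {n} (M : Matroid n) (m : ℕ) (size-basis : ∀ {B} → Matroid.Basis M B → ∣ B ∣ ≡ suc m)
    (noncrossing : Noncrossing M m) where

    open Matroid M
    open Rank M (suc m) size-basis

    module Hyperplane {Q} (q : Independent Q) (∣Q∣ : ∣ Q ∣ ≡ m) {o} (o-out : Basis (Q ∪ ⁅ o ⁆)) where

      -- The complement of the hyperplane spanned by Q.
      Out : Fin n → Set
      Out j = Basis (Q ∪ ⁅ j ⁆)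

      p : Fin n → ℕ
      p = offset o

      out⇒∉ : ∀ {j} → Out j → j ∉ Q
      out⇒∉ {j} b j∈Q = 1+n≰n (subst₂ _≤_ (size-basis b) ∣Q∣ (p⊆q⇒∣p∣≤∣q∣ (insert⊆ id j∈Q)))

      independent⇒out : ∀ {j} → j ∉ Q → Independent (Q ∪ ⁅ j ⁆) → Out j
      independent⇒out j∉Q i = independent⇒basis i (trans (size-insert j∉Q) (cong suc ∣Q∣))

      -- Since Q ∪ {y} is no basis, Q - x + y spans the same hyperplane as Q and has the same points
      -- outside. Concretely, augmenting it from Q ∪ {e} must add e: adding x instead would make Q ∪
      -- {y} independent of full size.
      swap-out : ∀ {x y e} → x ∈ Q → y ∉ Q → ¬ Out y → Independent ((Q ∖ x) ∪ ⁅ y ⁆) → Out e →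
                 Basis (((Q ∖ x) ∪ ⁅ y ⁆) ∪ ⁅ e ⁆)
      swap-out {x} {y} {e} x∈Q y∉Q ¬out i out-e = from (augment i (_ , out-e , id)
          (≤-reflexive (trans (cong suc ∣Q′∣) (sym (size-basis out-e)))))
        where
        Q′ = (Q ∖ x) ∪ ⁅ y ⁆
        y∉Q∖x : y ∉ Q ∖ x
        y∉Q∖x = y∉Q ∘ proj₁ ∘ ∈∖⇒ {S = Q}
        ∣Q′∣ : ∣ Q′ ∣ ≡ m
        ∣Q′∣ = trans (size-insert y∉Q∖x) (trans (sym (size-delete x∈Q)) ∣Q∣)
        from : (∃ λ z → z ∈ Q ∪ ⁅ e ⁆ × z ∉ Q′ × Independent (Q′ ∪ ⁅ z ⁆)) → Basis (Q′ ∪ ⁅ e ⁆)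
        from (z , z∈ , z∉ , i′) with x∈p∪q⁻ Q ⁅ e ⁆ z∈
        ... | inj₂ z∈e with x∈⁅y⁆⇒x≡y e z∈e
        ...   | refl = independent⇒basis i′ (trans (size-insert z∉) (cong suc ∣Q′∣))
        from (z , z∈ , z∉ , i′) | inj₁ z∈Q with z ≟ x
        ...   | no z≢x = contradiction (⊆insert _ y (x∈p∧x≢y⇒x∈p-y z∈Q z≢x)) z∉
        ...   | yes refl = contradiction
            (independent⇒out y∉Q (independent-⊆ (insert⊆ Q⊆ (⊆insert _ z (∈insert (Q ∖ z) y))) i′)) ¬out
          where
          Q⊆ : Q ⊆ Q′ ∪ ⁅ z ⁆
          Q⊆ {i} i∈Q with i ≟ z
          ... | yes refl = ∈insert Q′ i
          ... | no  i≢z  = ⊆insert _ z (⊆insert _ y (x∈p∧x≢y⇒x∈p-y i∈Q i≢z))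

      same-side : ∀ {x y e} → x ∈ Q → y ∉ Q → ¬ Out y → Independent ((Q ∖ x) ∪ ⁅ y ⁆) → Out e →
                  does (p x <? p e) ≡ does (p y <? p e)
      -- `Noncrossing` compares e with the origin o in the linear order. After the change of origin
      -- the bit of e occurs twice, and the bits of x and y occur on both sides, so all corrections
      -- cancel.
      same-side {x} {y} {e} x∈Q y∉Q ¬out i out-e = xor-cancel _ _ (x <ᶠ o) (y <ᶠ o) (e <ᶠ o)
        (subst₂ (λ a b → a xor b ≡ (x <ᶠ o) xor (y <ᶠ o)) (<ᶠ-offset o x e) (<ᶠ-offset o y e)
          (noncrossing ∣Q∣ x∈Q y∉Q ¬out out-e o-out (swap-out x∈Q y∉Q ¬out i out-e) (swap-out x∈Q y∉Q ¬out i o-out)))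

      same-side-< : ∀ {x y e} → x ∈ Q → y ∉ Q → ¬ Out y → Independent ((Q ∖ x) ∪ ⁅ y ⁆) → Out e →
                    (p x < p e → p y < p e) × (p y < p e → p x < p e)
      same-side-< {x} {y} {e} x∈Q y∉Q ¬out i out-e =
        does-≡⇒ (p x <? p e) (p y <? p e) eq , does-≡⇒ (p y <? p e) (p x <? p e) (sym eq)
        where eq = same-side x∈Q y∉Q ¬out i out-e

      -- As large as Q and containing y ∉ Q, the set K must omit some x ∈ Q, and by size it is then
      -- all of Q - x + y. That x avoids K is what later places it outside the gap.
      missing : ∀ {K y} → Independent K → K ⊆ Q ∪ ⁅ y ⁆ → ∣ K ∣ ≡ ∣ Q ∣ → y ∈ K → y ∉ Q →
                ∃ λ x → x ∈ Q × x ∉ K × Independent ((Q ∖ x) ∪ ⁅ y ⁆)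
      missing {K} {y} i K⊆ ∣K∣ y∈K y∉Q = from
        (<⇒∃∉ (subst (∣ K ∩ Q ∣ <_) ∣K∣ (p⊂q⇒∣p∣<∣q∣ (p∩q⊆p K Q , y , y∈K , λ h → y∉Q (p∩q⊆q K Q h)))))
        where
        from : (∃ λ x → x ∈ Q × x ∉ K ∩ Q) → ∃ λ x → x ∈ Q × x ∉ K × Independent ((Q ∖ x) ∪ ⁅ y ⁆)
        from (x , x∈Q , x∉) = x , x∈Q , x∉K , independent-⊆ (⊆∧size⇒⊇ K⊆Q′ (≤-reflexive
            (trans (size-insert (y∉Q ∘ proj₁ ∘ ∈∖⇒ {S = Q})) (trans (sym (size-delete x∈Q)) (sym ∣K∣))))) i
          where
          x∉K : x ∉ K
          x∉K x∈K = x∉ (x∈p∩q⁺ (x∈K , x∈Q))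
          K⊆Q′ : K ⊆ (Q ∖ x) ∪ ⁅ y ⁆
          K⊆Q′ {z} z∈K with x∈p∪q⁻ Q ⁅ y ⁆ (K⊆ z∈K)
          ... | inj₁ z∈Q = ⊆insert _ y (x∈p∧x≢y⇒x∈p-y z∈Q λ { refl → x∉K z∈K })
          ... | inj₂ z∈y = x∈p∪q⁺ (inj₂ z∈y)

      -- k is the offset of the point of Out that follows e, with n standing for o itself.
      record Gap (e : Fin n) (k : ℕ) : Set where
        field
          left    : Out e
          right   : (∃ λ e′ → Out e′ × p e′ ≡ k) ⊎ k ≡ n
          between : ∀ z → p e < p z → p z < k → ¬ Out z

      module _ {e k} (gap : Gap e k) where
        open Gap gap

        Inside : Fin n → Set
        Inside z = p e < p z × p z < k

        -- A larger independent set in X yields y ∈ X such that (Q ∩ X) ∪ {y} is independent.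
        -- Extending this inside Q ∪ {y} loses some x ∈ Q outside X, yet comparison with the two
        -- ends of the gap forces x between them, hence into X.
        rk-gap : ∀ {a b} → (∀ {z} → z ∈ ⟦ a , b ⟧ → Inside z) → (∀ {z} → Inside z → z ∈ ⟦ a , b ⟧) →
                 rk M ⟦ a , b ⟧ ≤ ∣ Q ∩ ⟦ a , b ⟧ ∣
        rk-gap {a} {b} sound complete = rk≤ λ j J⊆ → ≮⇒≥ λ lt → absurd J⊆ (augment (independent-⊆ (p∩q⊆p Q X) q) j lt)
          where
          X = ⟦ a , b ⟧
          absurd : ∀ {J} → J ⊆ X → ¬ (∃ λ y → y ∈ J × y ∉ Q ∩ X × Independent ((Q ∩ X) ∪ ⁅ y ⁆))
          absurd J⊆ (y , y∈J , y∉ , i) = x-inside x-pos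
            where
            y∈X = J⊆ y∈J
            y-in = sound y∈X
            y∉Q : y ∉ Q
            y∉Q y∈Q = y∉ (x∈p∩q⁺ (y∈Q , y∈X))
            ¬out : ¬ Out y
            ¬out = between y (proj₁ y-in) (proj₂ y-in)
            -- Otherwise Q is contained in X, and Q ∪ {y} is independent, so y would be off the
            -- hyperplane.
            small : ∣ (Q ∩ X) ∪ ⁅ y ⁆ ∣ ≤ ∣ Q ∣
            small = ≤-trans (≤-reflexive (size-insert y∉)) (≰⇒> λ Q≤ →
              ¬out (independent⇒out y∉Q (independent-⊆
                (insert⊆ (⊆insert _ y ∘ ⊆∧size⇒⊇ (p∩q⊆p Q X) Q≤) (∈insert _ y)) i)))
            ext = extend i q small
            K = proj₁ ext
            K-indep = proj₁ (proj₂ ext)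
            ⊆K = proj₁ (proj₂ (proj₂ ext))
            K⊆ : K ⊆ Q ∪ ⁅ y ⁆
            K⊆ h = [ insert⊆ (⊆insert Q y ∘ p∩q⊆p Q X) (∈insert Q y) , ⊆insert Q y ]
                     (x∈p∪q⁻ ((Q ∩ X) ∪ ⁅ y ⁆) Q (proj₁ (proj₂ (proj₂ (proj₂ ext))) h))
            lost = missing K-indep K⊆ (proj₂ (proj₂ (proj₂ (proj₂ ext)))) (⊆K (∈insert _ y)) y∉Q
            x = proj₁ lost
            x∈Q = proj₁ (proj₂ lost)
            x∉K = proj₁ (proj₂ (proj₂ lost))
            side = λ {e} → same-side-< {x} {y} {e} x∈Q y∉Q ¬out (proj₂ (proj₂ (proj₂ lost)))
            below : (∃ λ e′ → Out e′ × p e′ ≡ k) ⊎ k ≡ n → p x < k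
            below (inj₁ (e′ , out′ , refl)) = proj₂ (side out′) (proj₂ y-in)
            -- The last gap ends at o again, whose second copy has offset n, above all offsets.
            below (inj₂ refl)               = offset< o x
            x-pos : Inside x
            x-pos = ≤∧≢⇒< (≮⇒≥ λ x<e → <-asym (proj₁ y-in) (proj₁ (side left) x<e))
                          (λ eq → out⇒∉ left (subst (_∈ Q) (sym (offset-injective o eq)) x∈Q))
                  , below right
            x-inside : ¬ Inside x
            x-inside h = x∉K (⊆K (⊆insert _ y (x∈p∩q⁺ (x∈Q , complete h))))

        inside? : ∀ z → Dec (Inside z)
        inside? z = (p e <? p z) ×-dec (p z <? k)

        gap-count : ∀ {B} → p e < k → k ≤ n → (∀ a b → ∣ B ∩ ⟦ a , b ⟧ ∣ ≤ rk M ⟦ a , b ⟧) →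
                    sumℕ (λ z → 𝟙? ((z ∈? B) ×-dec inside? z)) ≤ sumℕ (λ z → 𝟙? ((z ∈? Q) ×-dec inside? z))
        gap-count {B} e<k k≤n bound with suc (p e) <? k
        -- An empty gap is treated apart because cyclic intervals are nonempty.
        ... | no ¬room = sumℕ-mono λ z → 𝟙?-mono ((z ∈? B) ×-dec inside? z) ((z ∈? Q) ×-dec inside? z)
                λ (_ , e<z , z<k) → contradiction (≤-trans (s≤s e<z) z<k) ¬room
        ... | yes room = subst₂ _≤_ (count B) (count Q) (≤-trans (bound a b) (rk-gap sound complete))
          where
          start = offset-surjective o (<-≤-trans room k≤n)
          end   = offset-surjective o {pred k} (<-≤-trans (pred-< e<k) k≤n)
            where
            pred-< : ∀ {i j} → i < j → pred j < j
            pred-< {j = suc j} _ = ≤-refl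
          a = proj₁ start
          b = proj₁ end
          suc-pred′ : ∀ {i j} → i < j → suc (pred j) ≡ j
          suc-pred′ {j = suc j} _ = refl
          a≤b : p a ≤ p b
          a≤b = subst₂ _≤_ (sym (proj₂ start)) (sym (proj₂ end))
              (s≤s⁻¹ (subst (suc (suc (p e)) ≤_) (sym (suc-pred′ e<k)) room))
          sound : ∀ {z} → z ∈ ⟦ a , b ⟧ → Inside z
          sound {z} z∈ with ∈-straight⁻ o a≤b z∈
          ... | l , u = subst (_≤ p z) (proj₂ start) l
                      , subst (suc (p z) ≤_) (suc-pred′ e<k) (s≤s (subst (p z ≤_) (proj₂ end) u))
          complete : ∀ {z} → Inside z → z ∈ ⟦ a , b ⟧
          complete {z} (l , u) = ∈-straight⁺ o (subst (_≤ p z) (sym (proj₂ start)) l)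
            (subst (p z ≤_) (sym (proj₂ end)) (s≤s⁻¹ (subst (suc (p z) ≤_) (sym (suc-pred′ e<k)) u)))
          count : ∀ S → ∣ S ∩ ⟦ a , b ⟧ ∣ ≡ sumℕ (λ z → 𝟙? ((z ∈? S) ×-dec inside? z))
          count S = trans (size-∈? (S ∩ ⟦ a , b ⟧))
              (sumℕ-cong λ z → 𝟙?-cong (z ∈? (S ∩ ⟦ a , b ⟧)) ((z ∈? S) ×-dec inside? z)
            (λ h → p∩q⊆p S _ h , sound (p∩q⊆q S _ h)) (λ (h , h′) → x∈p∩q⁺ (h , complete h′)))

      prefix : ℕ → Subset n → ℕ
      prefix k S = sumℕ (λ z → 𝟙? ((z ∈? S) ×-dec (p z <? k)))

      prefix-split : ∀ {e k S} → e ∉ S → (gap : Gap e k) → p e < k →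
                     prefix k S ≡ prefix (p e) S + sumℕ (λ z → 𝟙? ((z ∈? S) ×-dec inside? gap z))
      prefix-split {e} {k} {S} e∉S gap e<k = trans (sumℕ-cong pointwise) (sumℕ-+ {n} _ _)
        where
        pointwise : ∀ z → 𝟙? ((z ∈? S) ×-dec (p z <? k)) ≡ 𝟙? ((z ∈? S) ×-dec (p z <? p e)) + 𝟙?
            ((z ∈? S) ×-dec inside? gap z)
        pointwise z = 𝟙?-⊎ ((z ∈? S) ×-dec (p z <? k)) ((z ∈? S) ×-dec (p z <? p e)) ((z ∈? S) ×-dec inside? gap z)
          split (λ (z∈ , l) → z∈ , <-trans l e<k) (λ (z∈ , _ , u) → z∈ , u) (λ (_ , l) (_ , l′ , _) → <-asym l l′)
          where
          split : z ∈ S × p z < k → (z ∈ S × p z < p e) ⊎ (z ∈ S × p e < p z × p z < k)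
          split (z∈ , u) with <-cmp (p z) (p e)
          ... | tri< l _ _ = inj₁ (z∈ , l)
          ... | tri> _ _ g = inj₂ (z∈ , g , u)
          ... | tri≈ _ eq _ = contradiction (subst (_∈ S) (offset-injective o eq) z∈) e∉S

      module _ {B} (B-in : ∀ {z} → z ∈ B → ¬ Out z) (bound : ∀ a b → ∣ B ∩ ⟦ a , b ⟧ ∣ ≤ rk M ⟦ a , b ⟧) where

        close-gap : ∀ {e k} → Gap e k → p e < k → k ≤ n → prefix (p e) B ≤ prefix (p e) Q → prefix k B ≤ prefix k Q
        close-gap gap e<k k≤n le = subst₂ _≤_
          (sym (prefix-split (λ h → B-in h (Gap.left gap)) gap e<k)) (sym (prefix-split (out⇒∉ (Gap.left gap)) gap e<k))
          (+-mono-≤ le (gap-count gap e<k k≤n bound))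

        -- The invariant follows the last point e off the hyperplane with offset at most k, and
        -- compares B with Q only before e. Neither set contains e, so each time a new such point is
        -- met the comparison grows by exactly one gap.
        sweep : ∀ k → suc k ≤ n → ∃ λ e → Out e × p e ≤ k × (∀ z → p e < p z → p z ≤ k → ¬ Out z) ×
                prefix (p e) B ≤ prefix (p e) Q
        sweep zero 0<n = o , o-out , ≤-reflexive (offset-self o)
          , (λ z l u → contradiction (≤-trans l u) (n≮0))
          , ≤-trans (≤-reflexive (sumℕ-0 λ z → 𝟙?-no ((z ∈? B) ×-dec (p z <? p o))
              λ (_ , l) → n≮0 (subst (p z <_) (offset-self o) l))) z≤n
        sweep (suc k) k<n with sweep k (<⇒≤ k<n) | offset-surjective o k<n
        ... | e , out , e≤k , between , le | z , pz with basis? (Q ∪ ⁅ z ⁆)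
        ...   | yes out′ = z , out′ , ≤-reflexive pz , (λ w l u → contradiction (<-≤-trans l u) (<-irrefl pz))
                  , subst (λ t → prefix t B ≤ prefix t Q) (sym pz)
                      (close-gap (record { left = out ; right = inj₁ (z , out′ , pz) ; between = λ w l u → between
                          w l (s≤s⁻¹ u) })
                                 (s≤s e≤k) (<⇒≤ k<n) le)
        ...   | no ¬out′ = e , out , m≤n⇒m≤1+n e≤k , between′ , le
          where
          between′ : ∀ w → p e < p w → p w ≤ suc k → ¬ Out w
          between′ w l u with m≤n⇒m<n∨m≡n u
          ... | inj₁ w<k = between w l (s≤s⁻¹ w<k)
          ... | inj₂ eq rewrite offset-injective o (trans eq (sym pz)) = ¬out′

        size≤ : ∣ B ∣ ≤ ∣ Q ∣
        size≤ = finish n refl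
          where
          whole : ∀ S → prefix n S ≡ ∣ S ∣
          whole S = trans (sumℕ-cong λ z → 𝟙?-cong ((z ∈? S) ×-dec (p z <? n)) (z ∈? S) proj₁
              (λ h → h , offset< o z)) (sym (size-∈? S))
          finish : ∀ k → k ≡ n → ∣ B ∣ ≤ ∣ Q ∣
          finish zero    eq = contradiction (subst (p o <_) (sym eq) (offset< o o)) n≮0
          finish (suc k) eq with sweep k (≤-reflexive eq)
          ... | e , out , e≤k , between , le = subst₂ _≤_ (whole B) (whole Q)
            (close-gap (record { left = out ; right = inj₂ refl ; between = λ w l u → between w l
                (s≤s⁻¹ (subst (p w <_) (sym eq) u)) })
                       (offset< o e) ≤-refl le)

    -- The set Q extends a maximal independent subset I of B. If some z ∈ B were off the hyperplane
    -- of Q, then I ∪ {z} would be a larger independent subset of B; hence B lies in the hyperplane.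
    interval-ranks⇒basis : ∀ {B} → ∣ B ∣ ≡ suc m → (∀ a b → ∣ B ∩ ⟦ a , b ⟧ ∣ ≤ rk M ⟦ a , b ⟧) → Basis B
    interval-ranks⇒basis {B} ∣B∣ bound with basis? B
    ... | yes b = b
    ... | no ¬b = contradiction (Hyperplane.size≤ q ∣Q∣ o-out B-in bound)
        (subst₂ (λ s t → ¬ s ≤ t) (sym ∣B∣) (sym ∣Q∣) 1+n≰n)
      where
      maximal = rk-attained B
      I = proj₁ maximal
      I-indep = proj₁ (proj₂ maximal)
      I⊆B = proj₁ (proj₂ (proj₂ maximal))
      ∣I∣ = proj₂ (proj₂ (proj₂ maximal))
      ∣I∣≤m : ∣ I ∣ ≤ m
      ∣I∣≤m = s≤s⁻¹ (≤∧≢⇒< (size-independent I-indep) λ eq → ¬b (independent⇒basis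
        (independent-⊆ (⊆∧size⇒⊇ I⊆B (≤-reflexive (trans ∣B∣ (sym eq)))) I-indep) ∣B∣))
      B₀ = proj₁ nonempty
      -- Removing one element of a basis supplies an independent set of size exactly m, up to which
      -- I is extended.
      element : ∃ λ x → x ∈ B₀ × x ∉ ⊥
      element = <⇒∃∉ (subst₂ _<_ (sym (∣⊥∣≡0 n)) (sym (size-basis (proj₂ nonempty))) (s≤s z≤n))
      x = proj₁ element
      ∣B₀∖x∣ : ∣ B₀ ∖ x ∣ ≡ m
      ∣B₀∖x∣ = suc-injective (trans (sym (size-delete (proj₁ (proj₂ element)))) (size-basis (proj₂ nonempty)))
      ext = extend I-indep (B₀ , proj₂ nonempty , p─q⊆p B₀ ⁅ x ⁆) (≤-trans ∣I∣≤m (≤-reflexive (sym ∣B₀∖x∣)))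
      Q = proj₁ ext
      q = proj₁ (proj₂ ext)
      I⊆Q = proj₁ (proj₂ (proj₂ ext))
      ∣Q∣ : ∣ Q ∣ ≡ m
      ∣Q∣ = trans (proj₂ (proj₂ (proj₂ (proj₂ ext)))) ∣B₀∖x∣
      outer = augment q (B₀ , proj₂ nonempty , id) (subst₂ _<_ (sym ∣Q∣) (sym (size-basis (proj₂ nonempty))) ≤-refl)
      o-out : Basis (Q ∪ ⁅ proj₁ outer ⁆)
      o-out = independent⇒basis (proj₂ (proj₂ (proj₂ outer)))
          (trans (size-insert (proj₁ (proj₂ (proj₂ outer)))) (cong suc ∣Q∣))
      B-in : ∀ {z} → z ∈ B → ¬ Basis (Q ∪ ⁅ z ⁆)
      B-in {z} z∈B b = 1+n≰n (≤-trans (≤-reflexive (trans (cong suc (sym ∣I∣)) (sym (size-insert z∉I))))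
        (size≤rk (_ , b , insert⊆ (⊆insert Q z ∘ I⊆Q) (∈insert Q z)) (insert⊆ I⊆B z∈B)))
        where
        z∉I : z ∉ I
        z∉I z∈I = 1+n≰n (subst₂ _≤_ (size-basis b) ∣Q∣ (p⊆q⇒∣p∣≤∣q∣ (insert⊆ id (I⊆Q z∈I))))

-- Increasing enumerations of subsets

module Enumerations where

  open Counting
  open MatroidRank
  open CyclicIntervals
  open import Data.Fin.Base as Fin using (Fin; zero; suc; toℕ; punchIn; punchOut)
  open import Data.Fin.Properties as Fin using (_≟_; any?; toℕ-injective; punchInᵢ≢i; punchIn-punchOut; suc-injective)
  open import Data.Fin.Subset using (Subset; _∈_; _∉_; _∪_; ⁅_⁆; ∣_∣; inside; outside)
    renaming (_-_ to _∖_)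
  open import Data.Fin.Subset.Properties using (_∈?_; x∈p∪q⁻; x∈⁅y⁆⇒x≡y; ⊆-antisym; x∈p∪q⁺; p─q⊆p; x∈p∧x≢y⇒x∈p-y)
  open import Data.Nat.Base
  open import Data.Nat.Properties hiding (_≟_; suc-injective)
  open import Data.Product.Base using (∃; _×_; _,_; proj₂)
  open import Data.Sum.Base using (_⊎_; inj₁; inj₂; map₂)
  open import Data.Vec.Base using (_∷_; []; here; there)
  open import Function.Base using (_∘_)
  open import Relation.Binary.Definitions using (tri<; tri≈; tri>)
  open import Relation.Binary.PropositionalEquality
  open import Relation.Nullary

  ∈image⁺ : ∀ {d n} (f : Fin d → Fin n) k → f k ∈ image f
  ∈image⁺ f k = ∈-tabulate⁺ (λ x → any? (λ k → f k ≟ x)) (k , refl)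

  ∈image⁻ : ∀ {d n} (f : Fin d → Fin n) {i} → i ∈ image f → ∃ λ k → f k ≡ i
  ∈image⁻ f = ∈-tabulate⁻ (λ x → any? (λ k → f k ≟ x))

  enumerate : ∀ {n} (S : Subset n) → ∃ λ (f : Fin ∣ S ∣ → Fin n) →
              StrictlyIncreasing f × (∀ k → f k ∈ S) × (∀ {i} → i ∈ S → ∃ λ k → f k ≡ i)
  enumerate []            = (λ ()) , (λ {}) , (λ ()) , λ ()
  enumerate (outside ∷ S) with enumerate S
  ... | f , inc , sound , complete = suc ∘ f , (λ i<j → s≤s (inc i<j)) , there ∘ sound
      , λ { (there i∈) → let k , eq = complete i∈ in k , cong suc eq }
  enumerate (inside ∷ S) with enumerate S
  ... | f , inc , sound , complete = g , inc′ , sound′ , complete′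
    where
    g : Fin (suc ∣ S ∣) → _
    g zero    = zero
    g (suc k) = suc (f k)
    inc′ : StrictlyIncreasing g
    inc′ {zero}  {suc j} _         = s≤s z≤n
    inc′ {suc i} {suc j} (s≤s i<j) = s≤s (inc i<j)
    sound′ : ∀ k → g k ∈ inside ∷ S
    sound′ zero    = here
    sound′ (suc k) = there (sound k)
    complete′ : ∀ {i} → i ∈ inside ∷ S → ∃ λ k → g k ≡ i
    complete′ here       = zero , refl
    complete′ (there i∈) = let k , eq = complete i∈ in suc k , cong suc eq

  enumeration : ∀ {n d} (S : Subset n) → ∣ S ∣ ≡ d → ∃ λ (f : Fin d → Fin n) → StrictlyIncreasing f × S ≡ image f
  enumeration S refl with enumerate S
  ... | f , inc , sound , complete = f , inc , ⊆-antisym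
    (λ i∈ → let k , eq = complete i∈ in subst (_∈ image f) eq (∈image⁺ f k))
    (λ i∈ → let k , eq = ∈image⁻ f i∈ in subst (_∈ S) eq (sound k))

  increasing-injective : ∀ {d n} {f : Fin d → Fin n} → StrictlyIncreasing f → ∀ {i j} → f i ≡ f j → i ≡ j
  increasing-injective inc {i} {j} eq with Fin.<-cmp i j
  ... | tri< i<j _ _ = contradiction (inc i<j) (<-irrefl (cong toℕ eq))
  ... | tri≈ _ i≡j _ = i≡j
  ... | tri> _ _ j<i = contradiction (inc j<i) (<-irrefl (cong toℕ (sym eq)))

  increasing-reflects-< : ∀ {d n} {f : Fin d → Fin n} → StrictlyIncreasing f → ∀ {i j} → f i Fin.< f j → i Fin.< j
  increasing-reflects-< {f = f} inc {i} {j} fi<fj with Fin.<-cmp i j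
  ... | tri< i<j _ _  = i<j
  ... | tri≈ _ refl _ = contradiction fi<fj (<-irrefl refl)
  ... | tri> _ _ j<i  = contradiction fi<fj (<-asym (inc j<i))

  increasing-≤-first : ∀ {d n} {f : Fin (suc d) → Fin n} → StrictlyIncreasing f → ∀ k → toℕ (f zero) ≤ toℕ (f k)
  increasing-≤-first inc zero    = ≤-refl
  increasing-≤-first inc (suc k) = <⇒≤ (inc (s≤s z≤n))

  increasing-unique : ∀ {d n} {f g : Fin d → Fin n} → StrictlyIncreasing f → StrictlyIncreasing g →
                      (∀ k → ∃ λ l → g l ≡ f k) → (∀ l → ∃ λ k → f k ≡ g l) → ∀ k → f k ≡ g k
  increasing-unique {suc d} {n} {f} {g} f↑ g↑ f⊆g g⊆f = λ { zero → first ; (suc k) → increasing-unique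
      {f = f ∘ suc} {g ∘ suc} (λ i<j → f↑ (s≤s i<j)) (λ i<j → g↑ (s≤s i<j))
      (λ k → shift g↑ (sym first) f↑ k (f⊆g (suc k))) (λ l → shift f↑ first g↑ l (g⊆f (suc l))) k }
    where
    first : f zero ≡ g zero
    first with f⊆g zero | g⊆f zero
    ... | i , gi≡f0 | j , fj≡g0 = toℕ-injective (≤-antisym
      (≤-trans (increasing-≤-first f↑ j) (≤-reflexive (cong toℕ fj≡g0)))
      (≤-trans (increasing-≤-first g↑ i) (≤-reflexive (cong toℕ gi≡f0))))
    shift : ∀ {u v : Fin (suc d) → Fin n} → StrictlyIncreasing u → u zero ≡ v zero → StrictlyIncreasing v →
            ∀ k → (∃ λ l → u l ≡ v (suc k)) → ∃ λ l → u (suc l) ≡ v (suc k)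
    shift u↑ 0≡0 v↑ k (zero  , eq) = contradiction (v↑ {zero} {suc k} (s≤s z≤n))
        (<-irrefl (cong toℕ (trans (sym 0≡0) eq)))
    shift u↑ 0≡0 v↑ k (suc l , eq) = l , eq

  enumeration-unique : ∀ {d n} {f g : Fin d → Fin n} → StrictlyIncreasing f → StrictlyIncreasing g →
                       image f ≡ image g → ∀ k → f k ≡ g k
  enumeration-unique {f = f} {g} f↑ g↑ eq = increasing-unique f↑ g↑
    (λ k → ∈image⁻ g (subst (f k ∈_) eq (∈image⁺ f k))) (λ l → ∈image⁻ f (subst (g l ∈_) (sym eq) (∈image⁺ g l)))

  sum-image : ∀ {d n} {f : Fin d → Fin n} → StrictlyIncreasing f → (h : Fin n → ℕ) →
              sumℕ (λ l → h (f l)) ≡ sumℕ (λ i → 𝟙? (i ∈? image f) * h i)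
  sum-image {d} {n} {f} f↑ h = begin
    sumℕ (λ l → h (f l))                                   ≡⟨ sumℕ-cong (λ l → sym (row l)) ⟩
    sumℕ (λ l → sumℕ (λ i → 𝟙? (f l ≟ i) * h i))           ≡⟨ sumℕ-comm {d} {n} (λ l i → 𝟙? (f l ≟ i) * h i) ⟩
    sumℕ (λ i → sumℕ (λ l → 𝟙? (f l ≟ i) * h i))           ≡⟨ sumℕ-cong col ⟩
    sumℕ (λ i → 𝟙? (i ∈? image f) * h i)                   ∎
    where
    open ≡-Reasoning
    row : ∀ l → sumℕ (λ i → 𝟙? (f l ≟ i) * h i) ≡ h (f l)
    row l = trans (sumℕ-single (f l) (λ i i≢ → cong (_* h i) (𝟙?-no (f l ≟ i) (i≢ ∘ sym))))
      (trans (cong (_* h (f l)) (𝟙?-yes (f l ≟ f l) refl)) (+-identityʳ _))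
    col : ∀ i → sumℕ (λ l → 𝟙? (f l ≟ i) * h i) ≡ 𝟙? (i ∈? image f) * h i
    col i with i ∈? image f
    ... | no  i∉ = sumℕ-0 λ l → cong (_* h i) (𝟙?-no (f l ≟ i) λ { refl → i∉ (∈image⁺ f l) })
    ... | yes i∈ with ∈image⁻ f i∈
    ...   | k , refl = trans (sumℕ-single k
        (λ l l≢k → cong (_* h i) (𝟙?-no (f l ≟ f k) (l≢k ∘ increasing-injective f↑))))
                         (cong (_* h i) (𝟙?-yes (f k ≟ f k) refl))

  size-image : ∀ {d n} {f : Fin d → Fin n} → StrictlyIncreasing f → ∣ image f ∣ ≡ d
  size-image {d} {n} {f} f↑ = sym (begin
    d                                      ≡⟨ ones d ⟨
    sumℕ {d} (λ l → 1)                     ≡⟨ sum-image f↑ (λ _ → 1) ⟩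
    sumℕ (λ i → 𝟙? (i ∈? image f) * 1)     ≡⟨ sumℕ-cong {n} (λ i → *-identityʳ (𝟙? (i ∈? image f))) ⟩
    sumℕ (λ i → 𝟙? (i ∈? image f))         ≡⟨ size-∈? (image f) ⟨
    ∣ image f ∣                            ∎)
    where
    open ≡-Reasoning
    ones : ∀ d → sumℕ {d} (λ l → 1) ≡ d
    ones zero    = refl
    ones (suc d) = cong suc (ones d)

  -- For j ∉ S this is the index of j in the increasing enumeration of S ∪ {j}; its parity is the
  -- sign of moving column j to the front.
  below : ∀ {n} → Subset n → Fin n → ℕ
  below S j = sumℕ (λ i → 𝟙? (i ∈? S) * 𝟙? (i Fin.<? j))

  punchIn-below : ∀ {m} (k : Fin (suc m)) → sumℕ (λ l → 𝟙? (punchIn k l Fin.<? k)) ≡ toℕ k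
  punchIn-below {m}     zero    = sumℕ-0 {m} λ l → 𝟙?-no (punchIn (zero {m}) l Fin.<? zero {m}) λ ()
  punchIn-below {suc m} (suc k) = cong suc (trans
    (sumℕ-cong {m} λ l → 𝟙?-cong (punchIn (suc k) (suc l) Fin.<? suc k) (punchIn k l Fin.<? k) s≤s⁻¹ s≤s)
    (punchIn-below k))

  module _ {m n} {q : Fin m → Fin n} (q↑ : StrictlyIncreasing q) {j} (j∉ : j ∉ image q) where

    -- Skipping the index of j leaves an increasing enumeration of the image of q, which by
    -- uniqueness is q itself.
    enumeration-insert : ∃ λ (f : Fin (suc m) → Fin n) → ∃ λ k → StrictlyIncreasing f ×
      image q ∪ ⁅ j ⁆ ≡ image f × f k ≡ j × (∀ l → f (punchIn k l) ≡ q l) × toℕ k ≡ below (image q) j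
    enumeration-insert with enumeration (image q ∪ ⁅ j ⁆) (trans (size-insert j∉) (cong suc (size-image q↑)))
    ... | f , f↑ , eq with ∈image⁻ f (subst (j ∈_) eq (∈insert _ j))
    ...   | k , refl = f , k , f↑ , eq , refl , f∘punchIn≗q , position
      where
      f∘punchIn≗q : ∀ l → f (punchIn k l) ≡ q l
      f∘punchIn≗q = increasing-unique (λ i<j → f↑ (≰⇒> λ h → <⇒≱ i<j (Fin.punchIn-cancel-≤ k _ _ h))) q↑ to from
        where
        to : ∀ l → ∃ λ l′ → q l′ ≡ f (punchIn k l)
        to l with x∈p∪q⁻ (image q) ⁅ j ⁆ (subst (f (punchIn k l) ∈_) (sym eq) (∈image⁺ f _))
        ... | inj₁ h = ∈image⁻ q h
        ... | inj₂ h = contradiction (increasing-injective f↑ (x∈⁅y⁆⇒x≡y j h)) (punchInᵢ≢i k l)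
        from : ∀ l → ∃ λ l′ → f (punchIn k l′) ≡ q l
        from l with ∈image⁻ f (subst (q l ∈_) eq (⊆insert _ j (∈image⁺ q l)))
        ... | k′ , fk′ = punchOut k≢k′ , trans (cong f (punchIn-punchOut k≢k′)) fk′
          where
          k≢k′ : k ≢ k′
          k≢k′ refl = j∉ (subst (_∈ image q) (sym fk′) (∈image⁺ q l))
      position : toℕ k ≡ below (image q) j
      position = trans (sym (punchIn-below k)) (trans
        (sumℕ-cong {m} λ l → 𝟙?-cong (punchIn k l Fin.<? k) (q l Fin.<? j)
          (λ h → subst (Fin._< j) (f∘punchIn≗q l) (f↑ h))
          (λ h → increasing-reflects-< f↑ (subst (Fin._< j) (sym (f∘punchIn≗q l)) h)))
        (sum-image q↑ (λ i → 𝟙? (i Fin.<? j))))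

  module _ {n} {Q : Subset n} {p y} (p∈Q : p ∈ Q) (y∉Q : y ∉ Q) where

    -- Both sides count the elements of Q ∪ {y} below j, once split as Q′ and p, once as Q and y.
    below-swap : ∀ j → below ((Q ∖ p) ∪ ⁅ y ⁆) j + 𝟙? (p Fin.<? j) ≡ below Q j + 𝟙? (y Fin.<? j)
    below-swap j = begin
      below Q′ j + h p                                                    ≡⟨ cong (below Q′ j +_) (single p) ⟨
      sumℕ (λ i → 𝟙? (i ∈? Q′) * h i) + sumℕ (λ i → 𝟙? (i ≟ p) * h i)      ≡⟨ sumℕ-+ {n} _ _ ⟨
      sumℕ (λ i → 𝟙? (i ∈? Q′) * h i + 𝟙? (i ≟ p) * h i)                  ≡⟨ sumℕ-cong pointwise ⟩
      sumℕ (λ i → 𝟙? (i ∈? Q) * h i + 𝟙? (i ≟ y) * h i)                   ≡⟨ sumℕ-+ {n} _ _ ⟩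
      sumℕ (λ i → 𝟙? (i ∈? Q) * h i) + sumℕ (λ i → 𝟙? (i ≟ y) * h i)       ≡⟨ cong (below Q j +_) (single y) ⟩
      below Q j + h y                                                     ∎
      where
      open ≡-Reasoning
      Q′ = (Q ∖ p) ∪ ⁅ y ⁆
      h : Fin n → ℕ
      h i = 𝟙? (i Fin.<? j)
      single : ∀ z → sumℕ (λ i → 𝟙? (i ≟ z) * h i) ≡ h z
      single z = trans (sumℕ-single z (λ i i≢z → cong (_* h i) (𝟙?-no (i ≟ z) i≢z)))
        (trans (cong (_* h z) (𝟙?-yes (z ≟ z) refl)) (+-identityʳ _))
      split : ∀ i → i ∈ Q ∪ ⁅ y ⁆ → i ∈ Q′ ⊎ i ≡ p
      split i i∈ with i ≟ p
      ... | yes i≡p = inj₂ i≡p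
      ... | no  i≢p with x∈p∪q⁻ Q ⁅ y ⁆ i∈
      ...   | inj₁ i∈Q = inj₁ (⊆insert _ y (x∈p∧x≢y⇒x∈p-y i∈Q i≢p))
      ...   | inj₂ i∈y = inj₁ (x∈p∪q⁺ (inj₂ i∈y))
      p∉Q′ : p ∉ Q′
      p∉Q′ p∈ with x∈p∪q⁻ (Q ∖ p) ⁅ y ⁆ p∈
      ... | inj₁ h = proj₂ (∈∖⇒ {S = Q} h) refl
      ... | inj₂ h = y∉Q (subst (_∈ Q) (x∈⁅y⁆⇒x≡y y h) p∈Q)
      pointwise : ∀ i → 𝟙? (i ∈? Q′) * h i + 𝟙? (i ≟ p) * h i ≡ 𝟙? (i ∈? Q) * h i + 𝟙? (i ≟ y) * h i
      pointwise i = begin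
        𝟙? (i ∈? Q′) * h i + 𝟙? (i ≟ p) * h i   ≡⟨ *-distribʳ-+ (h i) (𝟙? (i ∈? Q′)) _ ⟨
        (𝟙? (i ∈? Q′) + 𝟙? (i ≟ p)) * h i       ≡⟨ cong (_* h i) (𝟙?-⊎ (i ∈? (Q ∪ ⁅ y ⁆)) (i ∈? Q′) (i ≟ p) (split i)
            (insert⊆ (λ k → ⊆insert Q y (p─q⊆p Q ⁅ p ⁆ k)) (∈insert Q y)) (λ { refl → ⊆insert Q y p∈Q })
                (λ { k refl → p∉Q′ k })) ⟨
        𝟙? (i ∈? (Q ∪ ⁅ y ⁆)) * h i             ≡⟨ cong (_* h i) (𝟙?-⊎ (i ∈? (Q ∪ ⁅ y ⁆)) (i ∈? Q) (i ≟ y)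
            (λ k → map₂ (x∈⁅y⁆⇒x≡y y) (x∈p∪q⁻ Q ⁅ y ⁆ k)) (⊆insert Q y) (λ { refl → ∈insert Q y })
                (λ { k refl → y∉Q k })) ⟩
        (𝟙? (i ∈? Q) + 𝟙? (i ≟ y)) * h i        ≡⟨ *-distribʳ-+ (h i) (𝟙? (i ∈? Q)) _ ⟩
        𝟙? (i ∈? Q) * h i + 𝟙? (i ≟ y) * h i    ∎

-- Determinants: column expansion, transposition, Grassmann-Plücker relations

module Determinants {c ℓ} (ℝ : RealNumbers c ℓ) where

  open import Data.Fin.Base using (Fin; zero; suc; punchIn; pinch; inject₁)
  open import Data.Nat.Base as ℕ using (ℕ; zero; suc)
  open import Data.Sum.Base using (inj₁; inj₂)
  open import Function.Base using (_∘_)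
  open import Relation.Binary.PropositionalEquality as ≡ using (_≡_; cong)
  open import Relation.Nullary hiding (det)

  open RealNumbers ℝ hiding (zero)
  open OverReals ℝ
  open import Algebra.Properties.Ring ring using (-1*x≈-x; -‿distribˡ-*; -‿distribʳ-*; -‿involutive)
  open import Algebra.Properties.Semiring.Sum semiring
    using (sum-cong-≋; sum-remove; ∑-comm; *-distribˡ-sum; sum-replicate-zero)
  open import Algebra.Solver.Ring.NaturalCoefficients.Default commutativeSemiring
    using (solve; _:=_; _:*_)
  open import Relation.Binary.Structures using (IsDecTotalOrder)
  open import Relation.Binary.Reasoning.Setoid setoid

  private
    module ≤ = IsDecTotalOrder isDecTotalOrder

  sum-cong : ∀ {n} {f g : Fin n → Carrier} → (∀ i → f i ≈ g i) → sum f ≈ sum g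
  sum-cong {n} = sum-cong-≋ {n}

  sum-0 : ∀ {n} {f : Fin n → Carrier} → (∀ i → f i ≈ 0#) → sum f ≈ 0#
  sum-0 {n} f≈0 = trans (sum-cong f≈0) (sum-replicate-zero n)

  *-sum : ∀ {n} x (f : Fin n → Carrier) → x * sum f ≈ sum (λ i → x * f i)
  *-sum {n} x f = *-distribˡ-sum {n} x f

  sum-swap : ∀ {m n} (f : Fin m → Fin n → Carrier) → sum (λ i → sum (f i)) ≈ sum (λ j → sum (λ i → f i j))
  sum-swap {m} {n} = ∑-comm {m} {n}

  -- The order excludes characteristic 2, so that alternation can be derived from antisymmetry.
  x≈-x⇒x≈0 : ∀ {x} → x ≈ - x → x ≈ 0#
  x≈-x⇒x≈0 {x} eq with ≤.total 0# x
  ... | inj₁ 0≤x = ≤.antisym (≤.trans (≤.reflexive (sym (+-identityˡ x))) (≤.trans (+-monoˡ-≤ x 0≤x)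
                     (≤.reflexive (trans (+-congˡ eq) (-‿inverseʳ x))))) 0≤x
  ... | inj₂ x≤0 = ≤.antisym x≤0 (≤.trans (≤.reflexive (sym (trans (+-congˡ eq) (-‿inverseʳ x))))
                     (≤.trans (+-monoˡ-≤ x x≤0) (≤.reflexive (+-identityˡ x))))

  x+y≈0⇒x≈-y : ∀ {x y} → x + y ≈ 0# → x ≈ - y
  x+y≈0⇒x≈-y {x} {y} eq = begin
    x              ≈⟨ +-identityʳ x ⟨
    x + 0#         ≈⟨ +-congˡ (-‿inverseʳ y) ⟨
    x + (y + - y)  ≈⟨ +-assoc x y (- y) ⟨
    x + y + - y    ≈⟨ +-congʳ eq ⟩
    0# + - y       ≈⟨ +-identityˡ (- y) ⟩
    - y            ∎

  sign² : ∀ {n} (k : Fin n) → sign k * sign k ≈ 1#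
  sign² zero    = *-identityˡ 1#
  sign² (suc k) = trans (sym (-‿distribˡ-* _ _))
      (trans (-‿cong (sym (-‿distribʳ-* _ _))) (trans (-‿involutive _) (sign² k)))

  sign-inject₁ : ∀ {n} (k : Fin n) → sign (inject₁ k) ≡ sign k
  sign-inject₁ zero    = ≡.refl
  sign-inject₁ (suc k) = cong -_ (sign-inject₁ k)

  -- Deleting the same two columns in either order: k and then j, or `punchIn k j` and then
  -- `pinch j k`. The two index sums have opposite parity.
  sign-punchIn : ∀ {n} (k : Fin (suc (suc n))) j → sign (punchIn k j) * sign (pinch j k) ≈ - (sign k * sign j)
  sign-punchIn zero          j       = trans (*-identityʳ _) (-‿cong (sym (*-identityˡ _)))
  sign-punchIn (suc k)       zero    = begin
    1# * sign k          ≈⟨ *-comm 1# (sign k) ⟩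
    sign k * 1#          ≈⟨ -‿involutive _ ⟨
    - (- (sign k * 1#))  ≈⟨ -‿cong (-‿distribˡ-* _ _) ⟩
    - (- sign k * 1#)    ∎
  sign-punchIn {suc n} (suc k) (suc j) = trans (neg*neg _ _) (trans (sign-punchIn k j) (-‿cong (sym (neg*neg _ _))))
    where
    neg*neg : ∀ x y → - x * - y ≈ x * y
    neg*neg x y = trans (sym (-‿distribˡ-* _ _)) (trans (-‿cong (sym (-‿distribʳ-* _ _))) (-‿involutive _))

  punchIn-pinch : ∀ {n} (k : Fin (suc (suc n))) j → punchIn (punchIn k j) (pinch j k) ≡ k
  punchIn-pinch         zero    j       = ≡.refl
  punchIn-pinch         (suc k) zero    = ≡.refl
  punchIn-pinch {suc n} (suc k) (suc j) = cong suc (punchIn-pinch k j)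

  punchIn-punchIn : ∀ {n} (k : Fin (suc (suc n))) j l →
                    punchIn (punchIn k j) (punchIn (pinch j k) l) ≡ punchIn k (punchIn j l)
  punchIn-punchIn         zero    j       l       = ≡.refl
  punchIn-punchIn         (suc k) zero    l       = ≡.refl
  punchIn-punchIn         (suc k) (suc j) zero    = ≡.refl
  punchIn-punchIn {suc n} (suc k) (suc j) (suc l) = cong suc (punchIn-punchIn k j l)

  det-cong : ∀ {n} {A B : Matrix n n} → (∀ i j → A i j ≈ B i j) → det A ≈ det B
  det-cong {zero}          A≈B = refl
  det-cong {suc n} {A} {B} A≈B = sum-cong λ j → *-congˡ {sign j}
    (*-cong (A≈B zero j) (det-cong λ i k → A≈B (suc i) (punchIn j k)))

  -- The column expansion of a determinant whose distinguished column is w and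
  -- whose other columns form N; as a function of w it is a linear functional.
  cofactor : ∀ {m} → Matrix (suc m) m → (Fin (suc m) → Carrier) → Carrier
  cofactor N w = sum (λ i → sign i * (w i * det (λ r → N (punchIn i r))))

  cofactor-cong : ∀ {m} {N N′ : Matrix (suc m) m} {w w′} → (∀ i j → N i j ≈ N′ i j) → (∀ i → w i ≈ w′ i) →
                  cofactor N w ≈ cofactor N′ w′
  cofactor-cong N≈ w≈ = sum-cong λ i → *-congˡ {sign i} (*-cong (w≈ i) (det-cong λ r → N≈ (punchIn i r)))

  column : ∀ {m n} → Matrix m n → Fin n → Fin m → Carrier
  column A k i = A i k

  omitColumn : ∀ {m n} → Fin (suc n) → Matrix m (suc n) → Matrix m n
  omitColumn k A i c = A i (punchIn k c)

  -- Induction on the size. In the first-row expansion the term at k is the top entry of the column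
  -- expansion. Every other minor still contains column k and is expanded along it; exchanging the
  -- sums collects first-row expansions of the minors without column k.
  laplace : ∀ {m} (B : Matrix (suc m) (suc m)) k → det B ≈ sign k * cofactor (omitColumn k B) (column B k)
  laplace {zero}  B zero = sym (*-identityˡ _)
  laplace {suc m} B k    = begin
    sum (λ j → sign j * (b j * D j))
        ≈⟨ sum-remove {i = k} (λ j → sign j * (b j * D j)) ⟩
    sign k * (b k * D k) + sum (λ j → sign (punchIn k j) * (b (punchIn k j) * D (punchIn k j)))
      ≈⟨ +-congˡ (sum-cong term) ⟩
    sign k * (b k * D k) + sum (λ j → sign k * sum (λ i → T i j))
        ≈⟨ +-cong (*-congˡ (sym (*-identityˡ _))) (sym (*-sum (sign k) (λ j → sum (λ i → T i j)))) ⟩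
    sign k * (1# * (b k * D k)) + sign k * sum (λ j → sum (λ i → T i j))      ≈⟨ distribˡ _ _ _ ⟨
    sign k * (1# * (b k * D k) + sum (λ j → sum (λ i → T i j)))
        ≈⟨ *-congˡ (+-congˡ (trans (sum-swap (λ j i → T i j)) (sum-cong collect))) ⟩
    sign k * cofactor (omitColumn k B) (column B k)                           ∎
    where
    b : Fin (suc (suc m)) → Carrier
    b j = B zero j
    D : Fin (suc (suc m)) → Carrier
    D j = det (λ i c → B (suc i) (punchIn j c))
    a : Fin (suc m) → Carrier
    a i = B (suc i) k
    E : Fin (suc m) → Fin (suc m) → Carrier
    E i j = det (λ r c → B (suc (punchIn i r)) (punchIn k (punchIn j c)))
    T : Fin (suc m) → Fin (suc m) → Carrier
    T i j = - sign i * (a i * (sign j * (b (punchIn k j) * E i j)))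
    collect : ∀ i → sum (T i) ≈ - sign i * (a i * det (λ r c → B (punchIn (suc i) r) (punchIn k c)))
    collect i = sym (trans (*-congˡ (*-sum (a i) (λ j → sign j * (b (punchIn k j) * E i j))))
      (*-sum (- sign i) (λ j → a i * (sign j * (b (punchIn k j) * E i j)))))
    expand : ∀ j → D (punchIn k j) ≈ sign (pinch j k) * sum (λ i → sign i * (a i * E i j))
    expand j = trans (laplace (λ i c → B (suc i) (punchIn (punchIn k j) c)) (pinch j k))
      (*-congˡ (sum-cong λ i → *-congˡ {sign i} (*-cong
        (reflexive (cong (B (suc i)) (punchIn-pinch k j)))
        (det-cong λ r c → reflexive (cong (B (suc (punchIn i r))) (punchIn-punchIn k j c))))))
    term : ∀ j → sign (punchIn k j) * (b (punchIn k j) * D (punchIn k j)) ≈ sign k * sum (λ i → T i j)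
    term j = begin
      s * (β * D (punchIn k j))                             ≈⟨ *-congˡ (*-congˡ (expand j)) ⟩
      s * (β * (t * S))
          ≈⟨ solve 4 (λ s β t S → s :* (β :* (t :* S)) := (s :* t) :* (β :* S)) refl s β t S ⟩
      s * t * (β * S)                                       ≈⟨ *-congʳ (trans (sign-punchIn k j) (sym (-1*x≈-x _))) ⟩
      ν * (sign k * sign j) * (β * S)
          ≈⟨ solve 5 (λ ν k j β S → (ν :* (k :* j)) :* (β :* S) := k :* ((ν :* (j :* β)) :* S)) refl ν (sign k)
              (sign j) β S ⟩
      sign k * (ν * (sign j * β) * S)
          ≈⟨ *-congˡ (*-sum (ν * (sign j * β)) (λ i → sign i * (a i * E i j))) ⟩
      sign k * sum (λ i → ν * (sign j * β) * (sign i * (a i * E i j))) ≈⟨ *-congˡ (sum-cong λ i →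
          trans (solve 6 (λ ν j β i a E → (ν :* (j :* β)) :* (i :* (a :* E)) := (ν :* i) :*
              (a :* (j :* (β :* E)))) refl ν (sign j) β (sign i) (a i) (E i j))
                (*-congʳ (-1*x≈-x _))) ⟩
      sign k * sum (λ i → T i j)                            ∎
      where
      s = sign (punchIn k j)
      t = sign (pinch j k)
      β = b (punchIn k j)
      ν = - 1#
      S = sum (λ i → sign i * (a i * E i j))

  -- Expansion of A along its first column is, by induction, the first-row expansion of the
  -- transpose.
  det-transpose : ∀ {n} (A : Matrix n n) → det (λ i j → A j i) ≈ det A
  det-transpose {zero}  A = refl
  det-transpose {suc n} A = sym (trans (laplace A zero) (trans (*-identityˡ _)
    (sum-cong λ i → *-congˡ {sign i} (*-congˡ {A i zero} (sym (det-transpose (λ r c → A (punchIn i r) (suc c))))))))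

  pinch-inject₁ : ∀ {n} (c : Fin n) → pinch c (inject₁ c) ≡ c
  pinch-inject₁ {suc n} zero    = ≡.refl
  pinch-inject₁ {suc n} (suc c) = cong suc (pinch-inject₁ c)

  pinch-suc : ∀ {n} (c : Fin n) → pinch c (suc c) ≡ c
  pinch-suc {suc n} zero    = ≡.refl
  pinch-suc {suc n} (suc c) = cong suc (pinch-suc c)

  pinch-punchIn-inject₁ : ∀ {n} (c l : Fin n) → pinch c (punchIn (inject₁ c) l) ≡ l
  pinch-punchIn-inject₁ {suc n} zero    l       = ≡.refl
  pinch-punchIn-inject₁ {suc n} (suc c) zero    = ≡.refl
  pinch-punchIn-inject₁ {suc n} (suc c) (suc l) = cong suc (pinch-punchIn-inject₁ c l)

  pinch-punchIn-suc : ∀ {n} (c l : Fin n) → pinch c (punchIn (suc c) l) ≡ l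
  pinch-punchIn-suc {suc n} zero    zero    = ≡.refl
  pinch-punchIn-suc {suc n} zero    (suc l) = ≡.refl
  pinch-punchIn-suc {suc n} (suc c) zero    = ≡.refl
  pinch-punchIn-suc {suc n} (suc c) (suc l) = cong suc (pinch-punchIn-suc c l)

  -- Expanding along either copy of a doubled column gives opposite signs.
  cofactor-column : ∀ {m} (N : Matrix (suc m) m) k → cofactor N (column N k) ≈ 0#
  cofactor-column {m} N k = begin
    φ                         ≈⟨ *-identityˡ φ ⟨
    1# * φ                    ≈⟨ *-congʳ (sign² k) ⟨
    sign k * sign k * φ       ≈⟨ *-assoc _ _ _ ⟩
    sign k * (sign k * φ)     ≈⟨ *-congˡ (x≈-x⇒x≈0 (trans (sym first) (trans second (sym (-‿distribˡ-* _ _))))) ⟩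
    sign k * 0#               ≈⟨ zeroʳ _ ⟩
    0#                        ∎
    where
    φ = cofactor N (column N k)
    B : Matrix (suc m) (suc m)
    B i l = N i (pinch k l)
    first : det B ≈ sign k * φ
    first = trans (laplace B (inject₁ k)) (*-cong (reflexive (sign-inject₁ k))
      (cofactor-cong (λ i c → reflexive (cong (N i) (pinch-punchIn-inject₁ k c)))
          (λ i → reflexive (cong (N i) (pinch-inject₁ k)))))
    second : det B ≈ - sign k * φ
    second = trans (laplace B (suc k)) (*-congˡ
      (cofactor-cong (λ i c → reflexive (cong (N i) (pinch-punchIn-suc k c)))
          (λ i → reflexive (cong (N i) (pinch-suc k)))))

  -- The sum expands, along its top row, the square matrix made from G by repeating row i on top.
  -- Transposed, this is a cofactor expansion with a doubled column.
  cramer : ∀ {m} (G : Matrix m (suc m)) i → sum (λ j → sign j * (G i j * det (omitColumn j G))) ≈ 0#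
  cramer G i = trans
    (sum-cong λ j → *-congˡ {sign j} (*-congˡ {G i j} (sym (det-transpose (omitColumn j G)))))
    (cofactor-column (λ r c → G c r) i)

  module _ {m n} (A : Matrix (suc m) n) where

    -- The determinant of the columns j, q 0, q 1, … of A, in this order.
    φ : (Fin m → Fin n) → Fin n → Carrier
    φ q j = cofactor (λ i c → A i (q c)) (column A j)

    φ-cong : ∀ {q q′ : Fin m → Fin n} → (∀ c → q c ≡ q′ c) → ∀ j → φ q j ≈ φ q′ j
    φ-cong q≗q′ j = cofactor-cong {w = column A j} (λ i c → reflexive (cong (A i) (q≗q′ c))) (λ i → refl)

    φ-self : ∀ q k → φ q (q k) ≈ 0#
    φ-self q = cofactor-column (λ i c → A i (q c))

    minor-φ : ∀ (f : Fin (suc m) → Fin n) k → minor A f ≈ sign k * φ (f ∘ punchIn k) (f k)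
    minor-φ f k = laplace (λ i c → A i (f c)) k

    -- A Grassmann–Plücker relation: two functionals with the same kernel are proportional.
    φ-proportional : ∀ q q′ → (∀ c → φ q′ (q c) ≈ 0#) → ∀ x y → φ q′ x * φ q y ≈ φ q′ y * φ q x
    φ-proportional q q′ vanish x y = trans (x+y≈0⇒x≈-y (trans (sym reduce) relation))
        (trans (-‿cong (sym (-‿distribˡ-* _ _))) (-‿involutive _))
      where
      -- The columns x, y and q are one more than the dimension, so `cramer` gives a linear relation
      -- among them. Under `φ q′` the columns of q drop out, and two terms remain.
      g : Fin (suc (suc m)) → Fin n
      g zero          = x
      g (suc zero)    = y
      g (suc (suc c)) = q c
      G : Matrix (suc m) (suc (suc m))
      G i j = A i (g j)
      C : Fin (suc m) → Carrier
      C i = det (λ r c → A (punchIn i r) (q′ c))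
      Δ : Fin (suc (suc m)) → Carrier
      Δ j = det (omitColumn j G)
      relation : sum (λ j → sign j * (φ q′ (g j) * Δ j)) ≈ 0#
      relation = begin
        sum (λ j → sign j * (φ q′ (g j) * Δ j))                             ≈⟨ sum-cong (λ j → trans
            (*-congˡ (trans (*-comm _ _) (*-sum (Δ j) (λ i → sign i * (G i j * C i)))))
            (*-sum (sign j) (λ i → Δ j * (sign i * (G i j * C i))))) ⟩
        sum (λ j → sum (λ i → sign j * (Δ j * (sign i * (G i j * C i)))))
            ≈⟨ sum-swap (λ j i → sign j * (Δ j * (sign i * (G i j * C i)))) ⟩
        sum (λ i → sum (λ j → sign j * (Δ j * (sign i * (G i j * C i)))))   ≈⟨ sum-cong (λ i → trans
            (sum-cong (λ j → solve 5 (λ s D t g C → s :* (D :* (t :* (g :* C))) := (t :* C) :* (s :* (g :* D)))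
                refl (sign j) (Δ j) (sign i) (G i j) (C i)))
            (sym (*-sum (sign i * C i) (λ j → sign j * (G i j * Δ j))))) ⟩
        sum (λ i → sign i * C i * sum (λ j → sign j * (G i j * Δ j)))
            ≈⟨ sum-0 (λ i → trans (*-congˡ {sign i * C i} (cramer G i)) (zeroʳ _)) ⟩
        0#                                                                  ∎
      Δ₀ : Δ zero ≈ φ q y
      Δ₀ = trans (laplace (omitColumn zero G) zero) (*-identityˡ _)
      Δ₁ : Δ (suc zero) ≈ φ q x
      Δ₁ = trans (laplace (omitColumn (suc zero) G) zero) (*-identityˡ _)
      reduce : sum (λ j → sign j * (φ q′ (g j) * Δ j)) ≈ φ q′ x * φ q y + - (φ q′ y) * φ q x
      reduce = +-cong (trans (*-identityˡ _) (*-congˡ Δ₀))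
        (trans (+-cong (trans (sym (-‿distribˡ-* _ _))
            (trans (-‿cong (trans (*-identityˡ _) (*-congˡ Δ₁))) (-‿distribˡ-* _ _)))
                       (sum-0 (λ c → trans (*-congˡ (trans (*-congʳ (vanish c)) (zeroˡ _))) (zeroʳ _))))
               (+-identityʳ _))

-- Sign constraints imposed by nonnegative maximal minors

module PositroidMinors {c ℓ} (ℝ : RealNumbers c ℓ) where

  open Counting
  open MatroidRank
  open IntervalBases
  open Enumerations
  open Determinants ℝ
  open import Data.Bool.Base using (Bool; true; false; _xor_)
  open import Data.Fin.Base as Fin using (Fin; zero; suc; toℕ)
  open import Data.Fin.Properties as Fin using (_≟_)
  open import Data.Fin.Subset using (Subset; _∈_; _∉_; _∪_; ⁅_⁆; ∣_∣)
    renaming (_-_ to _∖_)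
  open import Data.Fin.Subset.Properties using (_∈?_; p⊆q⇒∣p∣≤∣q∣; x∈p∪q⁻; x∈p∧x≢y⇒x∈p-y; ⊆-antisym; p─q⊆p; x∈⁅y⁆⇒x≡y)
  open import Data.Nat.Base as ℕ using (ℕ; zero; suc)
  import Data.Nat.Properties as ℕ
  open import Data.Product.Base using (∃; _×_; _,_; proj₁; proj₂)
  open import Data.Sum.Base using ([_,_])
  open import Function.Base using (_∘_; id)
  open import Function.Bundles using (_⇔_; module Equivalence)
  open import Relation.Binary.PropositionalEquality as ≡ using (_≡_; cong; subst)
  open import Relation.Nullary hiding (det)

  open RealNumbers ℝ hiding (zero)
  open OverReals ℝ
  open import Algebra.Properties.Ring ring using (-‿distribˡ-*; -‿distribʳ-*; -‿involutive)
  open import Algebra.Solver.Ring.NaturalCoefficients.Default commutativeSemiring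
    using (solve; _:=_; _:*_)
  open import Relation.Binary.Structures using (IsDecTotalOrder)
  open import Relation.Binary.Reasoning.Setoid setoid

  private
    module ≤ = IsDecTotalOrder isDecTotalOrder

  Positive : Carrier → Set ℓ
  Positive x = 0# ≤ x × ¬ x ≈ 0#

  positive-resp : ∀ {x y} → x ≈ y → Positive x → Positive y
  positive-resp eq (0≤x , x≉0) = ≤.≤-respʳ-≈ eq 0≤x , x≉0 ∘ trans eq

  integral : ∀ {x y} → ¬ x ≈ 0# → x * y ≈ 0# → y ≈ 0#
  integral {x} {y} x≉0 xy≈0 with inverse x x≉0
  ... | z , xz≈1 = begin
    y              ≈⟨ *-identityˡ y ⟨
    1# * y         ≈⟨ *-congʳ xz≈1 ⟨
    x * z * y      ≈⟨ solve 3 (λ x z y → (x :* z) :* y := z :* (x :* y)) refl x z y ⟩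
    z * (x * y)    ≈⟨ *-congˡ xy≈0 ⟩
    z * 0#         ≈⟨ zeroʳ z ⟩
    0#             ∎

  positive-* : ∀ {x y} → Positive x → Positive y → Positive (x * y)
  positive-* (0≤x , x≉0) (0≤y , y≉0) = *-nonneg 0≤x 0≤y , y≉0 ∘ integral x≉0

  ¬positive-negation : ∀ {x} → Positive x → ¬ Positive (- x)
  ¬positive-negation {x} (0≤x , x≉0) (0≤-x , _) = x≉0 (≤.antisym
    (≤.≤-respˡ-≈ (+-identityˡ x) (≤.≤-respʳ-≈ (-‿inverseˡ x) (+-monoˡ-≤ x 0≤-x))) 0≤x)

  sgn : ℕ → Carrier
  sgn zero    = 1#
  sgn (suc k) = - sgn k

  sgn-+ : ∀ a b → sgn (a ℕ.+ b) ≈ sgn a * sgn b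
  sgn-+ zero    b = sym (*-identityˡ _)
  sgn-+ (suc a) b = trans (-‿cong (sgn-+ a b)) (-‿distribˡ-* _ _)

  sgn² : ∀ a → sgn a * sgn a ≈ 1#
  sgn² zero    = *-identityˡ _
  sgn² (suc a) = trans (sym (-‿distribˡ-* _ _))
      (trans (-‿cong (sym (-‿distribʳ-* _ _))) (trans (-‿involutive _) (sgn² a)))

  sign≡sgn : ∀ {n} (k : Fin n) → sign k ≡ sgn (toℕ k)
  sign≡sgn zero    = ≡.refl
  sign≡sgn (suc k) = cong -_ (sign≡sgn k)

  sgn-xor : ∀ a b → sgn (𝟙 a) * sgn (𝟙 b) ≈ sgn (𝟙 (a xor b))
  sgn-xor false b     = *-identityˡ _
  sgn-xor true  false = *-identityʳ _
  sgn-xor true  true  = sgn² 1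

  sgn-sum : ∀ a b c d → a ℕ.+ b ≡ c ℕ.+ d → sgn a ≈ sgn c * (sgn b * sgn d)
  sgn-sum a b c d eq = begin
    sgn a                        ≈⟨ *-identityʳ _ ⟨
    sgn a * 1#                   ≈⟨ *-congˡ (sgn² b) ⟨
    sgn a * (sgn b * sgn b)      ≈⟨ *-assoc _ _ _ ⟨
    sgn a * sgn b * sgn b        ≈⟨ *-congʳ (trans (sym (sgn-+ a b)) (trans (reflexive (cong sgn eq)) (sgn-+ c d))) ⟩
    sgn c * sgn d * sgn b        ≈⟨ solve 3 (λ c d b → (c :* d) :* b := c :* (b :* d)) refl (sgn c) (sgn d) (sgn b) ⟩
    sgn c * (sgn b * sgn d)      ∎

  module Positroid {n d} (M : Matroid n) (A : Matrix d n)
    (nonneg : ∀ f → StrictlyIncreasing f → 0# ≤ minor A f)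
    (basis⇔ : ∀ B → Matroid.Basis M B ⇔ (∃ λ f → StrictlyIncreasing f × B ≡ image f × ¬ minor A f ≈ 0#)) where

    open Matroid M

    size-basis : ∀ {B} → Basis B → ∣ B ∣ ≡ d
    size-basis {B} b with Equivalence.to (basis⇔ B) b
    ... | f , f↑ , eq , _ = ≡.trans (cong ∣_∣ eq) (size-image f↑)

    basis⇒minor≉0 : ∀ {B f} → StrictlyIncreasing f → B ≡ image f → Basis B → ¬ minor A f ≈ 0#
    basis⇒minor≉0 {B} {f} f↑ eq b with Equivalence.to (basis⇔ B) b
    ... | g , g↑ , eq′ , ≉0 = ≉0 ∘ trans (det-cong λ i k →
      reflexive (cong (A i) (enumeration-unique g↑ f↑ (≡.trans (≡.sym eq′) eq) k)))

    ¬basis⇒minor≈0 : ∀ {B f} → StrictlyIncreasing f → B ≡ image f → ¬ Basis B → minor A f ≈ 0#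
    ¬basis⇒minor≈0 {B} {f} f↑ eq ¬b with minor A f ≤.≟ 0#
    ... | yes ≈0 = ≈0
    ... | no  ≉0 = contradiction (Equivalence.from (basis⇔ B) (f , f↑ , eq , ≉0)) ¬b

  module Hyperplanes {n m} (M : Matroid n) (A : Matrix (suc m) n)
    (nonneg : ∀ f → StrictlyIncreasing f → 0# ≤ minor A f)
    (basis⇔ : ∀ B → Matroid.Basis M B ⇔ (∃ λ f → StrictlyIncreasing f × B ≡ image f × ¬ minor A f ≈ 0#)) where

    open Matroid M
    open Positroid M A nonneg basis⇔

    module _ {q : Fin m → Fin n} (q↑ : StrictlyIncreasing q) {j : Fin n} where

      -- In `φ` the column j stands first, in a minor it stands at its sorted position; the sign
      -- accounts for the difference.
      minor-insert : j ∉ image q → ∃ λ f → StrictlyIncreasing f × image q ∪ ⁅ j ⁆ ≡ image f ×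
                     minor A f ≈ sgn (below (image q) j) * φ A q j
      minor-insert j∉ with enumeration-insert q↑ j∉
      ... | f , k , f↑ , eq , ≡.refl , f≗q , position = f , f↑ , eq , trans (minor-φ A f k)
        (*-cong (reflexive (≡.trans (sign≡sgn k) (cong sgn position))) (φ-cong A f≗q j))

      φ-positive : j ∉ image q → Basis (image q ∪ ⁅ j ⁆) → Positive (sgn (below (image q) j) * φ A q j)
      φ-positive j∉ b with minor-insert j∉
      ... | f , f↑ , eq , minor≈ = positive-resp minor≈ (nonneg f f↑ , basis⇒minor≉0 f↑ eq b)

      φ-zero : j ∉ image q → ¬ Basis (image q ∪ ⁅ j ⁆) → φ A q j ≈ 0#
      φ-zero j∉ ¬b with minor-insert j∉
      ... | f , f↑ , eq , minor≈ = begin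
        φ A q j                  ≈⟨ *-identityˡ _ ⟨
        1# * φ A q j             ≈⟨ *-congʳ (sgn² k) ⟨
        sgn k * sgn k * φ A q j  ≈⟨ *-assoc _ _ _ ⟩
        sgn k * (sgn k * φ A q j) ≈⟨ *-congˡ (trans (sym minor≈) (¬basis⇒minor≈0 f↑ eq ¬b)) ⟩
        sgn k * 0#               ≈⟨ zeroʳ _ ⟩
        0#                       ∎
        where k = below (image q) j

    -- The functionals φ q and φ q′ are proportional, and total nonnegativity determines
    -- their signs at x₁ and x₂.
    signs-agree : ∀ {q q′ : Fin m → Fin n} {x₁ x₂ s₁ s₂ s₁′ s₂′ u₁ u₂} → (∀ k → φ A q′ (q k) ≈ 0#) →
                  Positive (s₁ * φ A q x₁) → Positive (s₂ * φ A q x₂) →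
                  Positive (s₁′ * φ A q′ x₁) → Positive (s₂′ * φ A q′ x₂) →
                  s₁′ ≈ s₁ * u₁ → s₂′ ≈ s₂ * u₂ → ¬ u₁ ≈ - u₂
    signs-agree {q} {q′} {x₁} {x₂} {s₁} {s₂} {s₁′} {s₂′} {u₁} {u₂} vanish p₁ p₂ p₁′ p₂′ e₁ e₂ u≈ =
      ¬positive-negation (positive-resp second (positive-* p₂′ p₁)) (positive-resp first (positive-* p₁′ p₂))
      where
      Y₁ = φ A q x₁
      Y₂ = φ A q x₂
      X₁ = φ A q′ x₁
      X₂ = φ A q′ x₂
      t = s₁ * s₂ * u₂ * (X₂ * Y₁)
      second : s₂′ * X₂ * (s₁ * Y₁) ≈ t
      second = trans (*-congʳ (*-congʳ e₂))
        (solve 5 (λ s₁ s₂ u X Y → ((s₂ :* u) :* X) :* (s₁ :* Y) := ((s₁ :* s₂) :* u) :* (X :* Y)) refl s₁ s₂ u₂ X₂ Y₁)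
      first : s₁′ * X₁ * (s₂ * Y₂) ≈ - t
      first = begin
        s₁′ * X₁ * (s₂ * Y₂)              ≈⟨ *-congʳ (*-congʳ e₁) ⟩
        s₁ * u₁ * X₁ * (s₂ * Y₂)
            ≈⟨ solve 5 (λ s₁ s₂ u X Y → ((s₁ :* u) :* X) :* (s₂ :* Y) := ((s₁ :* s₂) :* (X :* Y)) :* u) refl s₁ s₂
                u₁ X₁ Y₂ ⟩
        s₁ * s₂ * (X₁ * Y₂) * u₁          ≈⟨ *-cong (*-congˡ (φ-proportional A q q′ vanish x₁ x₂)) u≈ ⟩
        s₁ * s₂ * (X₂ * Y₁) * - u₂        ≈⟨ -‿distribʳ-* _ _ ⟨
        - (s₁ * s₂ * (X₂ * Y₁) * u₂)
            ≈⟨ -‿cong (solve 4 (λ s₁ s₂ u Z → ((s₁ :* s₂) :* Z) :* u := ((s₁ :* s₂) :* u) :* Z) refl s₁ s₂ u₂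
                (X₂ * Y₁)) ⟩
        - t                               ∎

    -- Replacing Q by Q′ multiplies the required sign at a point by the parity of whether the point
    -- separates p from y. If these parities differed at the two given points, the factors would be
    -- opposite, which `signs-agree` excludes.
    noncrossing : Noncrossing M m
    noncrossing {Q} {p} {y} {x₁} {x₂} ∣Q∣ p∈Q y∉Q ¬by b₁ b₂ b₁′ b₂′ =
      agree _ _ (signs-agree {q = q} {q′} vanish
        (positive′ q↑ Q≡ b₁ (out ∣Q∣ b₁)) (positive′ q↑ Q≡ b₂ (out ∣Q∣ b₂))
        (positive′ q′↑ Q′≡ b₁′ (out ∣Q′∣ b₁′)) (positive′ q′↑ Q′≡ b₂′ (out ∣Q′∣ b₂′)) (factor x₁) (factor x₂))
      where
      Q′ = (Q ∖ p) ∪ ⁅ y ⁆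
      ∣Q′∣ : ∣ Q′ ∣ ≡ m
      ∣Q′∣ = ≡.trans (size-insert (y∉Q ∘ proj₁ ∘ ∈∖⇒ {S = Q})) (≡.trans (≡.sym (size-delete p∈Q)) ∣Q∣)
      enum = enumeration Q ∣Q∣
      enum′ = enumeration Q′ ∣Q′∣
      q = proj₁ enum
      q↑ = proj₁ (proj₂ enum)
      Q≡ = proj₂ (proj₂ enum)
      q′ = proj₁ enum′
      q′↑ = proj₁ (proj₂ enum′)
      Q′≡ = proj₂ (proj₂ enum′)
      out : ∀ {S : Subset n} {x} → ∣ S ∣ ≡ m → Basis (S ∪ ⁅ x ⁆) → x ∉ S
      out ∣S∣ b x∈S = ℕ.1+n≰n (≡.subst₂ ℕ._≤_ (size-basis b) ∣S∣ (p⊆q⇒∣p∣≤∣q∣ (insert⊆ id x∈S)))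
      positive′ : ∀ {S : Subset n} {f x} → StrictlyIncreasing f → S ≡ image f → Basis (S ∪ ⁅ x ⁆) → x ∉ S →
                  Positive (sgn (below S x) * φ A f x)
      positive′ f↑ ≡.refl b x∉ = φ-positive f↑ x∉ b
      zero′ : ∀ {S : Subset n} {f x} → StrictlyIncreasing f → S ≡ image f → ¬ Basis (S ∪ ⁅ x ⁆) → x ∉ S → φ A f x ≈ 0#
      zero′ f↑ ≡.refl ¬b x∉ = φ-zero f↑ x∉ ¬b
      Q∪y : Q′ ∪ ⁅ p ⁆ ≡ Q ∪ ⁅ y ⁆
      Q∪y = ⊆-antisym
        (insert⊆ (insert⊆ (λ h → ⊆insert Q y (p─q⊆p Q ⁅ p ⁆ h)) (∈insert Q y)) (⊆insert Q y p∈Q))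
        (insert⊆ to (⊆insert _ p (∈insert _ y)))
        where
        to : ∀ {i} → i ∈ Q → i ∈ Q′ ∪ ⁅ p ⁆
        to {i} i∈Q with i ≟ p
        ... | yes ≡.refl = ∈insert _ i
        ... | no  i≢p    = ⊆insert _ p (⊆insert _ y (x∈p∧x≢y⇒x∈p-y i∈Q i≢p))
      p∉Q′ : p ∉ Q′
      p∉Q′ p∈ = [ (λ h → proj₂ (∈∖⇒ {S = Q} h) ≡.refl) , (λ h → y∉Q (subst (_∈ Q) (x∈⁅y⁆⇒x≡y y h) p∈Q)) ]
                  (x∈p∪q⁻ (Q ∖ p) ⁅ y ⁆ p∈)
      -- Elements of Q other than p are themselves columns of q′. For p, the set Q′ ∪ {p} is Q ∪
      -- {y}, which is not a basis, so its minor is zero.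
      vanish : ∀ k → φ A q′ (q k) ≈ 0#
      vanish k with q k ∈? Q′
      ... | yes h = let l , eq = ∈image⁻ q′ (subst (q k ∈_) Q′≡ h) in
                    trans (reflexive (cong (φ A q′) (≡.sym eq))) (φ-self A q′ l)
      ... | no  h with q k ≟ p
      ...   | yes eq = trans (reflexive (cong (φ A q′) eq)) (zero′ q′↑ Q′≡ (λ b → ¬by (subst Basis Q∪y b)) p∉Q′)
      ...   | no ≢p  = contradiction (⊆insert _ y (x∈p∧x≢y⇒x∈p-y (subst (q k ∈_) (≡.sym Q≡) (∈image⁺ q k)) ≢p)) h
      factor : ∀ x → sgn (below Q′ x) ≈ sgn (below Q x) * sgn (𝟙 ((p <ᶠ x) xor (y <ᶠ x)))
      factor x = trans (sgn-sum (below Q′ x) (𝟙 (p <ᶠ x)) (below Q x) (𝟙 (y <ᶠ x)) (below-swap p∈Q y∉Q x))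
                       (*-congˡ (sgn-xor (p <ᶠ x) (y <ᶠ x)))
      agree : ∀ a b → ¬ sgn (𝟙 a) ≈ - sgn (𝟙 b) → a ≡ b
      agree true  true  h = ≡.refl
      agree false false h = ≡.refl
      agree true  false h = contradiction refl h
      agree false true  h = contradiction (sym (-‿involutive _)) h

-- Rounding with a threshold and averaging over thresholds

module ThresholdRounding {c ℓ} (ℝ : RealNumbers c ℓ) where

  open Counting
  open Determinants ℝ
  open import Data.Bool.Base using (Bool)
  open import Data.Fin.Base as Fin using (Fin; zero; suc)
  open import Data.Nat.Base as ℕ using (ℕ; zero; suc)
  import Data.Nat.Properties as ℕ
  open import Data.Product.Base using (∃; _×_; _,_; proj₁; proj₂)
  open import Data.Sum.Base using (_⊎_; inj₁; inj₂; [_,_])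
  open import Function.Base using (_∘_; id)
  open import Level using (_⊔_)
  open import Relation.Binary.PropositionalEquality as ≡ using (_≡_; cong)
  open import Relation.Nullary hiding (det)

  open RealNumbers ℝ hiding (zero)
  open OverReals ℝ
  open import Algebra.Properties.Ring ring using (-‿distribˡ-*; -‿involutive)
  open import Algebra.Properties.Monoid.Mult +-monoid using (×-homo-+)
  open import Algebra.Properties.Semiring.Mult semiring using (×1-homo-*)
  open import Algebra.Properties.Semiring.Sum semiring using (∑-distrib-+)
  open import Algebra.Solver.Ring.NaturalCoefficients.Default commutativeSemiring
    using (solve; _:=_; _:+_)
  open import Relation.Binary.Structures using (IsDecTotalOrder)
  open import Relation.Binary.Reasoning.Setoid setoid

  private
    module ≤ = IsDecTotalOrder isDecTotalOrder
  open ≤ using (_≤?_)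

  infix 4 _≰_
  _≰_ : Carrier → Carrier → Set ℓ
  x ≰ y = ¬ x ≤ y

  ≰⇒≤ : ∀ {x y} → x ≰ y → y ≤ x
  ≰⇒≤ {x} {y} x≰y = [ (λ h → contradiction h x≰y) , id ] (≤.total x y)

  +-mono : ∀ {a b x y} → a ≤ b → x ≤ y → a + x ≤ b + y
  +-mono {a} {b} {x} {y} a≤b x≤y = ≤.trans (+-monoˡ-≤ x a≤b)
    (≤.≤-respˡ-≈ (+-comm x b) (≤.≤-respʳ-≈ (+-comm y b) (+-monoˡ-≤ b x≤y)))

  +-cancelʳ : ∀ {a b} k → a + k ≈ b + k → a ≈ b
  +-cancelʳ {a} {b} k eq = begin
    a                ≈⟨ +-identityʳ a ⟨
    a + 0#           ≈⟨ +-congˡ (-‿inverseʳ k) ⟨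
    a + (k + - k)    ≈⟨ +-assoc a k _ ⟨
    a + k + - k      ≈⟨ +-congʳ eq ⟩
    b + k + - k      ≈⟨ +-assoc b k _ ⟩
    b + (k + - k)    ≈⟨ +-congˡ (-‿inverseʳ k) ⟩
    b + 0#           ≈⟨ +-identityʳ b ⟩
    b                ∎

  +-cancelʳ-≤ : ∀ {a b} k → a + k ≤ b + k → a ≤ b
  +-cancelʳ-≤ k le = ≤.≤-respˡ-≈ (cancel _) (≤.≤-respʳ-≈ (cancel _) (+-monoˡ-≤ (- k) le))
    where
    cancel : ∀ a → a + k + - k ≈ a
    cancel a = trans (+-assoc a k _) (trans (+-congˡ (-‿inverseʳ k)) (+-identityʳ a))

  -- a ≤ b follows from p ≤ q when b − a = q − p.
  ≤-from : ∀ {p q a b} → p ≤ q → a + q ≈ b + p → a ≤ b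
  ≤-from {p} {q} {a} {b} p≤q eq = +-cancelʳ-≤ q (≤.≤-respˡ-≈ (sym eq) (+-mono ≤.refl p≤q))

  x-y+y : ∀ x y → x - y + y ≈ x
  x-y+y x y = trans (+-assoc x _ y) (trans (+-congˡ (-‿inverseˡ y)) (+-identityʳ x))

  x≤y⇒0≤y-x : ∀ {x y} → x ≤ y → 0# ≤ y - x
  x≤y⇒0≤y-x {x} {y} x≤y = ≤.≤-respˡ-≈ (-‿inverseʳ x) (+-monoˡ-≤ (- x) x≤y)

  0≤1 : 0# ≤ 1#
  0≤1 = ≰⇒≤ λ 1≤0 →
    let 0≤-1 = ≤.≤-respʳ-≈ (+-identityˡ (- 1#)) (x≤y⇒0≤y-x 1≤0) in
    0≉1 (≤.antisym (≤.≤-respʳ-≈ (trans (sym (-‿distribˡ-* _ _)) (trans (-‿cong (*-identityˡ _)) (-‿involutive 1#)))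
                     (*-nonneg 0≤-1 0≤-1)) 1≤0)

  1≰0 : 1# ≰ 0#
  1≰0 1≤0 = 0≉1 (≤.antisym 0≤1 1≤0)

  fromℕ-+ : ∀ a b → fromℕ (a ℕ.+ b) ≈ fromℕ a + fromℕ b
  fromℕ-+ = ×-homo-+ 1#

  fromℕ-* : ∀ a b → fromℕ (a ℕ.* b) ≈ fromℕ a * fromℕ b
  fromℕ-* = ×1-homo-*

  0≤fromℕ : ∀ k → 0# ≤ fromℕ k
  0≤fromℕ zero    = ≤.refl
  0≤fromℕ (suc k) = ≤.≤-respˡ-≈ (+-identityˡ 0#) (+-mono 0≤1 (0≤fromℕ k))

  fromℕ-mono : ∀ {a b} → a ℕ.≤ b → fromℕ a ≤ fromℕ b
  fromℕ-mono {b = b} ℕ.z≤n = 0≤fromℕ b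
  fromℕ-mono (ℕ.s≤s a≤b)   = +-mono ≤.refl (fromℕ-mono a≤b)

  fromℕ-sum : ∀ {n} (f : Fin n → ℕ) → fromℕ (sumℕ f) ≈ sum (λ i → fromℕ (f i))
  fromℕ-sum {zero}  f = refl
  fromℕ-sum {suc n} f = trans (fromℕ-+ (f zero) (sumℕ (f ∘ suc))) (+-congˡ (fromℕ-sum (f ∘ suc)))

  sum-nonneg : ∀ {n} {f : Fin n → Carrier} → (∀ i → 0# ≤ f i) → 0# ≤ sum f
  sum-nonneg {zero}  0≤f = ≤.refl
  sum-nonneg {suc n} 0≤f = ≤.≤-respˡ-≈ (+-identityˡ 0#) (+-mono (0≤f zero) (sum-nonneg (0≤f ∘ suc)))

  sum-mono : ∀ {n} {f g : Fin n → Carrier} → (∀ i → f i ≤ g i) → sum f ≤ sum g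
  sum-mono {zero}  f≤g = ≤.refl
  sum-mono {suc n} f≤g = +-mono (f≤g zero) (sum-mono (f≤g ∘ suc))

  -- t is z rounded with threshold s: t = ⌊z − s⌋ + 1.
  Rounds : Carrier → Carrier → ℕ → Set ℓ
  Rounds s z t = fromℕ t + s ≤ z + 1# × fromℕ t + s ≰ z

  -- If the conclusion failed it would fail by at least 1, as its terms are integers; this 1 is
  -- exactly the slack in the lower half of `Rounds`. The bound z - z′ ≤ c - a is stated with a and
  -- c on separate sides.
  rounds-mono : ∀ {s z z′ t t′} a c → Rounds s z t → Rounds s z′ t′ →
                z + fromℕ a ≤ z′ + fromℕ c → t ℕ.+ a ℕ.≤ t′ ℕ.+ c
  rounds-mono {s} {z} {z′} {t} {t′} a c (low , _) (_ , high) le = ℕ.≮⇒≥ λ lt → high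
    (≤-from (+-mono (+-mono (≤.≤-respˡ-≈ (+-congˡ (fromℕ-+ t′ c)) (≤.≤-respʳ-≈ (fromℕ-+ t a) (fromℕ-mono lt))) low) le)
      (solve 8 (λ F s z z′ A C T o → (F :+ s) :+ (((T :+ A) :+ (z :+ o)) :+ (z′ :+ C)) :=
                  z′ :+ (((o :+ (F :+ C)) :+ (T :+ s)) :+ (z :+ A)))
        refl (fromℕ t′) s z z′ (fromℕ a) (fromℕ c) (fromℕ t) 1#))

  rounds-unique : ∀ {s z z′ t t′} → z ≈ z′ → Rounds s z t → Rounds s z′ t′ → t ≡ t′
  rounds-unique {t = t} {t′} z≈z′ r r′ = ℕ.≤-antisym
    (≡.subst₂ ℕ._≤_ (ℕ.+-identityʳ t) (ℕ.+-identityʳ t′) (rounds-mono 0 0 r r′ (≤.reflexive (+-congʳ z≈z′))))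
    (≡.subst₂ ℕ._≤_ (ℕ.+-identityʳ t′) (ℕ.+-identityʳ t) (rounds-mono 0 0 r′ r (≤.reflexive (+-congʳ (sym z≈z′)))))

  -- With 0 excluded and 1 included, every natural number rounds to itself.
  Threshold : Carrier → Set ℓ
  Threshold s = s ≰ 0# × s ≤ 1#

  rounds-fromℕ : ∀ {s} → Threshold s → ∀ t → Rounds s (fromℕ t) t
  rounds-fromℕ {s} (s≰0 , s≤1) t = +-mono ≤.refl s≤1 , λ le → s≰0
    (≤-from le (trans (+-comm s (fromℕ t)) (sym (+-identityˡ _))))

  floor : ∀ {z} k → 0# ≤ z → fromℕ (suc k) ≰ z → ∃ λ m → fromℕ m ≤ z × fromℕ (suc m) ≰ z
  floor {z} k 0≤z k+1≰z with fromℕ k ≤? z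
  floor {z} k       0≤z k+1≰z | yes k≤z = k , k≤z , k+1≰z
  floor {z} zero    0≤z k+1≰z | no  0≰z = contradiction 0≤z 0≰z
  floor {z} (suc k) 0≤z k+1≰z | no  k≰z = floor k 0≤z k≰z

  record Split (z : Carrier) : Set (c ⊔ ℓ) where
    field
      whole    : ℕ
      fraction : Carrier
      split    : z ≈ fromℕ whole + fraction
      0≤frac   : 0# ≤ fraction
      1≰frac   : 1# ≰ fraction

  splitting : ∀ d {z} → 0# ≤ z → z ≤ fromℕ d → Split z
  splitting d {z} 0≤z z≤d with floor d 0≤z (λ le → 1≰0 (≤-from (≤.trans le z≤d)
    (sym (+-identityˡ _))))
  ... | m , m≤z , m+1≰z = record
    { whole = m
    ; fraction = z - fromℕ m
    ; split = sym (trans (+-comm _ _) (x-y+y z (fromℕ m)))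
    ; 0≤frac = x≤y⇒0≤y-x m≤z
    ; 1≰frac = λ le → m+1≰z (≤.≤-respʳ-≈ (x-y+y z (fromℕ m)) (+-monoˡ-≤ (fromℕ m) le))
    }

  roundAt : ∀ {z} → Split z → Carrier → ℕ
  roundAt S s = whole ℕ.+ 𝟙? (s ≤? fraction)
    where open Split S

  rounds-roundAt : ∀ {z} (S : Split z) {s} → Threshold s → Rounds s z (roundAt S s)
  rounds-roundAt {z} S {s} (s≰0 , s≤1) with s ≤? Split.fraction S
  ... | yes s≤φ = ≤.≤-respˡ-≈ (+-congʳ (sym one)) (≤.≤-respʳ-≈ (+-congʳ (sym split))
                    (≤-from s≤φ (solve 4 (λ m o s φ → ((m :+ o) :+ s) :+ φ := ((m :+ φ) :+ o) :+ s) refl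
                        (fromℕ whole) 1# s fraction)))
                , λ le → 1≰frac (≤-from (+-mono (≤.≤-respˡ-≈ (+-congʳ one) (≤.≤-respʳ-≈ split le)) (≰⇒≤ s≰0))
                    (trans (solve 4 (λ m o s φ → o :+ ((m :+ φ) :+ s) := φ :+ ((m :+ o) :+ s)) refl (fromℕ whole)
                        1# s fraction)
                             (+-congˡ (sym (+-identityʳ _)))))
    where
    open Split S
    one : fromℕ (whole ℕ.+ 1) ≈ fromℕ whole + 1#
    one = trans (fromℕ-+ whole 1) (+-congˡ (+-identityʳ 1#))
  ... | no s≰φ = ≤.≤-respˡ-≈ (+-congʳ (sym zero′)) (≤.≤-respʳ-≈ (+-congʳ (sym split))
                   (≤-from (+-mono s≤1 0≤frac) (trans
                       (solve 4 (λ m o s φ → (m :+ s) :+ (o :+ φ) := ((m :+ φ) :+ o) :+ s) refl (fromℕ whole) 1# s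
                           fraction)
                     (+-congˡ (sym (+-identityʳ s))))))
               , λ le → s≰φ (≤-from (≤.≤-respˡ-≈ (+-congʳ zero′) (≤.≤-respʳ-≈ split le))
                   (solve 3 (λ m s φ → s :+ (m :+ φ) := φ :+ (m :+ s)) refl (fromℕ whole) s fraction))
    where
    open Split S
    zero′ : fromℕ (whole ℕ.+ 0) ≈ fromℕ whole
    zero′ = reflexive (cong fromℕ (ℕ.+-identityʳ whole))

  -- A subdivision of the interval (lo , 1] into half-open intervals (s , s′].
  data Chain (lo : Carrier) : Set (c ⊔ ℓ) where
    end : 1# ≰ lo → Chain lo
    cut : ∀ s → s ≰ lo → s ≤ 1# → Chain s → Chain lo

  pieces : ∀ {lo} → Chain lo → ℕ
  pieces (end _)       = 1
  pieces (cut _ _ _ C) = suc (pieces C)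

  -- Pieces are closed on the right, so for a cut φ the truth of s ≤ φ is constant on each piece and
  -- its right end can represent it.
  endpoint : ∀ {lo} (C : Chain lo) → Fin (pieces C) → Carrier
  endpoint (end _)       _       = 1#
  endpoint (cut s _ _ C) zero    = s
  endpoint (cut s _ _ C) (suc k) = endpoint C k

  width : ∀ {lo} (C : Chain lo) → Fin (pieces C) → Carrier
  width {lo} (end _)       _       = 1# - lo
  width {lo} (cut s _ _ C) zero    = s - lo
  width {lo} (cut s _ _ C) (suc k) = width C k

  0≤width : ∀ {lo} (C : Chain lo) k → 0# ≤ width C k
  0≤width (end 1≰lo)        k       = x≤y⇒0≤y-x (≰⇒≤ 1≰lo)
  0≤width (cut s s≰lo _ C) zero    = x≤y⇒0≤y-x (≰⇒≤ s≰lo)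
  0≤width (cut s s≰lo _ C) (suc k) = 0≤width C k

  endpoint≰lo : ∀ {lo} (C : Chain lo) k → endpoint C k ≰ lo
  endpoint≰lo (end 1≰lo)       k       = 1≰lo
  endpoint≰lo (cut s s≰lo _ C) zero    = s≰lo
  endpoint≰lo (cut s s≰lo _ C) (suc k) = λ le → endpoint≰lo C k (≤.trans le (≰⇒≤ s≰lo))

  endpoint≤1 : ∀ {lo} (C : Chain lo) k → endpoint C k ≤ 1#
  endpoint≤1 (end _)         k       = ≤.refl
  endpoint≤1 (cut s _ s≤1 C) zero    = s≤1
  endpoint≤1 (cut s _ s≤1 C) (suc k) = endpoint≤1 C k

  telescope : ∀ a b c → (b - a) + (c - b) ≈ c - a
  telescope a b c = trans (solve 4 (λ b a′ c b′ → (b :+ a′) :+ (c :+ b′) := (c :+ a′) :+ (b :+ b′)) refl b (- a) c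
      (- b))
    (trans (+-congˡ (-‿inverseʳ b)) (+-identityʳ _))

  sum-width : ∀ {lo} (C : Chain lo) → sum (width C) ≈ 1# - lo
  sum-width      (end _)       = +-identityʳ _
  sum-width {lo} (cut s _ _ C) = trans (+-congˡ (sum-width C)) (telescope lo s 1#)

  -- φ ≤ lo, or φ is one of the cuts of C.
  Resolves : ∀ {lo} → Chain lo → Carrier → Set ℓ
  Resolves {lo} (end _)       φ = φ ≤ lo
  Resolves {lo} (cut s _ _ C) φ = φ ≤ lo ⊎ (s ≤ φ × Resolves C φ)

  -- A value at or below lo needs no cut, since all thresholds lie above lo. Keeping the old values
  -- resolved is what permits one chain to serve all partial sums at once.
  refine : ∀ {lo} (C : Chain lo) ψ → 1# ≰ ψ →
           ∃ λ (C′ : Chain lo) → Resolves C′ ψ × (∀ φ → Resolves C φ → Resolves C′ φ)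
  refine {lo} (end 1≰lo) ψ 1≰ψ with ψ ≤? lo
  ... | yes ψ≤lo = end 1≰lo , ψ≤lo , λ φ r → r
  ... | no  ψ≰lo = cut ψ ψ≰lo (≰⇒≤ 1≰ψ) (end 1≰ψ) , inj₂ (≤.refl , ≤.refl) , λ φ → inj₁
  refine {lo} (cut s s≰lo s≤1 C) ψ 1≰ψ with ψ ≤? lo | s ≤? ψ
  ... | yes ψ≤lo | _ = cut s s≰lo s≤1 C , inj₁ ψ≤lo , λ φ r → r
  ... | no  ψ≰lo | yes s≤ψ with refine C ψ 1≰ψ
  ...   | C′ , rψ , keep = cut s s≰lo s≤1 C′ , inj₂ (s≤ψ , rψ)
        , λ { φ (inj₁ φ≤lo) → inj₁ φ≤lo ; φ (inj₂ (s≤φ , r)) → inj₂ (s≤φ , keep φ r) }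
  refine {lo} (cut s s≰lo s≤1 C) ψ 1≰ψ | no ψ≰lo | no s≰ψ =
    cut ψ ψ≰lo (≰⇒≤ 1≰ψ) (cut s s≰ψ s≤1 C) , inj₂ (≤.refl , inj₁ ≤.refl)
    , λ { φ (inj₁ φ≤lo) → inj₁ φ≤lo ; φ (inj₂ (s≤φ , r)) → inj₂ (≤.trans (≰⇒≤ s≰ψ) s≤φ , inj₂ (s≤φ , r)) }

  resolveAll : ∀ {K} (φ : Fin K → Carrier) → (∀ k → 1# ≰ φ k) → ∃ λ (C : Chain 0#) → ∀ k → Resolves C (φ k)
  resolveAll {zero}  φ 1≰φ = end 1≰0 , λ ()
  resolveAll {suc K} φ 1≰φ with resolveAll (φ ∘ suc) (1≰φ ∘ suc)
  ... | C , r with refine C (φ zero) (1≰φ zero)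
  ...   | C′ , r₀ , keep = C′ , λ { zero → r₀ ; (suc k) → keep _ (r k) }

  -- For a resolved φ ≥ lo this is the length of the set of thresholds in (lo , φ].
  measure : ∀ {lo} (C : Chain lo) → Carrier → Carrier
  measure C φ = sum (λ k → width C k * fromℕ (𝟙? (endpoint C k ≤? φ)))

  measure-≤ : ∀ {lo} (C : Chain lo) {φ} → φ ≤ lo → measure C φ ≈ 0#
  measure-≤ C {φ} φ≤lo = sum-0 λ k → trans
    (*-congˡ (reflexive (cong fromℕ (𝟙?-no (endpoint C k ≤? φ) λ le → endpoint≰lo C k (≤.trans le φ≤lo))))) (zeroʳ _)

  measure-resolved : ∀ {lo} (C : Chain lo) {φ} → Resolves C φ → lo ≤ φ → measure C φ ≈ φ - lo
  measure-resolved {lo} C {φ} r lo≤φ with φ ≤? lo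
  ... | yes φ≤lo = trans (measure-≤ C φ≤lo) (sym (trans (+-congʳ (≤.antisym φ≤lo lo≤φ)) (-‿inverseʳ lo)))
  measure-resolved (end _) φ≤lo lo≤φ | no φ≰lo = contradiction φ≤lo φ≰lo
  measure-resolved (cut s _ _ C) (inj₁ φ≤lo) lo≤φ | no φ≰lo = contradiction φ≤lo φ≰lo
  measure-resolved {lo} (cut s _ _ C) {φ} (inj₂ (s≤φ , r)) lo≤φ | no φ≰lo = begin
    (s - lo) * fromℕ (𝟙? (s ≤? φ)) + measure C φ
        ≈⟨ +-cong (*-congˡ (trans (reflexive (cong fromℕ (𝟙?-yes (s ≤? φ) s≤φ))) (+-identityʳ 1#)))
            (measure-resolved C r s≤φ) ⟩
    (s - lo) * 1# + (φ - s)                       ≈⟨ +-congʳ (*-identityʳ _) ⟩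
    (s - lo) + (φ - s)                            ≈⟨ telescope lo s φ ⟩
    φ - lo                                        ∎

  -- Rounding a real vector with all thresholds s ∈ (0 , 1] and averaging over s
  -- gives back the vector.
  record Rounding {K} (Y : Fin K → Carrier) : Set (c ⊔ ℓ) where
    field
      count     : ℕ
      threshold : Fin count → Carrier
      weight    : Fin count → Carrier
      rounded   : Fin count → Fin K → ℕ
      isThreshold : ∀ l → Threshold (threshold l)
      0≤weight  : ∀ l → 0# ≤ weight l
      sum-weight : sum weight ≈ 1#
      rounds    : ∀ l k → Rounds (threshold l) (Y k) (rounded l k)
      average   : ∀ k → sum (λ l → weight l * fromℕ (rounded l k)) ≈ Y k

  -- Averaging keeps the whole part, as the weights sum to 1, and turns the indicator of s ≤
  -- fraction into the length of (0 , fraction], which is the fraction.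
  rounding : ∀ d {K} (Y : Fin K → Carrier) → (∀ k → 0# ≤ Y k) → (∀ k → Y k ≤ fromℕ d) → Rounding Y
  rounding d {K} Y 0≤Y Y≤d = record
    { count       = pieces C
    ; threshold   = endpoint C
    ; weight      = width C
    ; rounded     = λ l k → roundAt (S k) (endpoint C l)
    ; isThreshold = isThr
    ; 0≤weight    = 0≤width C
    ; sum-weight  = total
    ; rounds      = λ l k → rounds-roundAt (S k) (isThr l)
    ; average     = average
    }
    where
    S : ∀ k → Split (Y k)
    S k = splitting d (0≤Y k) (Y≤d k)
    module S k = Split (S k)
    resolved = resolveAll S.fraction S.1≰frac
    C = proj₁ resolved
    isThr : ∀ l → Threshold (endpoint C l)
    isThr l = endpoint≰lo C l , endpoint≤1 C l
    x-0 : ∀ x → x - 0# ≈ x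
    x-0 x = trans (sym (+-identityʳ _)) (x-y+y x 0#)
    total : sum (width C) ≈ 1#
    total = trans (sum-width C) (x-0 1#)
    average : ∀ k → sum (λ l → width C l * fromℕ (roundAt (S k) (endpoint C l))) ≈ Y k
    average k = begin
      sum (λ l → width C l * fromℕ (roundAt (S k) (endpoint C l)))
        ≈⟨ sum-cong (λ l → trans (*-congˡ (fromℕ-+ (S.whole k) (ind l)))
            (distribˡ (width C l) (fromℕ (S.whole k)) (fromℕ (ind l)))) ⟩
      sum (λ l → width C l * fromℕ (S.whole k) + width C l * fromℕ (ind l))
        ≈⟨ ∑-distrib-+ {pieces C} (λ l → width C l * fromℕ (S.whole k)) (λ l → width C l * fromℕ (ind l)) ⟩
      sum (λ l → width C l * fromℕ (S.whole k)) + measure C (S.fraction k)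
        ≈⟨ +-cong (trans (sum-cong (λ l → *-comm (width C l) (fromℕ (S.whole k))))
            (trans (sym (*-sum (fromℕ (S.whole k)) (width C)))
                    (trans (*-congˡ total) (*-identityʳ _))))
                  (trans (measure-resolved C (proj₂ resolved k) (S.0≤frac k)) (x-0 _)) ⟩
      fromℕ (S.whole k) + S.fraction k    ≈⟨ S.split k ⟨
      Y k                                 ∎
      where
      ind : Fin (pieces C) → ℕ
      ind l = 𝟙? (endpoint C l ≤? S.fraction k)

-- Cyclic intervals as differences of prefixes

open Counting
open MatroidRank
open CyclicIntervals
open IntervalBases

ccw-sum : ∀ {n} (π : Permutation′ n) S → ccw π S ≡ sumℕ (λ x → 𝟙? (ccwArrow π x ⊆? S))
ccw-sum {n} π S = ≡.trans (size (tabulate (λ x → does (ccwArrow π x ⊆? S))))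
  (sumℕ-cong {n} (λ x → cong 𝟙 (lookup∘tabulate (λ x → does (ccwArrow π x ⊆? S)) x)))

size-∩ : ∀ {n} (S T : Subset n) → ∣ S ∩ T ∣ ≡ sumℕ (λ i → 𝟙? (i ∈? T) ℕ.* 𝟙? (i ∈? S))
size-∩ {n} S T = ≡.trans (size-∈? (S ∩ T)) (sumℕ-cong pointwise)
  where
  pointwise : ∀ i → 𝟙? (i ∈? (S ∩ T)) ≡ 𝟙? (i ∈? T) ℕ.* 𝟙? (i ∈? S)
  pointwise i with i ∈? T | i ∈? S
  ... | yes t | yes s = 𝟙?-yes (i ∈? (S ∩ T)) (x∈p∩q⁺ (s , t))
  ... | yes t | no ¬s = 𝟙?-no (i ∈? (S ∩ T)) (¬s ∘ p∩q⊆p S T)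
  ... | no ¬t | _     = 𝟙?-no (i ∈? (S ∩ T)) (¬t ∘ p∩q⊆q S T)

prefix : ∀ {n} → ℕ → Fin n → ℕ
prefix k i = 𝟙? (toℕ i ℕ.<? k)

-- ε tells whether the cyclic interval runs past n.
interval-prefix : ∀ {n} (a b : Fin n) → ∃ λ ε → ∀ i →
                  𝟙? (i ∈? ⟦ a , b ⟧) ℕ.+ prefix (toℕ a) i ≡ prefix (suc (toℕ b)) i ℕ.+ ε
interval-prefix {suc m} a b with toℕ a ℕ.≤? toℕ b
... | yes a≤b = 0 , λ i → ≡.sym (≡.trans (ℕ.+-identityʳ _)
    (𝟙?-⊎ (toℕ i ℕ.<? suc (toℕ b)) (i ∈? ⟦ a , b ⟧) (toℕ i ℕ.<? toℕ a)
      (split i)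
      (λ i∈ → ℕ.s≤s (lower i b (proj₂ (straight i i∈)))) (λ i<a → ℕ.m≤n⇒m≤1+n (ℕ.≤-trans i<a a≤b))
      (λ i∈ → ℕ.≤⇒≯ (lower a i (proj₁ (straight i i∈))))))
  where
  o : Fin (suc m)
  o = zero
  lift : ∀ x y → toℕ x ℕ.≤ toℕ y → offset o x ℕ.≤ offset o y
  lift x y = ≡.subst₂ ℕ._≤_ (≡.sym (offset-straight {o = o} {x} ℕ.z≤n)) (≡.sym (offset-straight {o = o} {y} ℕ.z≤n))
  lower : ∀ x y → offset o x ℕ.≤ offset o y → toℕ x ℕ.≤ toℕ y
  lower x y = ≡.subst₂ ℕ._≤_ (offset-straight {o = o} {x} ℕ.z≤n) (offset-straight {o = o} {y} ℕ.z≤n)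
  split : ∀ i → toℕ i ℕ.< suc (toℕ b) → i ∈ ⟦ a , b ⟧ ⊎ toℕ i ℕ.< toℕ a
  split i i<b with ℕ.<-≤-connex (toℕ i) (toℕ a)
  ... | inj₁ i<a = inj₂ i<a
  ... | inj₂ a≤i = inj₁ (∈-straight⁺ o {a} {b} {i} (lift a i a≤i) (lift i b (ℕ.s≤s⁻¹ i<b)))
  straight : ∀ i → i ∈ ⟦ a , b ⟧ → offset o a ℕ.≤ offset o i × offset o i ℕ.≤ offset o b
  straight i = ∈-straight⁻ o {a} {b} {i} (lift a b a≤b)
... | no a≰b = 1 , λ i → begin
    𝟙? (i ∈? ⟦ a , b ⟧) ℕ.+ prefix (toℕ a) i
      ≡⟨ cong (ℕ._+ prefix (toℕ a) i) (𝟙?-⊎ (i ∈? ⟦ a , b ⟧) (toℕ i ℕ.<? suc (toℕ b)) (¬? (toℕ i ℕ.<? toℕ a))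
           (λ i∈ → [ (λ a≤i → inj₂ (ℕ.≤⇒≯ (lower a i a≤i))) , (λ i≤b → inj₁ (ℕ.s≤s (lower i b i≤b))) ]
               (∈-wrapped⁻ o {a} {b} {i} b<a i∈))
           (λ i<b → ∈-wrapped⁺ o {a} {b} {i} b<a (inj₂ (lift i b (ℕ.s≤s⁻¹ i<b))))
           (λ i≮a → ∈-wrapped⁺ o {a} {b} {i} b<a (inj₁ (lift a i (ℕ.≮⇒≥ i≮a))))
           (λ i<b i≮a → i≮a (ℕ.≤-<-trans (ℕ.s≤s⁻¹ i<b) (ℕ.≰⇒> a≰b)))) ⟩
    prefix (suc (toℕ b)) i ℕ.+ 𝟙? (¬? (toℕ i ℕ.<? toℕ a)) ℕ.+ prefix (toℕ a) i
      ≡⟨ ℕ.+-assoc (prefix (suc (toℕ b)) i) _ _ ⟩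
    prefix (suc (toℕ b)) i ℕ.+ (𝟙? (¬? (toℕ i ℕ.<? toℕ a)) ℕ.+ prefix (toℕ a) i)
      ≡⟨ cong (prefix (suc (toℕ b)) i ℕ.+_) (complement (toℕ i ℕ.<? toℕ a)) ⟩
    prefix (suc (toℕ b)) i ℕ.+ 1 ∎
  where
  open ≡-Reasoning
  o : Fin (suc m)
  o = zero
  lift : ∀ x y → toℕ x ℕ.≤ toℕ y → offset o x ℕ.≤ offset o y
  lift x y = ≡.subst₂ ℕ._≤_ (≡.sym (offset-straight {o = o} {x} ℕ.z≤n)) (≡.sym (offset-straight {o = o} {y} ℕ.z≤n))
  lower : ∀ x y → offset o x ℕ.≤ offset o y → toℕ x ℕ.≤ toℕ y
  lower x y = ≡.subst₂ ℕ._≤_ (offset-straight {o = o} {x} ℕ.z≤n) (offset-straight {o = o} {y} ℕ.z≤n)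
  b<a : offset o b ℕ.< offset o a
  b<a = ≡.subst₂ ℕ._<_ (≡.sym (offset-straight {o = o} {b} ℕ.z≤n)) (≡.sym (offset-straight {o = o} {a} ℕ.z≤n))
      (ℕ.≰⇒> a≰b)
  complement : ∀ {P : Set} (P? : Dec P) → 𝟙? (¬? P?) ℕ.+ 𝟙? P? ≡ 1
  complement (yes _) = ≡.refl
  complement (no _)  = ≡.refl

prefix-telescope : ∀ {n} (N : Fin (suc n) → ℕ) (b : Fin n → ℕ) → (∀ i → N (suc i) ≡ N (inject₁ i) ℕ.+ b i) →
                   ∀ k → N k ≡ N zero ℕ.+ sumℕ (λ i → prefix (toℕ k) i ℕ.* b i)
prefix-telescope {n} N b step zero = ≡.sym (≡.trans (cong (N zero ℕ.+_)
  (sumℕ-0 {n} λ i → cong (ℕ._* b i) (𝟙?-no (toℕ i ℕ.<? 0) ℕ.n≮0))) (ℕ.+-identityʳ _))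
prefix-telescope {suc n} N b step (suc k) = begin
  N (suc k)
      ≡⟨ prefix-telescope (N ∘ suc) (b ∘ suc) (step ∘ suc) k ⟩
  N (suc zero) ℕ.+ s                                              ≡⟨ cong (ℕ._+ s) (step zero) ⟩
  N zero ℕ.+ b zero ℕ.+ s                                         ≡⟨ ℕ.+-assoc (N zero) _ _ ⟩
  N zero ℕ.+ (b zero ℕ.+ s)
      ≡⟨ cong (λ t → N zero ℕ.+ (t ℕ.+ s)) (ℕ.*-identityˡ (b zero)) ⟨
  N zero ℕ.+ (1 ℕ.* b zero ℕ.+ s)                                 ∎
  where
  open ≡-Reasoning
  s = sumℕ (λ i → prefix (toℕ k) i ℕ.* b (suc i))

-- Linear functionals with natural coefficients, and rounding to indicator vectors

module _ {c ℓ} (ℝ : RealNumbers c ℓ) where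
  open RealNumbers ℝ hiding (zero)
  open OverReals ℝ
  open Determinants ℝ
  open PositroidMinors ℝ
  open ThresholdRounding ℝ
  open import Algebra.Properties.Semiring.Sum semiring using (∑-distrib-+)
  open import Algebra.Solver.Ring.NaturalCoefficients.Default commutativeSemiring
    using (solve; _:=_; _:+_; _:*_)
  open import Relation.Binary.Reasoning.Setoid setoid
  private
    module ≤ = IsDecTotalOrder isDecTotalOrder

  sum-single : ∀ {n} {f : Fin n → Carrier} k → (∀ i → i ≢ k → f i ≈ 0#) → sum f ≈ f k
  sum-single zero    f≈0 = trans (+-congˡ (sum-0 (λ i → f≈0 (suc i) λ ()))) (+-identityʳ _)
  sum-single (suc k) f≈0 = trans
      (+-cong (f≈0 zero λ ()) (sum-single k λ i i≢k → f≈0 (suc i) λ { ≡.refl → i≢k ≡.refl })) (+-identityˡ _)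

  weighted : ∀ {n} → (Fin n → ℕ) → Vector Carrier n → Carrier
  weighted f x = sum (λ i → fromℕ (f i) * x i)

  weighted-+ : ∀ {n} (f g : Fin n → ℕ) x → weighted (λ i → f i ℕ.+ g i) x ≈ weighted f x + weighted g x
  weighted-+ {n} f g x = trans (sum-cong λ i → trans (*-congʳ (fromℕ-+ (f i) (g i)))
      (distribʳ (x i) (fromℕ (f i)) (fromℕ (g i))))
    (∑-distrib-+ {n} (λ i → fromℕ (f i) * x i) (λ i → fromℕ (g i) * x i))

  weighted-cong : ∀ {n} {f g : Fin n → ℕ} x → (∀ i → f i ≡ g i) → weighted f x ≈ weighted g x
  weighted-cong x f≗g = sum-cong λ i → *-congʳ {x i} (reflexive (cong fromℕ (f≗g i)))

  weighted-const : ∀ {n} k (x : Vector Carrier n) → weighted (λ _ → k) x ≈ fromℕ k * sum x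
  weighted-const k x = sym (*-sum (fromℕ k) x)

  weighted-1 : ∀ {n} (x : Vector Carrier n) → weighted (λ _ → 1) x ≈ sum x
  weighted-1 x = trans (weighted-const 1 x) (trans (*-congʳ (+-identityʳ 1#)) (*-identityˡ _))

  weighted-mono : ∀ {n} {f g : Fin n → ℕ} {x} → (∀ i → 0# ≤ x i) → (∀ i → f i ℕ.≤ g i) → weighted f x ≤ weighted g x
  weighted-mono {f = f} {g} {x} 0≤x f≤g = sum-mono λ i →
    ≤.≤-respʳ-≈ (trans (sym (distribʳ (x i) _ _))
        (*-congʳ (trans (sym (fromℕ-+ (f i) _)) (reflexive (cong fromℕ (ℕ.m+[n∸m]≡n (f≤g i)))))))
      (≤.≤-respˡ-≈ (+-identityʳ _) (+-mono ≤.refl (*-nonneg (0≤fromℕ (g i ℕ.∸ f i)) (0≤x i))))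

  indicator : ∀ b x → (if b then x else 0#) ≈ fromℕ (𝟙 b) * x
  indicator true  x = sym (trans (*-congʳ (+-identityʳ 1#)) (*-identityˡ x))
  indicator false x = sym (zeroˡ x)

  ∑-weighted : ∀ {n} (S : Subset n) x → ∑[ S ] x ≈ weighted (λ i → 𝟙? (i ∈? S)) x
  ∑-weighted S x = sum-cong λ i → trans (indicator (lookup S i) (x i))
    (*-congʳ {x i} (reflexive (cong (λ b → fromℕ (𝟙 b)) (does-∈? S i))))

  e-indicator : ∀ {n} (B : Subset n) i → e⟨ B ⟩ i ≈ fromℕ (𝟙? (i ∈? B))
  e-indicator B i = begin
    e⟨ B ⟩ i                             ≈⟨ ∑-weighted B (λ j → e j i) ⟩
    sum (λ j → fromℕ (𝟙? (j ∈? B)) * e j i)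
        ≈⟨ sum-single i (λ j j≢i → trans (*-congˡ {fromℕ (𝟙? (j ∈? B))} (off j j≢i)) (zeroʳ _)) ⟩
    fromℕ (𝟙? (i ∈? B)) * e i i          ≈⟨ *-congˡ {fromℕ (𝟙? (i ∈? B))} on ⟩
    fromℕ (𝟙? (i ∈? B)) * 1#             ≈⟨ *-identityʳ _ ⟩
    fromℕ (𝟙? (i ∈? B))                  ∎
    where
    off : ∀ j → j ≢ i → e j i ≈ 0#
    off j j≢i with j ≟ i
    ... | yes j≡i = contradiction j≡i j≢i
    ... | no _    = refl
    on : e i i ≈ 1#
    on with i ≟ i
    ... | yes _  = refl
    ... | no i≢i = contradiction ≡.refl i≢i

  module _ {n} (x : Vector Carrier n) where

    cumulative : Fin (suc n) → Carrier
    cumulative k = weighted (prefix (toℕ k)) x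

    cumulative-suc : ∀ i → cumulative (suc i) ≈ cumulative (inject₁ i) + x i
    cumulative-suc i = trans (weighted-cong x pointwise)
        (trans (weighted-+ (prefix (toℕ (inject₁ i))) (λ j → 𝟙? (j ≟ i)) x) (+-congˡ single))
      where
      pointwise : ∀ j → prefix (suc (toℕ i)) j ≡ prefix (toℕ (inject₁ i)) j ℕ.+ 𝟙? (j ≟ i)
      pointwise j = 𝟙?-⊎ (toℕ j ℕ.<? suc (toℕ i)) (toℕ j ℕ.<? toℕ (inject₁ i)) (j ≟ i)
        (λ j≤i → [ (λ j<i → inj₁ (subst (toℕ j ℕ.<_) (≡.sym (toℕ-inject₁ i)) j<i)) ,
            (λ eq → inj₂ (toℕ-injective eq)) ]
                   (ℕ.m≤n⇒m<n∨m≡n (ℕ.s≤s⁻¹ j≤i)))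
        (λ j<i → ℕ.m≤n⇒m≤1+n (subst (toℕ j ℕ.<_) (toℕ-inject₁ i) j<i))
        (λ { ≡.refl → ℕ.≤-refl })
        (λ { j<i ≡.refl → ℕ.<-irrefl (≡.sym (toℕ-inject₁ i)) j<i })
      single : weighted (λ j → 𝟙? (j ≟ i)) x ≈ x i
      single = trans (sum-single i (λ j j≢i → trans (*-congʳ (reflexive (cong fromℕ (𝟙?-no (j ≟ i) j≢i)))) (zeroˡ _)))
        (trans (*-congʳ (trans (reflexive (cong fromℕ (𝟙?-yes (i ≟ i) ≡.refl))) (+-identityʳ 1#))) (*-identityˡ _))

  -- Rounding the partial sums of x rounds x to 0/1-points satisfying the same interval bounds,
  -- because a bound on a cyclic interval is a bound on a difference of two partial sums.
  module RoundToSubsets {n d} (x : Vector Carrier n) (0≤x : ∀ i → 0# ≤ x i) (sum≈d : sum x ≈ fromℕ d)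
    (r : Fin n → Fin n → ℕ) (r-point : ∀ i → r i i ℕ.≤ 1) (bound : ∀ a b → ∑[ ⟦ a , b ⟧ ] x ≤ fromℕ (r a b)) where

    Y = cumulative x

    0≤Y : ∀ k → 0# ≤ Y k
    0≤Y k = sum-nonneg λ i → *-nonneg (0≤fromℕ (prefix (toℕ k) i)) (0≤x i)

    Y≤d : ∀ k → Y k ≤ fromℕ d
    Y≤d k = ≤.≤-respʳ-≈ (trans (weighted-1 x) sum≈d) (weighted-mono 0≤x λ i → 𝟙?-≤1 (toℕ i ℕ.<? toℕ k))

    open Rounding (rounding d Y 0≤Y Y≤d)

    module _ (l : Fin count) where
      N = rounded l

      N-zero : N zero ≡ 0
      N-zero = rounds-unique {z = Y zero}
        (sum-0 λ i → trans (*-congʳ {x i} (reflexive (cong fromℕ (𝟙?-no (toℕ i ℕ.<? 0) ℕ.n≮0)))) (zeroˡ _))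
        (rounds l zero) (rounds-fromℕ (isThreshold l) 0)

      N-last : N (Fin.fromℕ n) ≡ d
      N-last = rounds-unique {z = Y (Fin.fromℕ n)}
        (trans (weighted-cong x λ i → 𝟙?-yes (toℕ i ℕ.<? toℕ (Fin.fromℕ n))
            (subst (toℕ i ℕ.<_) (≡.sym (toℕ-fromℕ n)) (toℕ<n i)))
               (trans (weighted-1 x) sum≈d))
        (rounds l (Fin.fromℕ n)) (rounds-fromℕ (isThreshold l) d)

      B : Subset n
      B = tabulate (λ i → does (N (inject₁ i) ℕ.<? N (suc i)))

      x≤1 : ∀ i → x i ≤ 1#
      x≤1 i = ≤.trans (≤.reflexive (sym point))
          (≤.trans (bound i i) (≤.≤-respʳ-≈ (+-identityʳ 1#) (fromℕ-mono (r-point i))))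
        where
        point : ∑[ ⟦ i , i ⟧ ] x ≈ x i
        point = trans (∑-weighted ⟦ i , i ⟧ x) (trans
          (sum-single i (λ j j≢i → trans
              (*-congʳ (reflexive (cong fromℕ (𝟙?-no (j ∈? ⟦ i , i ⟧) (j≢i ∘ ∈⟦b,b⟧⇒≡))))) (zeroˡ _)))
          (trans (*-congʳ (trans (reflexive (cong fromℕ (𝟙?-yes (i ∈? ⟦ i , i ⟧) (first∈⟦⟧ i i))))
              (+-identityʳ 1#))) (*-identityˡ _)))

      -- Both 0 ≤ x i and x i ≤ 1 bound a difference of consecutive partial sums by an integer,
      -- hence survive rounding: the rounded sums jump by 0 or 1.
      N-step : ∀ i → N (suc i) ≡ N (inject₁ i) ℕ.+ 𝟙? (i ∈? B)
      N-step i = by-cases (N (inject₁ i) ℕ.<? N (suc i))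
        where
        up : N (inject₁ i) ℕ.≤ N (suc i)
        up = ≡.subst₂ ℕ._≤_ (ℕ.+-identityʳ _) (ℕ.+-identityʳ _)
            (rounds-mono 0 0 (rounds l (inject₁ i)) (rounds l (suc i))
          (+-monoˡ-≤ 0# (≤.≤-respʳ-≈ (sym (cumulative-suc x i))
              (≤.≤-respˡ-≈ (+-identityʳ _) (+-mono ≤.refl (0≤x i))))))
        down : N (suc i) ℕ.≤ N (inject₁ i) ℕ.+ 1
        down = subst (ℕ._≤ N (inject₁ i) ℕ.+ 1) (ℕ.+-identityʳ (N (suc i)))
            (rounds-mono 0 1 (rounds l (suc i)) (rounds l (inject₁ i))
          (≤.≤-respˡ-≈ (sym (trans (+-identityʳ _) (cumulative-suc x i)))
            (+-mono ≤.refl (≤.≤-respʳ-≈ (sym (+-identityʳ 1#)) (x≤1 i)))))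
        by-cases : Dec (N (inject₁ i) ℕ.< N (suc i)) → N (suc i) ≡ N (inject₁ i) ℕ.+ 𝟙? (i ∈? B)
        by-cases (yes lt) = ≡.trans (ℕ.≤-antisym down (subst (ℕ._≤ N (suc i)) (ℕ.+-comm 1 (N (inject₁ i))) lt))
          (cong (N (inject₁ i) ℕ.+_) (≡.sym (𝟙?-yes (i ∈? B) (∈-tabulate⁺ (λ i → N (inject₁ i) ℕ.<? N (suc i)) lt))))
        by-cases (no ¬lt) = ≡.trans (ℕ.≤-antisym (ℕ.≮⇒≥ ¬lt) up) (≡.trans (≡.sym (ℕ.+-identityʳ _))
          (cong (N (inject₁ i) ℕ.+_) (≡.sym
              (𝟙?-no (i ∈? B) (¬lt ∘ ∈-tabulate⁻ (λ i → N (inject₁ i) ℕ.<? N (suc i)))))))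

      β : Fin n → ℕ
      β i = 𝟙? (i ∈? B)

      N-prefix : ∀ k → N k ≡ sumℕ (λ i → prefix (toℕ k) i ℕ.* β i)
      N-prefix k = ≡.trans (prefix-telescope N β N-step k) (cong (ℕ._+ sumℕ (λ i → prefix (toℕ k) i ℕ.* β i)) N-zero)

      sum-β : sumℕ β ≡ d
      sum-β = ≡.trans (sumℕ-cong λ i → ≡.sym (≡.trans (cong (ℕ._* β i)
          (𝟙?-yes (toℕ i ℕ.<? toℕ (Fin.fromℕ n)) (subst (toℕ i ℕ.<_) (≡.sym (toℕ-fromℕ n)) (toℕ<n i))))
              (ℕ.*-identityˡ (β i))))
        (≡.trans (≡.sym (N-prefix (Fin.fromℕ n))) N-last)

      size-B : ∣ B ∣ ≡ d
      size-B = ≡.trans (size-∈? B) sum-β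

      -- By `interval-prefix`, E has x-sum `Y (b+1) + ε d − Y a`, and |B ∩ E| is the same expression
      -- in the rounded sums. As ε d and the rank bound are natural numbers, `rounds-mono` carries
      -- the inequality over.
      B-bound : ∀ a b → ∣ B ∩ ⟦ a , b ⟧ ∣ ℕ.≤ r a b
      B-bound a b = ℕ.+-cancelˡ-≤ (N (inject₁ a)) _ _
          (ℕ.≤-trans (ℕ.≤-reflexive (≡.trans (ℕ.+-comm (N (inject₁ a)) _) balanceℕ))
        (rounds-mono (ε ℕ.* d) (r a b) (rounds l (suc b)) (rounds l (inject₁ a)) Y-bound))
        where
        E = ⟦ a , b ⟧
        ε = proj₁ (interval-prefix a b)
        balance : ∀ i → 𝟙? (i ∈? E) ℕ.+ prefix (toℕ (inject₁ a)) i ≡ prefix (suc (toℕ b)) i ℕ.+ ε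
        balance i = ≡.trans (cong (λ t → 𝟙? (i ∈? E) ℕ.+ prefix t i) (toℕ-inject₁ a)) (proj₂ (interval-prefix a b) i)
        sumℕ-*ˡ : ∀ {n} k (f : Fin n → ℕ) → sumℕ (λ i → k ℕ.* f i) ≡ k ℕ.* sumℕ f
        sumℕ-*ˡ {zero}  k f = ≡.sym (ℕ.*-zeroʳ k)
        sumℕ-*ˡ {suc n} k f = ≡.trans (cong (k ℕ.* f zero ℕ.+_) (sumℕ-*ˡ k (f ∘ suc)))
            (≡.sym (ℕ.*-distribˡ-+ k (f zero) _))
        sumℕ-distrib : ∀ (f g : Fin n → ℕ) → sumℕ (λ i → (f i ℕ.+ g i) ℕ.* β i) ≡ sumℕ (λ i → f i ℕ.* β i) ℕ.+
            sumℕ (λ i → g i ℕ.* β i)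
        sumℕ-distrib f g = ≡.trans (sumℕ-cong λ i → ℕ.*-distribʳ-+ (β i) (f i) (g i)) (sumℕ-+ {n} _ _)
        balanceℕ : ∣ B ∩ E ∣ ℕ.+ N (inject₁ a) ≡ N (suc b) ℕ.+ ε ℕ.* d
        balanceℕ = ≡.trans (cong₂ ℕ._+_ (size-∩ B E) (N-prefix (inject₁ a)))
          (≡.trans (≡.sym (sumℕ-distrib (λ i → 𝟙? (i ∈? E)) (prefix (toℕ (inject₁ a)))))
          (≡.trans (sumℕ-cong (λ i → cong (ℕ._* β i) (balance i)))
          (≡.trans (sumℕ-distrib (prefix (suc (toℕ b))) (λ _ → ε))
          (≡.sym (cong₂ ℕ._+_ (N-prefix (suc b)) (≡.trans (cong (ε ℕ.*_) (≡.sym sum-β)) (≡.sym (sumℕ-*ˡ ε β))))))))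
        Y-bound : Y (suc b) + fromℕ (ε ℕ.* d) ≤ Y (inject₁ a) + fromℕ (r a b)
        Y-bound = ≤.≤-respˡ-≈ (begin
            ∑[ E ] x + Y (inject₁ a)                                ≈⟨ +-congʳ (∑-weighted E x) ⟩
            weighted (λ i → 𝟙? (i ∈? E)) x + Y (inject₁ a)
                ≈⟨ weighted-+ (λ i → 𝟙? (i ∈? E)) (prefix (toℕ (inject₁ a))) x ⟨
            weighted (λ i → 𝟙? (i ∈? E) ℕ.+ prefix (toℕ (inject₁ a)) i) x ≈⟨ weighted-cong x balance ⟩
            weighted (λ i → prefix (suc (toℕ b)) i ℕ.+ ε) x         ≈⟨ weighted-+ (prefix (suc (toℕ b))) (λ _ → ε) x ⟩
            Y (suc b) + weighted (λ _ → ε) x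
                ≈⟨ +-congˡ (trans (weighted-const ε x) (trans (*-congˡ sum≈d) (sym (fromℕ-* ε d)))) ⟩
            Y (suc b) + fromℕ (ε ℕ.* d)                             ∎)
          (≤.≤-respʳ-≈ (+-comm _ _) (+-monoˡ-≤ (Y (inject₁ a)) (bound a b)))

    decomposition : ∀ i → x i ≈ sum (λ l → weight l * e⟨ B l ⟩ i)
    decomposition i = +-cancelʳ (Y (inject₁ i)) (begin
      x i + Y (inject₁ i)        ≈⟨ trans (+-comm _ _) (sym (cumulative-suc x i)) ⟩
      Y (suc i)                  ≈⟨ average (suc i) ⟨
      sum (λ l → weight l * fromℕ (rounded l (suc i)))
        ≈⟨ sum-cong (λ l → trans (*-congˡ {weight l}
            (trans (reflexive (cong fromℕ (N-step l i))) (fromℕ-+ (rounded l (inject₁ i)) (β l i))))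
                                 (trans (distribˡ (weight l) _ _) (+-comm _ _))) ⟩
      sum (λ l → weight l * fromℕ (β l i) + weight l * fromℕ (rounded l (inject₁ i)))
        ≈⟨ ∑-distrib-+ {count} (λ l → weight l * fromℕ (β l i)) (λ l → weight l * fromℕ (rounded l (inject₁ i))) ⟩
      sum (λ l → weight l * fromℕ (β l i)) + sum (λ l → weight l * fromℕ (rounded l (inject₁ i)))
        ≈⟨ +-cong (sum-cong λ l → *-congˡ {weight l} (sym (e-indicator (B l) i))) (average (inject₁ i)) ⟩
      sum (λ l → weight l * e⟨ B l ⟩ i) + Y (inject₁ i) ∎)

    in-conv : ∀ {p} {P : Subset n → Set p} → (∀ {S} → ∣ S ∣ ≡ d → (∀ a b → ∣ S ∩ ⟦ a , b ⟧ ∣ ℕ.≤ r a b) → P S) →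
              conv (λ v → ∃ λ S → P S × (∀ i → v i ≈ e⟨ S ⟩ i)) x
    in-conv P-bounded = count , (λ l → e⟨ B l ⟩) , weight
      , (λ l → B l , P-bounded (size-B l) (B-bound l) , λ i → refl) , 0≤weight , sum-weight , decomposition

  interval-ranks⇒basis : ∀ {n} d (M : Matroid n) → IsPositroid d M → ∀ {B} → ∣ B ∣ ≡ d →
                         (∀ a b → ∣ B ∩ ⟦ a , b ⟧ ∣ ℕ.≤ rk M ⟦ a , b ⟧) → Matroid.Basis M B
  -- In rank 0 no set has size d - 1 to span a hyperplane; here B is empty and contained in any
  -- basis.
  interval-ranks⇒basis zero M (A , _ , nonneg , basis⇔) {B} ∣B∣ _ =
    independent⇒basis (B₀ , b₀ , λ {i} i∈ → contradiction (ℕ.≤-trans (ℕ.≤-reflexive (≡.sym (∣⁅x⁆∣≡1 i)))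
      (p⊆q⇒∣p∣≤∣q∣ {p = ⁅ i ⁆} λ j∈ → subst (_∈ B) (≡.sym (x∈⁅y⁆⇒x≡y i j∈)) i∈)) (ℕ.≤⇒≯ (ℕ.≤-reflexive ∣B∣))) ∣B∣
    where
    open Rank M zero (Positroid.size-basis M A nonneg basis⇔)
    B₀ = proj₁ (Matroid.nonempty M)
    b₀ = proj₂ (Matroid.nonempty M)
  interval-ranks⇒basis (suc m) M (A , _ , nonneg , basis⇔) =
    IntervalRanks.interval-ranks⇒basis M m (Positroid.size-basis M A nonneg basis⇔)
      (Hyperplanes.noncrossing M A nonneg basis⇔)

  -- From covered complements to all cyclic intervals

  module _ {n} (d : ℕ) (π : Permutation′ n) (x : Vector Carrier n) (0≤x : ∀ i → 0# ≤ x i)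
      (sum≈d : sum x ≈ fromℕ d) where

    Bounded : Subset n → Set ℓ
    Bounded E = ∑[ E ] x + fromℕ (ccw π (∁ E)) ≤ fromℕ d

    module _ {a b y} (y∉ : y ∉ ⟦ a , b ⟧) (uncovered : ∀ z → ccwArrow π z ⊆ ∁ ⟦ a , b ⟧ → y ∉ ccwArrow π z) where

      ccw-split : ccw π (∁ ⟦ a , b ⟧) ℕ.≤ ccw π (∁ ⟦ y , b ⟧) ℕ.+ ccw π (∁ ⟦ a , y ⟧)
      ccw-split = ≡.subst₂ ℕ._≤_ (≡.sym (ccw-sum π _))
        (≡.trans (sumℕ-+ {n} _ _) (≡.sym (cong₂ ℕ._+_ (ccw-sum π (∁ ⟦ y , b ⟧)) (ccw-sum π (∁ ⟦ a , y ⟧)))))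
        (sumℕ-mono pointwise)
        where
        pointwise : ∀ z → 𝟙? (ccwArrow π z ⊆? ∁ ⟦ a , b ⟧) ℕ.≤ 𝟙? (ccwArrow π z ⊆? ∁ ⟦ y , b ⟧) ℕ.+ 𝟙?
            (ccwArrow π z ⊆? ∁ ⟦ a , y ⟧)
        pointwise z with ccwArrow π z ⊆? ∁ ⟦ a , b ⟧
        ... | no  _   = ℕ.z≤n
        ... | yes out with arrow-one-side y∉ out (uncovered z out)
        ...   | inj₁ h = ℕ.≤-trans (ℕ.≤-reflexive (≡.sym (𝟙?-yes (ccwArrow π z ⊆? ∁ ⟦ y , b ⟧) h))) (ℕ.m≤m+n _ _)
        ...   | inj₂ h = ℕ.≤-trans (ℕ.≤-reflexive (≡.sym (𝟙?-yes (ccwArrow π z ⊆? ∁ ⟦ a , y ⟧) h))) (ℕ.m≤n+m _ _)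

      -- The intervals [y , b] and [a , y] cover the circle and overlap in [a , b] and y. The slack
      -- is the coordinate of x at y, so nonnegativity gives the inequality.
      ∑-split : ∑[ ⟦ a , b ⟧ ] x + fromℕ d ≤ ∑[ ⟦ y , b ⟧ ] x + ∑[ ⟦ a , y ⟧ ] x
      ∑-split = ≤.≤-respˡ-≈ (trans (weighted-+ (λ i → 𝟙? (i ∈? ⟦ a , b ⟧)) (λ _ → 1) x)
                              (+-cong (sym (∑-weighted ⟦ a , b ⟧ x)) (trans (weighted-1 x) sum≈d)))
        (≤.≤-respʳ-≈ (trans (weighted-+ (λ i → 𝟙? (i ∈? ⟦ y , b ⟧)) (λ i → 𝟙? (i ∈? ⟦ a , y ⟧)) x)
                       (+-cong (sym (∑-weighted ⟦ y , b ⟧ x)) (sym (∑-weighted ⟦ a , y ⟧ x))))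
          (weighted-mono 0≤x pointwise))
        where
        pointwise : ∀ i → 𝟙? (i ∈? ⟦ a , b ⟧) ℕ.+ 1 ℕ.≤ 𝟙? (i ∈? ⟦ y , b ⟧) ℕ.+ 𝟙? (i ∈? ⟦ a , y ⟧)
        pointwise i with ∈⟦y,b⟧⊎∈⟦a,y⟧ y∉ i
        ... | inj₁ h = subst (ℕ._≤ 𝟙? (i ∈? ⟦ y , b ⟧) ℕ.+ 𝟙? (i ∈? ⟦ a , y ⟧))
            (ℕ.+-comm 1 (𝟙? (i ∈? ⟦ a , b ⟧))) (ℕ.+-mono-≤ (ℕ.≤-reflexive (≡.sym (𝟙?-yes (i ∈? ⟦ y , b ⟧) h)))
                         (𝟙?-mono (i ∈? ⟦ a , b ⟧) (i ∈? ⟦ a , y ⟧) (⟦a,b⟧⊆⟦a,y⟧ y∉)))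
        ... | inj₂ h = ℕ.+-mono-≤ (𝟙?-mono (i ∈? ⟦ a , b ⟧) (i ∈? ⟦ y , b ⟧) (⟦a,b⟧⊆⟦y,b⟧ y∉))
                         (ℕ.≤-reflexive (≡.sym (𝟙?-yes (i ∈? ⟦ a , y ⟧) h)))

      -- Adding the two hypotheses gives 2d on the right, and `∑-split` returns one d on the left;
      -- no arrow is lost, because none of them passes over y.
      bounded-join : Bounded ⟦ y , b ⟧ → Bounded ⟦ a , y ⟧ → Bounded ⟦ a , b ⟧
      bounded-join h₁ h₂ = ≤-from (+-mono (+-mono ∑-split (+-mono h₁ h₂))
          (≤.≤-respʳ-≈ (fromℕ-+ (ccw π (∁ ⟦ y , b ⟧)) (ccw π (∁ ⟦ a , y ⟧))) (fromℕ-mono ccw-split)))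
        (solve 7 (λ S c S₁ S₂ D c₁ c₂ → (S :+ c) :+ (((S₁ :+ S₂) :+ (D :+ D)) :+ (c₁ :+ c₂)) :=
                    D :+ (((S :+ D) :+ ((S₁ :+ c₁) :+ (S₂ :+ c₂))) :+ c))
          refl (∑[ ⟦ a , b ⟧ ] x) (fromℕ (ccw π (∁ ⟦ a , b ⟧))) (∑[ ⟦ y , b ⟧ ] x) (∑[ ⟦ a , y ⟧ ] x) (fromℕ d)
               (fromℕ (ccw π (∁ ⟦ y , b ⟧))) (fromℕ (ccw π (∁ ⟦ a , y ⟧))))

    -- Induction on the size of the complement: an uncovered y is added to both of the larger
    -- intervals.
    bounded-everywhere : (∀ a b → CoveredByCCWArrows π (∁ ⟦ a , b ⟧) → Bounded ⟦ a , b ⟧) → ∀ a b → Bounded ⟦ a , b ⟧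
    bounded-everywhere covered a b = go (suc ∣ ∁ ⟦ a , b ⟧ ∣) a b ℕ.≤-refl
      where
      go : ∀ k a b → ∣ ∁ ⟦ a , b ⟧ ∣ ℕ.< k → Bounded ⟦ a , b ⟧
      go (suc k) a b <k with any? (λ y → (y ∈? ∁ ⟦ a , b ⟧) ×-dec ¬?
          (any? λ z → (y ∈? ccwArrow π z) ×-dec (ccwArrow π z ⊆? ∁ ⟦ a , b ⟧)))
      ... | no  ∄y = covered a b λ y y∈ → by-cases y y∈
          (any? λ z → (y ∈? ccwArrow π z) ×-dec (ccwArrow π z ⊆? ∁ ⟦ a , b ⟧))
        where
        by-cases : ∀ y → y ∈ ∁ ⟦ a , b ⟧ → Dec (∃ λ z → y ∈ ccwArrow π z × ccwArrow π z ⊆ ∁ ⟦ a , b ⟧) →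
                   ∃ λ z → y ∈ ccwArrow π z × ccwArrow π z ⊆ ∁ ⟦ a , b ⟧
        by-cases y y∈ (yes w) = w
        by-cases y y∈ (no ∄z) = contradiction (y , y∈ , ∄z) ∄y
      ... | yes (y , y∈ , ∄z) = bounded-join y∉ (λ z out y∈z → ∄z (z , y∈z , out))
              (go k y b (shrink (⟦a,b⟧⊆⟦y,b⟧ y∉) (first∈⟦⟧ y b))) (go k a y (shrink (⟦a,b⟧⊆⟦a,y⟧ y∉) (last∈⟦⟧ a y)))
        where
        y∉ = x∈∁p⇒x∉p y∈
        shrink : ∀ {E : Subset n} → ⟦ a , b ⟧ ⊆ E → y ∈ E → ∣ ∁ E ∣ ℕ.< k
        shrink {E} ⊆E y∈E = ℕ.<-≤-trans (p⊂q⇒∣p∣<∣q∣ (p⊆q⇒∁p⊇∁q ⊆E , y , y∈ , λ h → x∈∁p⇒x∉p h y∈E)) (ℕ.s≤s⁻¹ <k)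

  -- Convex combinations of indicator vectors

  module _ {n} (x : Vector Carrier n) {m} (v : Fin m → Vector Carrier n) (w : Vector Carrier m)
    (0≤w : ∀ k → 0# ≤ w k) (sum-w : sum w ≈ 1#) (x≈ : ∀ i → x i ≈ sum (λ k → w k * v k i))
    (S : Fin m → Subset n) (v≈ : ∀ k i → v k i ≈ e⟨ S k ⟩ i) where

    weighted-conv : ∀ f → weighted f x ≈ sum (λ k → w k * fromℕ (sumℕ (λ i → f i ℕ.* 𝟙? (i ∈? S k))))
    weighted-conv f = begin
      sum (λ i → fromℕ (f i) * x i)
        ≈⟨ sum-cong (λ i → trans (*-congˡ {fromℕ (f i)} (x≈ i))
            (trans (*-sum (fromℕ (f i)) (λ k → w k * v k i)) (sum-cong (term i)))) ⟩
      sum (λ i → sum (λ k → w k * fromℕ (f i ℕ.* 𝟙? (i ∈? S k))))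
        ≈⟨ sum-swap (λ i k → w k * fromℕ (f i ℕ.* 𝟙? (i ∈? S k))) ⟩
      sum (λ k → sum (λ i → w k * fromℕ (f i ℕ.* 𝟙? (i ∈? S k))))
        ≈⟨ sum-cong (λ k → trans (sym (*-sum (w k) (λ i → fromℕ (f i ℕ.* 𝟙? (i ∈? S k)))))
                                 (*-congˡ {w k} (sym (fromℕ-sum (λ i → f i ℕ.* 𝟙? (i ∈? S k)))))) ⟩
      sum (λ k → w k * fromℕ (sumℕ (λ i → f i ℕ.* 𝟙? (i ∈? S k)))) ∎
      where
      term : ∀ i k → fromℕ (f i) * (w k * v k i) ≈ w k * fromℕ (f i ℕ.* 𝟙? (i ∈? S k))
      term i k = begin
        fromℕ (f i) * (w k * v k i)  ≈⟨ solve 3 (λ f w v → f :* (w :* v) := w :* (f :* v)) refl (fromℕ (f i))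
            (w k) (v k i) ⟩
        w k * (fromℕ (f i) * v k i)  ≈⟨ *-congˡ (*-congˡ (trans (v≈ k i) (e-indicator (S k) i))) ⟩
        w k * (fromℕ (f i) * fromℕ (𝟙? (i ∈? S k))) ≈⟨ *-congˡ (fromℕ-* (f i) (𝟙? (i ∈? S k))) ⟨
        w k * fromℕ (f i ℕ.* 𝟙? (i ∈? S k)) ∎

    average-const : ∀ y → sum (λ k → w k * y) ≈ y
    average-const y = trans (sum-cong λ k → *-comm (w k) y)
        (trans (sym (*-sum y w)) (trans (*-congˡ sum-w) (*-identityʳ y)))

    conv-nonneg : ∀ i → 0# ≤ x i
    conv-nonneg i = ≤.≤-respʳ-≈ (sym (x≈ i)) (sum-nonneg λ k → *-nonneg (0≤w k)
      (≤.≤-respʳ-≈ (sym (trans (v≈ k i) (e-indicator (S k) i))) (0≤fromℕ (𝟙? (i ∈? S k)))))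

    conv-sum : ∀ {d} → (∀ k → ∣ S k ∣ ≡ d) → sum x ≈ fromℕ d
    conv-sum {d} ∣S∣ = trans (sym (weighted-1 x)) (trans (weighted-conv (λ _ → 1)) (trans
      (sum-cong λ k → *-congˡ {w k} (reflexive
          (cong fromℕ (≡.trans (sumℕ-cong λ i → ℕ.*-identityˡ (𝟙? (i ∈? S k)))
              (≡.trans (≡.sym (size-∈? (S k))) (∣S∣ k))))))
      (average-const (fromℕ d))))

    conv-bound : ∀ {E r} → (∀ k → ∣ S k ∩ E ∣ ℕ.≤ r) → ∑[ E ] x ≤ fromℕ r
    conv-bound {E} {r} bound = ≤.≤-respˡ-≈ (sym (trans (∑-weighted E x) (weighted-conv (λ i → 𝟙? (i ∈? E)))))
      (≤.≤-respʳ-≈ (average-const (fromℕ r)) (sum-mono λ k → scale k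
        (fromℕ-mono (subst (ℕ._≤ r) (size-∩ (S k) E) (bound k)))))
      where
      scale : ∀ k {a b} → a ≤ b → w k * a ≤ w k * b
      scale k {a} {b} a≤b = ≤.≤-respʳ-≈ (trans (sym (distribˡ (w k) _ _)) (*-congˡ (trans (+-comm _ _) (x-y+y b a))))
        (≤.≤-respˡ-≈ (+-identityʳ _) (+-mono ≤.refl (*-nonneg (0≤w k) (x≤y⇒0≤y-x a≤b))))

theorem5p1 : ∀ {c ℓ} (ℝ : RealNumbers c ℓ) →
    let open RealNumbers ℝ
        open OverReals ℝ
    in
    (n d : ℕ) (M : Matroid n) → IsPositroid d M →
    Matroid.Loopless M → Matroid.Coloopless M →
    (π : Permutation′ n) → IsDecoratedPermutation M π →
    (x : Vector Carrier n) →
    matroidPolytope M x ⇔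
      ((∀ i → 0# ≤ x i) ×
       sum x ≈ fromℕ d ×
       (∀ (E : Subset n) → IsCyclicInterval E → CoveredByCCWArrows π (∁ E) →
         ∑[ E ] x ≤ fromℕ d - fromℕ (ccw π (∁ E))))
theorem5p1 ℝ n d M positroid@(A , _ , nonneg , basis⇔) loopless _ π decorated x = mk⇔ inequalities polytope
  where
  open RealNumbers ℝ hiding (zero)
  open OverReals ℝ
  open PositroidMinors ℝ
  open ThresholdRounding ℝ
  module ≤ = IsDecTotalOrder isDecTotalOrder
  open Positroid M A nonneg basis⇔
  open Rank M d size-basis
  open ArrowCount M d size-basis loopless π decorated

  d≈ : ∀ a b → fromℕ d ≈ fromℕ (rk M ⟦ a , b ⟧) + fromℕ (ccw π (∁ ⟦ a , b ⟧))
  d≈ a b = trans (reflexive (cong fromℕ (rk+ccw a b))) (fromℕ-+ (rk M ⟦ a , b ⟧) _)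

  Inequalities = (∀ i → 0# ≤ x i) × sum x ≈ fromℕ d ×
    (∀ (E : Subset n) → IsCyclicInterval E → CoveredByCCWArrows π (∁ E) → ∑[ E ] x ≤ fromℕ d - fromℕ (ccw π (∁ E)))

  inequalities : matroidPolytope M x → Inequalities
  inequalities (m , v , w , P , 0≤w , sum-w , x≈) =
      conv-nonneg ℝ x v w 0≤w sum-w x≈ S v≈
    , conv-sum ℝ x v w 0≤w sum-w x≈ S v≈ (λ k → size-basis (basis k))
    -- By `rk+ccw` the right-hand side is the rank of E, and the part of a basis inside E is an
    -- independent subset of E.
    , λ { E (a , b , ≡.refl) _ → ≤.≤-respʳ-≈ (+-cancelʳ (fromℕ (ccw π (∁ ⟦ a , b ⟧)))
            (trans (sym (d≈ a b)) (sym (x-y+y (fromℕ d) (fromℕ (ccw π (∁ ⟦ a , b ⟧)))))))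
          (conv-bound ℝ x v w 0≤w sum-w x≈ S v≈ λ k → size≤rk (S k , basis k , p∩q⊆p (S k) _) (p∩q⊆q (S k) _)) }
    where
    S = λ k → proj₁ (P k)
    basis = λ k → proj₁ (proj₂ (P k))
    v≈ = λ k → proj₂ (proj₂ (P k))

  polytope : Inequalities → matroidPolytope M x
  polytope (0≤x , sum≈d , bound) = RoundToSubsets.in-conv ℝ x 0≤x sum≈d (λ a b → rk M ⟦ a , b ⟧)
    (λ i → rk≤ λ _ I⊆ → ℕ.≤-trans (p⊆q⇒∣p∣≤∣q∣ I⊆) (ℕ.≤-reflexive (≡.trans (cong ∣_∣ (⟦b,b⟧≡⁅b⁆ i)) (∣⁅x⁆∣≡1 i))))
    rk-bound
    (interval-ranks⇒basis ℝ d M positroid)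
    where
    covered-bound : ∀ a b → CoveredByCCWArrows π (∁ ⟦ a , b ⟧) → Bounded ℝ d π x 0≤x sum≈d ⟦ a , b ⟧
    covered-bound a b cov = ≤.≤-respʳ-≈ (x-y+y (fromℕ d) _)
        (+-monoˡ-≤ (fromℕ (ccw π (∁ ⟦ a , b ⟧))) (bound _ (a , b , ≡.refl) cov))
    rk-bound : ∀ a b → ∑[ ⟦ a , b ⟧ ] x ≤ fromℕ (rk M ⟦ a , b ⟧)
    rk-bound a b = +-cancelʳ-≤ (fromℕ (ccw π (∁ ⟦ a , b ⟧)))
      (≤.≤-respʳ-≈ (d≈ a b) (bounded-everywhere ℝ d π x 0≤x sum≈d covered-bound a b))
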